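{- Let $G=(V,E)$ be a graph and $T\subseteq V$ a nonempty subset of even cardinality. Then the linear system in variables $x\in\mathbb{R}^E$ $$x(J)\geq 1 \ \text{ for all $T$-joins } J;\qquad x\geq \mathbf{0}$$ is totally dual dyadic; that is, writing it as the integral system $-x(J)\leq -1$ (for all $T$-joins $J$), $-x_e\leq 0$ (for all $e\in E$), this system is totally dual dyadic.
   Context: For $J\subseteq E$, $x(J):=\sum_{e\in J}x_e$. A $T$-join is a subset $J\subseteq E$ such that the set of vertices of odd degree in the subgraph $(V,J)$ is exactly $T$. A dyadic rational is a number of the form $a/2^k$ with $a,k$ integers and $k\geq 0$; a vector is dyadic if all its entries are. A system $Ax\leq b$ with $A,b$ integral is totally dual dyadic if for every integral $w$ for which $\min\{b^\top y: A^\top y=w,\ y\geq \mathbf{0}\}$ has an optimal solution, it has a dyadic optimal solution.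
   Formalization: The dual linear program is posed over the rationals: the optimal solution assumed to exist and the feasible solutions it is compared with are rational vectors rather than real ones; since A, b and w are integral, standard LP theory gives the real version. -}

module Defs where

open import Data.Nat as ℕ using (ℕ; zero; suc; _%_; _^_)
open import Data.Integer as ℤ using (ℤ)
open import Data.Rational as ℚ using (ℚ; 0ℚ; 1ℚ; _/_)
open import Data.Bool using (Bool; true; false; if_then_else_)
open import Data.Fin using (Fin; _≟_)
open import Data.Fin.Subset using (Subset; Nonempty; ∣_∣; _∈_)
open import Data.Vec using (Vec; []; _∷_; lookup)
open import Data.List using (List; []; _∷_; map; _++_; foldr)
open import Data.Product using (_×_; _,_; proj₁; proj₂; Σ; ∃; ∃-syntax)
open import Relation.Binary.PropositionalEquality using (_≡_; _≢_)
open import Relation.Nullary using (¬_; Dec; yes; no)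
open import Function.Bundles using (_⇔_)

record Graph : Set where
  field
    n    : ℕ
    m    : ℕ
    ends : Fin m → Fin n × Fin n
    loopless : ∀ e → proj₁ (ends e) ≢ proj₂ (ends e)
open Graph public

sumFinℕ : ∀ k → (Fin k → ℕ) → ℕ
sumFinℕ zero    f = 0
sumFinℕ (suc k) f = f Data.Fin.zero ℕ.+ sumFinℕ k (λ i → f (Data.Fin.suc i))

sumFinℚ : ∀ k → (Fin k → ℚ) → ℚ
sumFinℚ zero    f = 0ℚ
sumFinℚ (suc k) f = f Data.Fin.zero ℚ.+ sumFinℚ k (λ i → f (Data.Fin.suc i))

sumListℚ : ∀ {A : Set} → List A → (A → ℚ) → ℚ
sumListℚ xs f = foldr (λ a s → f a ℚ.+ s) 0ℚ xs

[_]ᵈ : ∀ {P : Set} → Dec P → ℕ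
[ yes _ ]ᵈ = 1
[ no _ ]ᵈ  = 0

bool→ℕ : Bool → ℕ
bool→ℕ true  = 1
bool→ℕ false = 0

bool→ℚ : Bool → ℚ
bool→ℚ true  = 1ℚ
bool→ℚ false = 0ℚ

-- number of ends of edge e equal to vertex v (0 or 1, since loopless)
incidence : (G : Graph) → Fin (m G) → Fin (n G) → ℕ
incidence G e v = [ proj₁ (ends G e) ≟ v ]ᵈ ℕ.+ [ proj₂ (ends G e) ≟ v ]ᵈ

degree : (G : Graph) → Subset (m G) → Fin (n G) → ℕ
degree G J v = sumFinℕ (m G) (λ e → bool→ℕ (lookup J e) ℕ.* incidence G e v)

OddNat : ℕ → Set
OddNat d = d % 2 ≡ 1

IsTJoin : (G : Graph) → Subset (n G) → Subset (m G) → Set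
IsTJoin G T J = ∀ v → (OddNat (degree G J v) ⇔ (v ∈ T))

allSubsets : ∀ k → List (Subset k)
allSubsets zero    = [] ∷ []
allSubsets (suc k) = map (true ∷_) (allSubsets k) ++ map (false ∷_) (allSubsets k)

Dyadic : ℚ → Set
Dyadic q = ∃[ k ] ℚ.denominatorℕ q ≡ 2 ^ k

ℤ→ℚ : ℤ → ℚ
ℤ→ℚ a = a / 1

-- The dual of  min/max over the system  -x(J) ≤ -1 (J a T-join), -x_e ≤ 0.
-- Dual variables: y_J ≥ 0 for every T-join J (y is a function on all
-- subsets, required to vanish off T-joins), and z_e ≥ 0 for every edge.
-- A^T (y,z) = w reads:  for every e,  - Σ_{J ∋ e} y_J - z_e = w_e.
-- Objective b^T (y,z) = - Σ_J y_J.

record DualVec (G : Graph) : Set where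
  constructor dualVec
  field
    y : Subset (m G) → ℚ
    z : Fin (m G) → ℚ
open DualVec public

DualFeasible : (G : Graph) → Subset (n G) → (Fin (m G) → ℤ) → DualVec G → Set
DualFeasible G T w d =
    (∀ J → 0ℚ ℚ.≤ y d J)
  × (∀ J → ¬ IsTJoin G T J → y d J ≡ 0ℚ)
  × (∀ e → 0ℚ ℚ.≤ z d e)
  × (∀ e → ℚ.- (sumListℚ (allSubsets (m G)) (λ J → bool→ℚ (lookup J e) ℚ.* y d J))
             ℚ.- z d e
           ≡ ℤ→ℚ (w e))

dualObjective : (G : Graph) → DualVec G → ℚ
dualObjective G d = ℚ.- sumListℚ (allSubsets (m G)) (y d)

DualOptimal : (G : Graph) → Subset (n G) → (Fin (m G) → ℤ) → DualVec G → Set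
DualOptimal G T w d =
  DualFeasible G T w d ×
  (∀ d' → DualFeasible G T w d' → dualObjective G d ℚ.≤ dualObjective G d')

DyadicVec : (G : Graph) → DualVec G → Set
DyadicVec G d = (∀ J → Dyadic (y d J)) × (∀ e → Dyadic (z d e))

TJoinSystemTDD : (G : Graph) → Subset (n G) → Set
TJoinSystemTDD G T =
  ∀ (w : Fin (m G) → ℤ) →
    (∃[ d ] DualOptimal G T w d) →
    ∃[ d ] (DualOptimal G T w d × DyadicVec G d)

EvenNat : ℕ → Set
EvenNat k = k % 2 ≡ 0

{-# OPTIONS --safe #-}
-- Write c = -w and let τ be the least weight of an odd cut. By weak duality it suffices to find,
-- for some k, a list of 2^k τ T-joins that uses every edge e at most 2^k c(e) times; call (c , τ)
-- good in that case. Every (c , τ) in the cone cut out by the inequalities c ≥ 0, τ ≥ 0 and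
-- c(U) ≥ τ for all odd cuts U is good, by induction on the number of vertices and then on the
-- number of inequalities c(e) ≥ 0 and c(star v) ≥ τ that are not tight.
--
-- If a tight odd cut has two vertices on each side, contract either side and glue the packings.
-- Otherwise look for a join J compatible with (c , τ): one in the support of c that meets every
-- tight star once. If a tight vertex has a single edge, contract that edge. If it has two, both
-- leading to tight vertices, a compatible join is found directly. Otherwise a count of the edges at
-- the tight vertices shows that the support has more edges than there are tight vertices; then
-- move along a vector orthogonal to all tight stars to a point on the boundary of the cone, which
-- is good by induction, and take J from its packing.
--
-- Now move from (c , τ) along -J until the boundary of the cone is reached. If the inequality met
-- there grows along J by 1, 2 or 4, the step is dyadic up to scaling and the induction applies.
-- Otherwise it belongs to a cut U with |J ∩ U| ≥ 7. The traces on U of the compatible joins on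
-- either side of U satisfy the exchange axiom of even delta-matroids and contain J ∩ U and its
-- singletons; two such families share a set of three or five elements. So some compatible join
-- crosses U in three or five edges, and after following J to a dyadic point next to the boundary
-- one continues along that join, which reduces the set of inequalities that can be met.
--
-- If two such families share no set of three or five elements, colour a triple red or blue
-- according to the family that contains it: no four elements span exactly one triple of a colour.
-- In the link of an element this gives a colouring of pairs without rainbow triangles and without
-- paths of either colour on four vertices, which therefore always splits into two parts with no
-- edge of one colour between them; descending along these splits to smaller and smaller modules
-- ends in a contradiction.

module Submission where

open import Defs using (allSubsets)
open import Data.Bool as Bool using (Bool; _xor_; _∧_; _∨_; false; not; true)
import Data.Bool.Properties as Boolₚ
open import Data.Bool.Solver using (module xor-∧-Solver)
open import Data.Nat as ℕ using (suc; s≤s; zero; z≤n; ℕ)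
import Data.Nat.Properties as ℕₚ
open import Data.Nat.Induction using (<-wellFounded)
open import Data.Nat.Divisibility as Div using (divides)
open import Data.Nat.Primality using (euclidsLemma; prime[2])
open import Data.Integer as ℤ using (+_; +≤+; -_; 0ℤ; 1ℤ; _*_; _+_; _-_; _<_; _≤_; ℤ)
import Data.Integer.Properties as ℤₚ
open import Data.Integer.Tactic.RingSolver using (solve-∀)
import Data.Integer.GCD as ℤ-GCD
open import Data.Rational as ℚ using (0ℚ; ℚ)
import Data.Rational.Properties as ℚₚ
open import Data.Rational.Unnormalised as ℚᵘ using (*≡*; *≤*; mkℚᵘ; ℚᵘ)
import Data.Rational.Unnormalised.Properties as ℚᵘₚ
open import Data.Fin as Fin using (Fin; suc; zero)
import Data.Fin.Properties as Finₚ
open import Data.Fin.Subset using (Nonempty; Subset; ∣_∣)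
open import Data.Fin.Subset.Properties using (anySubset?)
open import Data.List using (List; []; _++_; _∷_; allFin; filter; length; map; replicate)
open import Data.List.Properties as Listₚ using (filter-notAll)
open import Data.List.Membership.Propositional using (_∈_; _∉_; find; lose)
open import Data.List.Membership.Propositional.Properties using (∈-++⁺ʳ; ∈-++⁺ˡ; ∈-++⁻; ∈-allFin; ∈-filter⁺; ∈-filter⁻; ∈-map⁺; ∈-map⁻; ∈-∃++)
open import Data.List.Relation.Unary.Any as Any using (Any; any?; here; there)
open import Data.List.Relation.Unary.All as All using (All; []; _∷_)
open import Data.List.Relation.Unary.AllPairs using ([]; _∷_)
open import Data.List.Relation.Unary.Unique.Propositional using (Unique)
import Data.List.Relation.Unary.Unique.Propositional.Properties as Uniqueₚ
import Data.List.Relation.Unary.All.Properties as Allₚ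
open import Data.Vec using ([]; _∷_; lookup; tabulate)
open import Data.Vec.Properties using ([]=⇒lookup; lookup⇒[]=; lookup∘tabulate)
open import Data.Product using (_,_; _×_; proj₁; proj₂; Σ; ∃)
open import Data.Sum as Sum using (_⊎_; inj₁; inj₂)
open import Data.Empty using (⊥; ⊥-elim)
open import Data.Unit using (tt; ⊤)
open import Relation.Nullary using (Dec; contradiction; does; no; yes; ¬_)
open import Relation.Nullary.Decidable using (_×-dec_; _→-dec_; _⊎-dec_; dec-false; dec-true; toSum; ¬?)
open import Relation.Unary using (Decidable)
open import Relation.Binary.PropositionalEquality hiding (J)
open import Induction.WellFounded using (Acc; acc)
open import Function using (_∘_)
open import Function.Bundles using (Equivalence; mk⇔)
import Algebra.Properties.Semiring.Sum as SemiringSum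
open import Algebra.Bundles using (module AbelianGroup; module CommutativeRing)
open import Algebra.Properties.Group (AbelianGroup.group ℤₚ.+-0-abelianGroup) using ()
  renaming (∙-cancelˡ to +-cancelˡ; ∙-cancelʳ to +-cancelʳ)
open import Algebra.Properties.Group ℚₚ.+-0-group using (⁻¹-involutive)

-- Two-coloured triple systems

-- Moving from q along -J to an inequality of slack a and slope b leads, after clearing
-- denominators, to b q - a J. A packing there turns into one of q at the price of a factor b in the
-- denominator, so slopes that are powers of two are harmless. A join meets an odd cut in an odd
-- number of edges, and the slope of the cut is one less: 3 and 5 edges give 2 and 4, but 7 edges
-- give 6. This is the obstacle that shapes the proof, and the origin of the numbers three and five.
-- J may be replaced by any compatible join, since all of them keep the tight inequalities tight.
-- The two sides of U are independent of each other: a half on one side combines with every half on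
-- the other side that has the same trace on U, so a common trace is all that has to be found. The
-- exchange property comes from trails in the symmetric difference of two halves, and the singletons
-- from the packing at the boundary point, whose joins all cross the tight cut U once. With τ as a
-- coordinate the problem is homogeneous. Points can be scaled to stay integral, and rational
-- numbers enter only at the end.

data Colour : Set where
  red blue neither : Colour

opp : Colour → Colour
opp red = blue
opp blue = red
opp neither = neither

_≟ᶜ_ : (c d : Colour) → Dec (c ≡ d)
red ≟ᶜ red = yes refl
red ≟ᶜ blue = no λ ()
red ≟ᶜ neither = no λ ()
blue ≟ᶜ red = no λ ()
blue ≟ᶜ blue = yes refl
blue ≟ᶜ neither = no λ ()
neither ≟ᶜ red = no λ ()
neither ≟ᶜ blue = no λ ()
neither ≟ᶜ neither = yes refl

exactlyOne : Bool → Bool → Bool → Bool → Bool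
exactlyOne true q r s = not (q ∨ r ∨ s)
exactlyOne false true r s = not (r ∨ s)
exactlyOne false false true s = not s
exactlyOne false false false s = s

-- The arguments stand for the colours of the four triples in a set of four elements.
balanced : Colour → Colour → Colour → Colour → Bool
balanced w x y z = not (one red) ∧ not (one blue)
  where
  one : Colour → Bool
  one c = exactlyOne (does (w ≟ᶜ c)) (does (x ≟ᶜ c)) (does (y ≟ᶜ c)) (does (z ≟ᶜ c))

data Chromatic : Colour → Set where
  isRed : Chromatic red
  isBlue : Chromatic blue

opp-chromatic : ∀ {c} → Chromatic c → Chromatic (opp c)
opp-chromatic isRed = isBlue
opp-chromatic isBlue = isRed

opp≢ : ∀ {c} → Chromatic c → opp c ≢ c
opp≢ isRed ()
opp≢ isBlue ()

third-colour : ∀ {c d} → Chromatic c → d ≢ c → d ≢ opp c → d ≡ neither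
third-colour {d = red} isRed p q = contradiction refl p
third-colour {d = blue} isRed p q = contradiction refl q
third-colour {d = neither} isRed p q = refl
third-colour {d = red} isBlue p q = contradiction refl q
third-colour {d = blue} isBlue p q = contradiction refl p
third-colour {d = neither} isBlue p q = refl

-- If `z` were blank, both `c` and `opp c` would need a second occurrence, and the one remaining
-- entry `w` can supply only one of them.
no-rainbow : ∀ {c z w} → Chromatic c → balanced c z (opp c) w ≡ true → z ≢ neither
no-rainbow {w = red} isRed () refl
no-rainbow {w = blue} isRed () refl
no-rainbow {w = neither} isRed () refl
no-rainbow {w = red} isBlue () refl
no-rainbow {w = blue} isBlue () refl
no-rainbow {w = neither} isBlue () refl

lonely : ∀ {c s t} → Chromatic c → s ≢ c → t ≢ c → balanced (opp c) s t c ≡ false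
lonely {s = red} isRed p q = contradiction refl p
lonely {s = blue} {t = red} isRed p q = contradiction refl q
lonely {s = blue} {t = blue} isRed p q = refl
lonely {s = blue} {t = neither} isRed p q = refl
lonely {s = neither} {t = red} isRed p q = contradiction refl q
lonely {s = neither} {t = blue} isRed p q = refl
lonely {s = neither} {t = neither} isRed p q = refl
lonely {s = blue} isBlue p q = contradiction refl p
lonely {s = red} {t = blue} isBlue p q = contradiction refl q
lonely {s = red} {t = red} isBlue p q = refl
lonely {s = red} {t = neither} isBlue p q = refl
lonely {s = neither} {t = blue} isBlue p q = contradiction refl q
lonely {s = neither} {t = red} isBlue p q = refl
lonely {s = neither} {t = neither} isBlue p q = refl

-- Both colours need a second occurrence, and two equal entries can serve only one of them.
lonely-twin : ∀ {c} s → Chromatic c → balanced (opp c) s s c ≡ false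
lonely-twin red isRed = refl
lonely-twin blue isRed = refl
lonely-twin neither isRed = refl
lonely-twin red isBlue = refl
lonely-twin blue isBlue = refl
lonely-twin neither isBlue = refl

twin-colour : ∀ {c s} → Chromatic c → balanced neither s s c ≡ true → s ≡ c
twin-colour {s = red} isRed p = refl
twin-colour {s = blue} isRed ()
twin-colour {s = neither} isRed ()
twin-colour {s = red} isBlue ()
twin-colour {s = blue} isBlue p = refl
twin-colour {s = neither} isBlue ()

-- Each hypothesis forces its last two entries to be red and blue in some order, and three entries
-- in two colours cannot differ pairwise.
twin-clash : ∀ s t u → balanced red blue s t ≡ true → balanced red blue s u ≡ true →
             balanced red blue t u ≡ true → ⊥
twin-clash red red _ () _ _
twin-clash red blue red _ () _
twin-clash red blue blue _ _ ()
twin-clash red blue neither _ () _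
twin-clash red neither _ () _ _
twin-clash blue red red _ _ ()
twin-clash blue red blue _ () _
twin-clash blue red neither _ () _
twin-clash blue blue _ () _ _
twin-clash blue neither _ () _ _
twin-clash neither red _ () _ _
twin-clash neither blue _ () _ _
twin-clash neither neither _ () _ _

module _ {N : ℕ} (X : Fin N → Set) (col : Fin N → Fin N → Fin N → Colour) where

  record Distinct₃ (a b c : Fin N) : Set where
    constructor distinct₃
    field
      a≢b : a ≢ b
      a≢c : a ≢ c
      b≢c : b ≢ c
      a∈ : X a
      b∈ : X b
      c∈ : X c

  -- In `pentagon-free` the pairs that form a red triple with `e` are the edges of the path
  -- `q p v z`, and those that form a blue one are the edges of the complementary path `v q z p`.
  record TripleSystem : Set where
    field
      swap₁₂ : ∀ a b c → col a b c ≡ col b a c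
      swap₂₃ : ∀ a b c → col a b c ≡ col a c b
      four : ∀ {a b c d} → Distinct₃ a b c → Distinct₃ a b d → Distinct₃ a c d → Distinct₃ b c d →
             balanced (col a b c) (col a b d) (col a c d) (col b c d) ≡ true
      pentagon-free : ∀ {e q p v z} →
        Distinct₃ e q p → Distinct₃ e p v → Distinct₃ e v z →
        Distinct₃ e q v → Distinct₃ e q z → Distinct₃ e p z →
        col e q p ≡ red → col e p v ≡ red → col e v z ≡ red →
        col e q v ≡ blue → col e q z ≡ blue → col e p z ≡ blue → ⊥
      extend : ∀ {c} → Chromatic c → ∀ {a b} → a ≢ b → X a → X b →
               ∃ λ x → Distinct₃ a b x × col a b x ≡ c

  module Link (S : TripleSystem) (e : Fin N) (e∈ : X e) where
    open TripleSystem S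

    ℓ : Fin N → Fin N → Colour
    ℓ = col e

    ℓ-sym : ∀ x y → ℓ x y ≡ ℓ y x
    ℓ-sym = swap₂₃ e

    record Vertex (x : Fin N) : Set where
      constructor vertex
      field
        x∈ : X x
        e≢x : e ≢ x
    open Vertex

    link₃ : ∀ {x y} → Vertex x → Vertex y → x ≢ y → Distinct₃ e x y
    link₃ vx vy x≢y = distinct₃ (e≢x vx) (e≢x vy) x≢y e∈ (x∈ vx) (x∈ vy)

    base₃ : ∀ {x y z} → Vertex x → Vertex y → Vertex z → x ≢ y → x ≢ z → y ≢ z → Distinct₃ x y z
    base₃ vx vy vz p q r = distinct₃ p q r (x∈ vx) (x∈ vy) (x∈ vz)

    tetra : ∀ {x y z} → Vertex x → Vertex y → Vertex z → x ≢ y → x ≢ z → y ≢ z →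
            balanced (ℓ x y) (ℓ x z) (ℓ y z) (col x y z) ≡ true
    tetra vx vy vz p q r = four (link₃ vx vy p) (link₃ vx vz q) (link₃ vy vz r) (base₃ vx vy vz p q r)

    -- In the four-element set `e`, `x`, `y`, `z` the triple `x y z` cannot balance both colours.
    -- Colourings of pairs without rainbow triangles are known as Gallai colourings.
    gallai : ∀ {c x y z} → Chromatic c → Vertex x → Vertex y → Vertex z → x ≢ y → x ≢ z → y ≢ z →
             ℓ x y ≡ c → ℓ y z ≡ opp c → ℓ x z ≢ neither
    gallai {c} {x} {y} {z} ch vx vy vz p q r xy yz =
      no-rainbow {z = ℓ x z} {col x y z} ch (subst₂ (λ s t → balanced s (ℓ x z) t (col x y z) ≡ true) xy yz (tetra vx vy vz p q r))

    path-free : ∀ {c q p v z} → Chromatic c → Vertex q → Vertex p → Vertex v → Vertex z →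
                q ≢ p → p ≢ v → v ≢ z → q ≢ v → q ≢ z → p ≢ z →
                ℓ q p ≡ c → ℓ p v ≡ c → ℓ v z ≡ c → ℓ q v ≡ opp c → ℓ q z ≡ opp c → ℓ p z ≡ opp c → ⊥
    path-free isRed vq vp vv vz qp pv vz' qv qz pz =
      pentagon-free (link₃ vq vp qp) (link₃ vp vv pv) (link₃ vv vz vz') (link₃ vq vv qv) (link₃ vq vz qz) (link₃ vp vz pz)
    -- The complement of a path on four vertices is again such a path.
    path-free {q = q} {p} {v} {z} isBlue vq vp vv vz qp pv vz' qv qz pz eqp epv evz eqv eqz epz =
      pentagon-free (link₃ vv vq (qv ∘ sym)) (link₃ vq vz qz) (link₃ vz vp (pz ∘ sym))
        (link₃ vv vz vz') (link₃ vv vp (pv ∘ sym)) (link₃ vq vp qp)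
        (trans (ℓ-sym v q) eqv) eqz (trans (ℓ-sym z p) epz) evz (trans (ℓ-sym v p) epv) eqp

    Vertices : List (Fin N) → Set
    Vertices = All Vertex

    record Split (V : List (Fin N)) : Set where
      constructor split
      field
        {c} : Colour
        chromatic : Chromatic c
        side : Fin N → Bool
        inside : ∃ λ x → x ∈ V × side x ≡ true
        outside : ∃ λ x → x ∈ V × side x ≡ false
        separated : ∀ {x y} → x ∈ V → y ∈ V → side x ≡ true → side y ≡ false → ℓ x y ≢ c

    flip-side : ∀ {V} → Split V → Split V
    flip-side (split {c} ch s (x , x∈V , sx) (y , y∈V , sy) sep) =
      split ch (not ∘ s) (y , y∈V , cong not sy) (x , x∈V , cong not sx)
        λ {u} {w} u∈ w∈ su sw → λ eq → sep w∈ u∈ (not-true sw) (not-false su) (trans (ℓ-sym w u) eq)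
      where
      not-true : ∀ {b} → not b ≡ false → b ≡ true
      not-true {true} _ = refl
      not-false : ∀ {b} → not b ≡ true → b ≡ false
      not-false {false} _ = refl

    eqᵇ : Colour → Colour → Bool
    eqᵇ c d with c ≟ᶜ d
    ... | yes _ = true
    ... | no _ = false

    eqᵇ-true : ∀ {c d} → eqᵇ c d ≡ true → c ≡ d
    eqᵇ-true {c} {d} p with c ≟ᶜ d
    ... | yes q = q

    eqᵇ-false : ∀ {c d} → eqᵇ c d ≡ false → c ≢ d
    eqᵇ-false {c} {d} p with c ≟ᶜ d
    ... | no q = q

    eqᵇ-refl : ∀ {c d} → c ≡ d → eqᵇ c d ≡ true
    eqᵇ-refl {c} {d} p with c ≟ᶜ d
    ... | yes _ = refl
    ... | no q = contradiction p q

    search : ∀ (P : Fin N → Set) → (∀ x → Dec (P x)) → Dec (∃ P)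
    search P P? = Finₚ.any? P?

    _∈?_ : (x : Fin N) (V : List (Fin N)) → Dec (x ∈ V)
    x ∈? V = any? (x Fin.≟_) V

    override : Fin N → Bool → (Fin N → Bool) → Fin N → Bool
    override v b s x with x Fin.≟ v
    ... | yes _ = b
    ... | no _ = s x

    override-here : ∀ v b s → override v b s v ≡ b
    override-here v b s with v Fin.≟ v
    ... | yes _ = refl
    ... | no q = contradiction refl q

    override-there : ∀ {v x} b s → x ≢ v → override v b s x ≡ s x
    override-there {v} {x} b s p with x Fin.≟ v
    ... | yes q = contradiction q p
    ... | no _ = refl

    member≢ : ∀ {v} {V : List (Fin N)} → All (v ≢_) V → ∀ {x} → x ∈ V → x ≢ v
    member≢ fresh x∈V refl = All.lookup fresh x∈V refl

    module AddVertex {v : Fin N} {V : List (Fin N)} (vv : Vertex v) (vV : Vertices V)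
                     (fresh : All (v ≢_) V) where

      ≢v : ∀ {x} → x ∈ V → x ≢ v
      ≢v = member≢ fresh

      vert : ∀ {x} → x ∈ V → Vertex x
      vert = All.lookup vV

      isolate : ∀ {c} → Chromatic c → (∃ λ x → x ∈ V) → (∀ {x} → x ∈ V → ℓ v x ≢ c) → Split (v ∷ V)
      isolate {c} ch (w , w∈V) free = split ch s (v , here refl , override-here v true _)
          (w , there w∈V , override-there true _ (≢v w∈V)) sep
        where
        s = override v true (λ _ → false)
        sep : ∀ {x y} → x ∈ v ∷ V → y ∈ v ∷ V → s x ≡ true → s y ≡ false → ℓ x y ≢ c
        sep (here refl) (here refl) sx sy = contradiction (trans (sym sx) sy) λ ()
        sep (here refl) (there y∈) sx sy = free y∈
        sep (there x∈) _ sx sy = contradiction (trans (sym sx) (override-there true _ (≢v x∈))) λ ()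

      attach : ∀ {c} → Chromatic c → (s : Fin N → Bool) →
               (∃ λ x → x ∈ V × s x ≡ true) → (∃ λ x → x ∈ V × s x ≡ false) →
               (∀ {x y} → x ∈ V → y ∈ V → s x ≡ true → s y ≡ false → ℓ x y ≢ c) →
               (∀ {x} → x ∈ V → s x ≡ true → ℓ v x ≢ c) → Split (v ∷ V)
      attach {c} ch s (x , x∈V , sx) (y , y∈V , sy) sep free = split ch t
          (x , there x∈V , trans (override-there false s (≢v x∈V)) sx)
          (y , there y∈V , trans (override-there false s (≢v y∈V)) sy) sep′
        where
        t = override v false s
        sep′ : ∀ {x y} → x ∈ v ∷ V → y ∈ v ∷ V → t x ≡ true → t y ≡ false → ℓ x y ≢ c
        sep′ (here refl) _ tx ty = contradiction (trans (sym tx) (override-here v false s)) λ ()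
        sep′ (there x∈) (here refl) tx ty eq =
          free x∈ (trans (sym (override-there false s (≢v x∈))) tx) (trans (ℓ-sym v _) eq)
        sep′ (there x∈) (there y∈) tx ty =
          sep x∈ y∈ (trans (sym (override-there false s (≢v x∈))) tx)
                    (trans (sym (override-there false s (≢v y∈))) ty)

      -- If v has c-neighbours on both sides and an opp c-neighbour on the true side, then
      -- the opp c-neighbours of v on the true side have no c-edges to anything else.
      carve : (S : Split V) → ∀ {z w} →
              z ∈ V → Split.side S z ≡ false → ℓ v z ≡ Split.c S →
              w ∈ V → Split.side S w ≡ true → ℓ v w ≡ opp (Split.c S) → Split (v ∷ V)
      carve S {z} {w} z∈V sz vz w∈V sw vw = split chromatic t
          (w , there w∈V , trans (override-there false _ (≢v w∈V)) (side-w))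
          (v , here refl , override-here v false _) sep
        where
        open Split S
        s₀ : Fin N → Bool
        s₀ x = side x Bool.∧ eqᵇ (ℓ v x) (opp c)
        t = override v false s₀
        side-w : s₀ w ≡ true
        side-w rewrite sw = eqᵇ-refl vw
        ∧-left : ∀ {a b} → a Bool.∧ b ≡ true → a ≡ true
        ∧-left {true} _ = refl
        ∧-right : ∀ {a b} → a Bool.∧ b ≡ true → b ≡ true
        ∧-right {true} p = p
        ∧-false : ∀ {a b} → a ≡ true → a Bool.∧ b ≡ false → b ≡ false
        ∧-false refl p = p
        sep : ∀ {x y} → x ∈ v ∷ V → y ∈ v ∷ V → t x ≡ true → t y ≡ false → ℓ x y ≢ c
        sep (here refl) _ tx _ = contradiction (trans (sym tx) (override-here v false s₀)) λ ()
        sep {q} (there q∈) y∈ tx ty = go y∈ ty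
          where
          s₀q = trans (sym (override-there false s₀ (≢v q∈))) tx
          sq : side q ≡ true
          sq = ∧-left s₀q
          vq : ℓ v q ≡ opp c
          vq = eqᵇ-true (∧-right {side q} s₀q)
          qv = trans (ℓ-sym q v) vq
          go : ∀ {p} → p ∈ v ∷ V → t p ≡ false → ℓ q p ≢ c
          go (here refl) _ eq = opp≢ chromatic (trans (sym qv) eq)
          go {p} (there p∈) tp eq with side p in sp
          ... | false = separated q∈ p∈ sq sp eq
          ... | true with ℓ v p ≟ᶜ c
          -- As `p` is not carved off, `v p` is not `opp c` either; it must be blank, and the
          -- triangle `p q v` is rainbow.
          ...   | no vp≢c = gallai chromatic (vert p∈) (vert q∈) vv (q≢p ∘ sym) (≢v p∈) (≢v q∈)
                              (trans (ℓ-sym p q) eq) qv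
                              (trans (ℓ-sym p v) (third-colour chromatic vp≢c vp≢o))
            where
            vp≢o : ℓ v p ≢ opp c
            vp≢o = eqᵇ-false (∧-false sp (trans (sym (override-there false s₀ (≢v p∈))) tp))
            q≢p : q ≢ p
            q≢p refl = vp≢o vq
          -- Now `q p v z` is a path in colour `c`. Its complement has colour `opp c`: no pair
          -- between the sides of `S` has colour `c`, and two triangles rule out blank pairs.
          ...   | yes vp = path-free chromatic (vert q∈) (vert p∈) vv (vert z∈V)
                             q≢p (≢v p∈) (≢v z∈V ∘ sym) (≢v q∈) q≢z p≢z eq (trans (ℓ-sym p v) vp) vz qv qz pz
            where
            q≢p : q ≢ p
            q≢p refl = opp≢ chromatic (trans (sym vq) vp)
            q≢z : q ≢ z
            q≢z refl = contradiction (trans (sym sq) sz) λ ()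
            p≢z : p ≢ z
            p≢z refl = contradiction (trans (sym sp) sz) λ ()
            zv = trans (ℓ-sym z v) vz
            only : ∀ {d} → d ≢ c → d ≢ neither → d ≡ opp c
            only {d} a b with d ≟ᶜ opp c
            ... | yes r = r
            ... | no r = contradiction (third-colour chromatic a r) b
            qz : ℓ q z ≡ opp c
            qz = only (separated q∈ z∈V sq sz)
                   (λ n → gallai chromatic (vert z∈V) vv (vert q∈) (≢v z∈V) (q≢z ∘ sym) (≢v q∈ ∘ sym)
                            zv vq (trans (ℓ-sym z q) n))
            pz : ℓ p z ≡ opp c
            pz = only (separated p∈ z∈V sp sz)
                   (gallai chromatic (vert p∈) (vert q∈) (vert z∈V) (q≢p ∘ sym) p≢z q≢z (trans (ℓ-sym p q) eq) qz)

      neighbour? : ∀ (s : Fin N → Bool) b d → Dec (∃ λ x → x ∈ V × s x ≡ b × ℓ v x ≡ d)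
      neighbour? s b d = search _ λ x → (x ∈? V) ×-dec (s x Bool.≟ b) ×-dec (ℓ v x ≟ᶜ d)

      -- If `v` has no `c`-neighbour on one side, it joins the other. Otherwise it has
      -- `c`-neighbours on both sides: an `opp c`-edge at `v` allows `carve`, and without one `v` is
      -- split off in colour `opp c`.
      extendSplit : Split V → Split (v ∷ V)
      extendSplit S with neighbour? (Split.side S) true (Split.c S) | neighbour? (Split.side S) false (Split.c S)
      ... | no n | _ = attach chromatic side inside outside separated (λ x∈ sx eq → n (_ , x∈ , sx , eq))
        where open Split S
      ... | yes _ | no n = attach (Split.chromatic S′) side inside outside separated
                             (λ x∈ sx eq → n (_ , x∈ , not-true sx , eq))
        where
        S′ = flip-side S
        open Split S′
        not-true : ∀ {b} → not b ≡ true → b ≡ false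
        not-true {false} _ = refl
      ... | yes (x , x∈ , sx , vx) | yes (z , z∈ , sz , vz) with neighbour? side true (opp c) | neighbour? side false (opp c)
        where open Split S
      ...   | yes (w , w∈ , sw , vw) | _ = carve S z∈ sz vz w∈ sw vw
      ...   | no _ | yes (w , w∈ , sw , vw) =
        carve (flip-side S) x∈ (cong not sx) vx w∈ (cong not sw) vw
      ...   | no n₁ | no n₂ = isolate (opp-chromatic (Split.chromatic S)) (x , x∈) free
        where
        free : ∀ {y} → y ∈ V → ℓ v y ≢ opp (Split.c S)
        free {y} y∈ eq with Split.side S y in sy
        ... | true = n₁ (y , y∈ , sy , eq)
        ... | false = n₂ (y , y∈ , sy , eq)

    -- With only red and blue this is the theorem that a graph without induced paths on four
    -- vertices, or its complement, is disconnected. Blank pairs are controlled by `gallai`.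
    splits : ∀ {u v V} → Vertices (u ∷ v ∷ V) → Unique (u ∷ v ∷ V) → Split (u ∷ v ∷ V)
    splits {u} {v} {[]} (vu All.∷ vs) (fr ∷ _) with ℓ u v ≟ᶜ red
    ... | no n = AddVertex.isolate vu vs fr isRed (v , here refl) λ { (here refl) → n }
    ... | yes p = AddVertex.isolate vu vs fr isBlue (v , here refl)
                    λ { (here refl) q → contradiction (trans (sym p) q) λ () }
    splits {u} {v} {w ∷ V} (vu All.∷ vs) (fr ∷ un) = AddVertex.extendSplit vu vs fr (splits vs un)

    record Edge (c : Colour) (V : List (Fin N)) : Set where
      constructor edge
      field
        {x y} : Fin N
        x∈V : x ∈ V
        y∈V : y ∈ V
        x≢y : x ≢ y
        coloured : ℓ x y ≡ c

    edge? : ∀ c V → Dec (Edge c V)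
    edge? c V with search _ (λ x → search _ (λ y → (x ∈? V) ×-dec (y ∈? V) ×-dec ¬? (x Fin.≟ y) ×-dec (ℓ x y ≟ᶜ c)))
    ... | yes (x , y , p , q , r , s) = yes (edge p q r s)
    ... | no n = no λ { (edge p q r s) → n (_ , _ , p , q , r , s) }

    -- The homogeneous sets of modular decomposition, here for three colours.
    Module : List (Fin N) → Set
    Module V = ∀ {y} → Vertex y → y ∉ V → ∀ {a b} → a ∈ V → b ∈ V → ℓ a y ≡ ℓ b y

    sym₁₃ : ∀ a b c → col a b c ≡ col b c a
    sym₁₃ a b c = trans (swap₁₂ a b c) (swap₂₃ b a c)

    module _ {V : List (Fin N)} (vV : Vertices V) (mod : Module V) where

      vert : ∀ {x} → x ∈ V → Vertex x
      vert = All.lookup vV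

      third-vertex : ∀ {c a b} → ℓ a b ≢ c → ∀ {x} → Distinct₃ a b x → col a b x ≡ c → Vertex x
      third-vertex {a = a} {b} ab≢c {x} d eq = vertex (Distinct₃.c∈ d)
        λ { refl → ab≢c (trans (sym (trans (sym₁₃ a b x) (sym₁₃ b x a))) eq) }

      -- Some `x` makes `a b x` a triple of colour `c`, while `e a b` has colour `opp c`. If `x`
      -- lies in `V`, the pairs `a x` and `b x` avoid `c`; if not, they have the same colour. Either
      -- way `e`, `a`, `b`, `x` is unbalanced.
      no-mono-edge : ∀ {c} → Chromatic c → ¬ Edge c V → ¬ Edge (opp c) V
      no-mono-edge {c} ch ¬c (edge {a} {b} a∈ b∈ a≢b ab) with extend ch a≢b (x∈ (vert a∈)) (x∈ (vert b∈))
      ... | x , d , abx = contradiction (trans (sym tet) bad) λ ()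
        where
        vx = third-vertex (λ eq → opp≢ ch (trans (sym ab) eq)) d abx
        a≢x = Distinct₃.a≢c d
        b≢x = Distinct₃.b≢c d
        tet = tetra (vert a∈) (vert b∈) vx a≢b a≢x b≢x
        bad : balanced (ℓ a b) (ℓ a x) (ℓ b x) (col a b x) ≡ false
        bad with x ∈? V
        ... | yes x∈V rewrite ab | abx =
          lonely ch (λ eq → ¬c (edge a∈ x∈V a≢x eq)) (λ eq → ¬c (edge b∈ x∈V b≢x eq))
        ... | no x∉V rewrite ab | abx | mod vx x∉V a∈ b∈ = lonely-twin (ℓ b x) ch

      -- In a module with blank pairs only, `a` and `b` look alike from every other vertex. Let `x`
      -- and `y` complete `a b` to a red and a blue triple. Balance makes `a x`, `b x` red and
      -- `a y`, `b y` blue, and the sets `e a x y`, `e b x y` and `a b x y` then contradict each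
      -- other.
      no-blank : ∀ {a b} → a ∈ V → b ∈ V → a ≢ b → ¬ Edge red V → ¬ Edge blue V → ⊥
      no-blank {a} {b} a∈ b∈ a≢b ¬r ¬b with extend isRed a≢b (x∈ (vert a∈)) (x∈ (vert b∈))
                                          | extend isBlue a≢b (x∈ (vert a∈)) (x∈ (vert b∈))
      ... | x , dx , abx | y , dy , aby =
        twin-clash (ℓ x y) (col a x y) (col b x y) (clash a≢x a≢y va ax ay) (clash b≢x b≢y vb bx by) base
        where
        va = vert a∈
        vb = vert b∈
        blank : ∀ {x y} → x ∈ V → y ∈ V → x ≢ y → ℓ x y ≡ neither
        blank p q r = third-colour isRed (λ eq → ¬r (edge p q r eq)) (λ eq → ¬b (edge p q r eq))
        ab = blank a∈ b∈ a≢b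
        vx = third-vertex (λ eq → contradiction (trans (sym ab) eq) λ ()) dx abx
        vy = third-vertex (λ eq → contradiction (trans (sym ab) eq) λ ()) dy aby
        a≢x = Distinct₃.a≢c dx
        a≢y = Distinct₃.a≢c dy
        b≢x = Distinct₃.b≢c dx
        b≢y = Distinct₃.b≢c dy
        x≢y : x ≢ y
        x≢y refl = contradiction (trans (sym abx) aby) λ ()
        twins : ∀ {z} → Vertex z → a ≢ z → b ≢ z → ℓ b z ≡ ℓ a z
        twins {z} vz p q with z ∈? V
        ... | yes z∈ = trans (blank b∈ z∈ q) (sym (blank a∈ z∈ p))
        ... | no z∉ = mod vz z∉ b∈ a∈
        type : ∀ {c z} → Chromatic c → Vertex z → Distinct₃ a b z → col a b z ≡ c → ℓ a z ≡ c
        type {c} {z} ch vz d eq = twin-colour {s = ℓ a z} ch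
          (subst₂ (λ s t → balanced s (ℓ a z) t c ≡ true) ab (twins vz (Distinct₃.a≢c d) (Distinct₃.b≢c d))
            (subst (λ t → balanced (ℓ a b) (ℓ a z) (ℓ b z) t ≡ true) eq
              (tetra va vb vz a≢b (Distinct₃.a≢c d) (Distinct₃.b≢c d))))
        ax = type isRed vx dx abx
        ay = type isBlue vy dy aby
        bx = trans (twins vx a≢x b≢x) ax
        by = trans (twins vy a≢y b≢y) ay
        clash : ∀ {u} → u ≢ x → u ≢ y → Vertex u → ℓ u x ≡ red → ℓ u y ≡ blue →
                balanced red blue (ℓ x y) (col u x y) ≡ true
        clash {u} u≢x u≢y vu ux uy = subst₂ (λ s t → balanced s t (ℓ x y) (col u x y) ≡ true) ux uy
                                       (tetra vu vx vy u≢x u≢y x≢y)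
        base : balanced red blue (col a x y) (col b x y) ≡ true
        base = subst₂ (λ s t → balanced s t (col a x y) (col b x y) ≡ true) abx aby
                 (four dx dy (base₃ va vx vy a≢x a≢y x≢y) (base₃ vb vx vy b≢x b≢y x≢y))

    private
      on : (Fin N → Bool) → Bool → List (Fin N) → List (Fin N)
      on s b = filter (λ x → s x Bool.≟ b)

      on⁺ : ∀ s {b V x} → x ∈ V → s x ≡ b → x ∈ on s b V
      on⁺ s {b} = ∈-filter⁺ (λ x → s x Bool.≟ b)

      on⁻ : ∀ s {b V x} → x ∈ on s b V → x ∈ V × s x ≡ b
      on⁻ s {b} = ∈-filter⁻ (λ x → s x Bool.≟ b)

      shorter : ∀ s {b V x} → x ∈ V → s x ≢ b → length (on s b V) ℕ.< length V
      shorter s {b} {V} x∈ p = filter-notAll (λ x → s x Bool.≟ b) V (lose x∈ p)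

    -- A union of components of colour `c` within `V`, not all of them single vertices.
    record Part (c : Colour) (V : List (Fin N)) : Set where
      constructor part
      field
        W : List (Fin N)
        W⊆V : ∀ {x} → x ∈ W → x ∈ V
        unique : Unique W
        closed : ∀ {x y} → x ∈ W → y ∈ V → y ∉ W → ℓ x y ≢ c
        hasEdge : Edge c W

    -- A vertex outside W that sees W non-uniformly cuts W along no c-edge.
    module _ {c V} (ch : Chromatic c) (vV : Vertices V) (P : Part c V) where
      open Part P

      Cutter : Fin N → Set
      Cutter y = y ∈ V × y ∉ W × (∃ λ a → a ∈ W × ℓ a y ≡ opp c) × (∃ λ b → b ∈ W × ℓ b y ≢ opp c)

      cutter? : Dec (∃ Cutter)
      cutter? = search _ λ y → (y ∈? V) ×-dec ¬? (y ∈? W)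
        ×-dec (search _ λ a → (a ∈? W) ×-dec (ℓ a y ≟ᶜ opp c))
        ×-dec (search _ λ b → (b ∈? W) ×-dec ¬? (ℓ b y ≟ᶜ opp c))

      module Refine {y} (cut : Cutter y) where
        y∈V = proj₁ cut
        y∉W = proj₁ (proj₂ cut)
        s : Fin N → Bool
        s x = eqᵇ (ℓ x y) (opp c)

        vert′ : ∀ {x} → x ∈ W → Vertex x
        vert′ x∈ = All.lookup vV (W⊆V x∈)

        -- The pair `v y` is blank: it is not `opp c`, and `W` is closed. An edge `u v` of colour
        -- `c` would make `u v y` rainbow.
        crossless : ∀ {u v} → u ∈ W → v ∈ W → s u ≡ true → s v ≡ false → ℓ u v ≢ c
        crossless {u} {v} u∈ v∈ su sv uv =
          gallai ch (vert′ v∈) (vert′ u∈) (All.lookup vV y∈V) (λ { refl → contradiction (trans (sym su) sv) λ () })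
            (λ { refl → y∉W v∈ }) (λ { refl → y∉W u∈ }) (trans (ℓ-sym v u) uv) (eqᵇ-true su)
            (third-colour ch (closed v∈ y∈V y∉W) (eqᵇ-false sv))

        across : ∀ b {u v} → u ∈ W → v ∈ W → s u ≡ b → s v ≢ b → ℓ u v ≢ c
        across true {v = v} u∈ v∈ su sv with s v in eq
        ... | true = contradiction refl sv
        ... | false = crossless u∈ v∈ su eq
        across false {u} {v} u∈ v∈ su sv uv with s v in eq
        ... | true = crossless v∈ u∈ eq su (trans (ℓ-sym v u) uv)
        ... | false = contradiction refl sv

        piece : ∀ b → Edge c (on s b W) → Part c V
        piece b E = part (on s b W) (λ x∈ → W⊆V (proj₁ (on⁻ s x∈))) (Uniqueₚ.filter⁺ (λ x → s x Bool.≟ b) unique) cl E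
          where
          cl : ∀ {u v} → u ∈ on s b W → v ∈ V → v ∉ on s b W → ℓ u v ≢ c
          cl {u} {v} u∈ v∈ v∉ uv with v ∈? W | on⁻ s {b} u∈
          ... | no v∉W | u∈W , _ = closed u∈W v∈ v∉W uv
          ... | yes v∈W | u∈W , su = across b u∈W v∈W su (λ sv → v∉ (on⁺ s v∈W sv)) uv

        refine : Σ (Part c V) λ Q → length (Part.W Q) ℕ.< length W
        refine with hasEdge | proj₂ (proj₂ cut)
        ... | edge {u} {v} u∈ v∈ u≢v uv | (a , a∈ , ay) , (b , b∈ , by) with s u in su | s v in sv
        ...   | true | true = piece true (edge (on⁺ s u∈ su) (on⁺ s v∈ sv) u≢v uv) ,
                              shorter s b∈ (λ eq → by (eqᵇ-true eq))
        ...   | false | false = piece false (edge (on⁺ s u∈ su) (on⁺ s v∈ sv) u≢v uv) ,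
                                shorter s a∈ (λ eq → eqᵇ-false eq ay)
        ...   | true | false = contradiction uv (crossless u∈ v∈ su sv)
        ...   | false | true = contradiction (trans (ℓ-sym v u) uv) (crossless v∈ u∈ sv su)

      -- Pairs from `W` to the rest of `V` never have colour `c`. So a vertex there that is not a
      -- cutter sees `W` entirely in `opp c` or entirely blank.
      uniform : Module V → ¬ ∃ Cutter → Module W
      uniform mod none′ {y} vy y∉W {a} {b} a∈ b∈ with y ∈? V
      ... | no y∉V = mod vy y∉V (W⊆V a∈) (W⊆V b∈)
      ... | yes y∈V with ℓ a y ≟ᶜ opp c | ℓ b y ≟ᶜ opp c
      ...   | yes p | yes q = trans p (sym q)
      ...   | yes p | no q = contradiction (y , y∈V , y∉W , (a , a∈ , p) , (b , b∈ , q)) none′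
      ...   | no p | yes q = contradiction (y , y∈V , y∉W , (b , b∈ , q) , (a , a∈ , p)) none′
      ...   | no p | no q = trans (third-colour ch (closed a∈ y∈V y∉W) p) (sym (third-colour ch (closed b∈ y∈V y∉W) q))

    module-part : ∀ {c V} → Chromatic c → Vertices V → Module V → (P : Part c V) → Acc ℕ._<_ (length (Part.W P)) →
                  Σ (Part c V) λ Q → Module (Part.W Q) × length (Part.W Q) ℕ.≤ length (Part.W P)
    module-part ch vV mod P (acc rs) with cutter? ch vV P
    ... | no n = P , uniform ch vV P mod n , ℕₚ.≤-refl
    ... | yes (y , cut) with Refine.refine ch vV P cut
    ...   | Q , Q<P with module-part ch vV mod Q (rs Q<P)
    ...     | R , modR , R≤Q = R , modR , ℕₚ.≤-trans R≤Q (ℕₚ.<⇒≤ Q<P)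

    both-colours : ∀ {V} → Vertices V → Module V → ∀ {a b} → a ∈ V → b ∈ V → a ≢ b → Edge red V × Edge blue V
    both-colours {V} vV mod a∈ b∈ a≢b with edge? red V | edge? blue V
    ... | yes r | yes b = r , b
    ... | yes r | no nb = contradiction r (no-mono-edge vV mod isBlue nb)
    ... | no nr | yes b = contradiction b (no-mono-edge vV mod isRed nr)
    ... | no nr | no nb = ⊥-elim (no-blank vV mod a∈ b∈ a≢b nr nb)

    -- Infinite descent. A module with two vertices has edges of both colours, so a split leaves an
    -- edge of the splitting colour inside one half, and this half refines to a smaller module that
    -- still has such an edge.
    no-module : ∀ V → Vertices V → Unique V → Module V → 2 ℕ.≤ length V → Acc ℕ._<_ (length V) → ⊥
    no-module (u ∷ v ∷ V) vV un@((u≢v All.∷ _) ∷ _) mod (s≤s (s≤s _)) (acc rs) =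
      go chromatic (pick chromatic (both-colours vV mod (here refl) (there (here refl)) u≢v))
      where
      U = u ∷ v ∷ V
      halves = splits vV un
      open Split halves
      pick : ∀ {c} → Chromatic c → Edge red U × Edge blue U → Edge c U
      pick isRed (r , _) = r
      pick isBlue (_ , b) = b
      conclude : Σ (Part c U) (λ P → length (Part.W P) ℕ.< length U) → ⊥
      conclude (P , P<U) with module-part chromatic vV mod P (<-wellFounded _)
      ... | part W W⊆U unW _ (edge x∈ y∈ x≢y _) , modW , W≤P =
        no-module W (All.tabulate (λ w∈ → All.lookup vV (W⊆U w∈))) unW modW (two x∈ y∈ x≢y) (rs (ℕₚ.≤-<-trans W≤P P<U))
        where
        two : ∀ {W : List (Fin N)} {x y} → x ∈ W → y ∈ W → x ≢ y → 2 ℕ.≤ length W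
        two {_ ∷ _ ∷ _} _ _ _ = s≤s (s≤s z≤n)
        two {_ ∷ []} (here refl) (here refl) ne = contradiction refl ne
      across : ∀ b {p q} → p ∈ U → q ∈ U → side p ≡ b → side q ≢ b → ℓ p q ≢ c
      across true {q = q} p∈ q∈ sp sq with side q in eq
      ... | true = contradiction refl sq
      ... | false = separated p∈ q∈ sp eq
      across false {p} {q} p∈ q∈ sp sq pq with side q in eq
      ... | true = separated q∈ p∈ eq sp (trans (ℓ-sym q p) pq)
      ... | false = contradiction refl sq
      half : ∀ b → Edge c (on side b U) → (∃ λ x → x ∈ U × side x ≢ b) → ⊥
      half b E (x , x∈ , sx) = conclude
        (part (on side b U) (λ p → proj₁ (on⁻ side p)) (Uniqueₚ.filter⁺ (λ x → side x Bool.≟ b) un) cl E , shorter side x∈ sx)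
        where
        cl : ∀ {p q} → p ∈ on side b U → q ∈ U → q ∉ on side b U → ℓ p q ≢ c
        cl p∈ q∈ q∉ with on⁻ side {b} p∈
        ... | p∈U , sp = across b p∈U q∈ sp (λ sq → q∉ (on⁺ side q∈ sq))
      go : Chromatic c → Edge c U → ⊥
      go ch (edge {p} {q} p∈ q∈ p≢q pq) with side p in sp | side q in sq | inside | outside
      ... | true | true | _ | (x , x∈ , sx) = half true (edge (on⁺ side p∈ sp) (on⁺ side q∈ sq) p≢q pq) (x , x∈ , λ eq → contradiction (trans (sym sx) eq) λ ())
      ... | false | false | (x , x∈ , sx) | _ = half false (edge (on⁺ side p∈ sp) (on⁺ side q∈ sq) p≢q pq) (x , x∈ , λ eq → contradiction (trans (sym sx) eq) λ ())
      ... | true | false | _ | _ = separated p∈ q∈ sp sq pq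
      ... | false | true | _ | _ = separated q∈ p∈ sq sp (trans (ℓ-sym q p) pq)

-- Pairs of even delta-matroids

not-one : ∀ p q r s →
          (p ≡ true → q ≡ true ⊎ r ≡ true ⊎ s ≡ true) → (q ≡ true → p ≡ true ⊎ r ≡ true ⊎ s ≡ true) →
          (r ≡ true → p ≡ true ⊎ q ≡ true ⊎ s ≡ true) → (s ≡ true → p ≡ true ⊎ q ≡ true ⊎ r ≡ true) →
          not (exactlyOne p q r s) ≡ true
not-one true true r s _ _ _ _ = refl
not-one true false true s _ _ _ _ = refl
not-one true false false true _ _ _ _ = refl
not-one true false false false f _ _ _ with f refl
... | inj₂ (inj₁ ())
... | inj₂ (inj₂ ())
not-one false true true s _ _ _ _ = refl
not-one false true false true _ _ _ _ = refl
not-one false true false false _ f _ _ with f refl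
... | inj₂ (inj₁ ())
... | inj₂ (inj₂ ())
not-one false false true true _ _ _ _ = refl
not-one false false true false _ _ f _ with f refl
... | inj₂ (inj₁ ())
... | inj₂ (inj₂ ())
not-one false false false false _ _ _ _ = refl
not-one false false false true _ _ _ f with f refl
... | inj₂ (inj₁ ())
... | inj₂ (inj₂ ())

Subsetᵇ : ℕ → Set
Subsetᵇ N = Fin N → Bool

infixl 6 _△_
_△_ : ∀ {N} → Subsetᵇ N → Subsetᵇ N → Subsetᵇ N
(A △ B) x = A x xor B x

-- Opaque so that unification recovers the elements from ⁅ a ⁆ and triple a b c.
opaque
  ⁅_⁆ : ∀ {N} → Fin N → Subsetᵇ N
  ⁅ a ⁆ x = does (a Fin.≟ x)

  ⁅⁆-self : ∀ {N} (a : Fin N) → ⁅ a ⁆ a ≡ true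
  ⁅⁆-self a = dec-true (a Fin.≟ a) refl

  ⁅⁆-other : ∀ {N} {a x : Fin N} → a ≢ x → ⁅ a ⁆ x ≡ false
  ⁅⁆-other {a = a} {x} = dec-false (a Fin.≟ x)

opaque
  triple : ∀ {N} → Fin N → Fin N → Fin N → Subsetᵇ N
  triple a b c = ⁅ a ⁆ △ ⁅ b ⁆ △ ⁅ c ⁆

-- The symmetric exchange axiom of even delta-matroids: a step of `A` towards `B` at a prescribed
-- element alters exactly one further element.
record Family {N} (X : Subsetᵇ N) : Set₁ where
  field
    R : Subsetᵇ N → Set
    R? : ∀ A → Dec (R A)
    respects : ∀ {A B} → A ≗ B → R A → R B
    exchange : ∀ {A B} → R A → R B → ∀ a → A a ≢ B a →
               ∃ λ b → b ≢ a × A b ≢ B b × R (A △ ⁅ a ⁆ △ ⁅ b ⁆)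
    singletons : ∀ a → X a ≡ true → R ⁅ a ⁆
    whole : R X

≢-cases : ∀ {p q} → p ≢ q → q ≡ false → p ≡ true
≢-cases {true} _ _ = refl
≢-cases {false} p refl = contradiction refl p

opaque
  unfolding triple

  triple-def : ∀ {N} (a b c : Fin N) → triple a b c ≗ ⁅ a ⁆ △ ⁅ b ⁆ △ ⁅ c ⁆
  triple-def a b c x = refl

  triple-false : ∀ {N} {a b c x : Fin N} → a ≢ x → b ≢ x → c ≢ x → triple a b c x ≡ false
  triple-false p q r rewrite ⁅⁆-other p | ⁅⁆-other q | ⁅⁆-other r = refl

  triple-true : ∀ {N} (a b c : Fin N) {x} → triple a b c x ≡ true → x ≡ a ⊎ x ≡ b ⊎ x ≡ c
  triple-true a b c {x} p with toSum (a Fin.≟ x) | toSum (b Fin.≟ x) | toSum (c Fin.≟ x)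
  ... | inj₁ q | _ | _ = inj₁ (sym q)
  ... | inj₂ _ | inj₁ q | _ = inj₂ (inj₁ (sym q))
  ... | inj₂ _ | inj₂ _ | inj₁ q = inj₂ (inj₂ (sym q))
  ... | inj₂ q | inj₂ r | inj₂ t = contradiction (trans (sym p) (triple-false q r t)) λ ()


module _ {N} {X : Subsetᵇ N} (F : Family X) where
  open Family F
  open xor-∧-Solver

  opaque
    unfolding triple

    triple-swap₁₂ : ∀ a b c → triple a b c ≗ triple {N} b a c
    triple-swap₁₂ a b c x = cong (_xor ⁅ c ⁆ x) (Boolₚ.xor-comm (⁅ a ⁆ x) (⁅ b ⁆ x))

    triple-swap₂₃ : ∀ a b c → triple a b c ≗ triple {N} a c b
    triple-swap₂₃ a b c x = solve 3 (λ p q r → p :+ q :+ r := p :+ r :+ q) refl (⁅ a ⁆ x) (⁅ b ⁆ x) (⁅ c ⁆ x)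

    R-swap₁₂ : ∀ {a b c} → R (triple a b c) → R (triple b a c)
    R-swap₁₂ {a} {b} {c} = respects (triple-swap₁₂ a b c)

    R-swap₂₃ : ∀ {a b c} → R (triple a b c) → R (triple a c b)
    R-swap₂₃ {a} {b} {c} = respects (triple-swap₂₃ a b c)

    -- Exchange from the triple towards the singleton of `d`, at `d`: the partner has to be an
    -- element of the triple, which leaves it.
    another : ∀ {a b c d} → X d ≡ true → a ≢ d → b ≢ d → c ≢ d → R (triple a b c) →
              R (triple a b d) ⊎ R (triple a c d) ⊎ R (triple b c d)
    another {a} {b} {c} {d} d∈ a≢d b≢d c≢d abc
      with exchange abc (singletons d d∈) d (λ eq → contradiction (trans (sym (triple-false a≢d b≢d c≢d)) (trans eq (⁅⁆-self d))) λ ())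
    ... | x , x≢d , ne , r with triple-true a b c {x} (≢-cases ne (⁅⁆-other (x≢d ∘ sym)))
    ...   | inj₁ refl = inj₂ (inj₂ (respects (λ y → solve 4 (λ p q s t → p :+ q :+ s :+ t :+ p := q :+ s :+ t) refl
                          (⁅ a ⁆ y) (⁅ b ⁆ y) (⁅ c ⁆ y) (⁅ d ⁆ y)) r))
    ...   | inj₂ (inj₁ refl) = inj₂ (inj₁ (respects (λ y → solve 4 (λ p q s t → p :+ q :+ s :+ t :+ q := p :+ s :+ t) refl
                          (⁅ a ⁆ y) (⁅ b ⁆ y) (⁅ c ⁆ y) (⁅ d ⁆ y)) r))
    ...   | inj₂ (inj₂ refl) = inj₁ (respects (λ y → solve 4 (λ p q s t → p :+ q :+ s :+ t :+ s := p :+ q :+ t) refl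
                          (⁅ a ⁆ y) (⁅ b ⁆ y) (⁅ c ⁆ y) (⁅ d ⁆ y)) r)

    -- Exchange from the singleton of `a` towards the whole of `X`, at `b`.
    extendPair : ∀ {a b} → a ≢ b → X a ≡ true → X b ≡ true →
                 ∃ λ x → x ≢ a × x ≢ b × X x ≡ true × R (triple a b x)
    extendPair {a} {b} a≢b a∈ b∈
      with exchange (singletons a a∈) whole b (λ eq → contradiction (trans (sym (⁅⁆-other a≢b)) (trans eq b∈)) λ ())
    ... | x , x≢b , ne , r = x , x≢a , x≢b , ≢-cases (ne ∘ sym) (⁅⁆-other (x≢a ∘ sym)) , r
      where
      x≢a : x ≢ a
      x≢a refl = ne (trans (⁅⁆-self a) (sym a∈))

    -- Exchange from `e q p` towards `e v z` at `z`. The partner is `q`, `p` or `v`, and the first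
    -- two would produce one of the excluded triples.
    quintuple : ∀ {e q p v z} → R (triple e q p) → R (triple e v z) →
                q ≢ z → p ≢ z → v ≢ z → e ≢ z → e ≢ v → e ≢ q → e ≢ p →
                ¬ R (triple e p z) → ¬ R (triple e q z) → R (triple e q p △ ⁅ v ⁆ △ ⁅ z ⁆)
    quintuple {e} {q} {p} {v} {z} eqp evz q≢z p≢z v≢z e≢z e≢v e≢q e≢p ¬epz ¬eqz
      with exchange eqp evz z (λ eq → contradiction (trans (sym (triple-false e≢z q≢z p≢z)) (trans eq evz-z)) λ ())
      where
      evz-z : triple e v z z ≡ true
      evz-z rewrite ⁅⁆-other e≢z | ⁅⁆-other v≢z | ⁅⁆-self z = refl
    ... | x , x≢z , ne , r with toSum (e Fin.≟ x) | toSum (v Fin.≟ x)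
    ...   | inj₁ refl | _ = contradiction (trans in₁ (sym in₂)) ne
      where
      in₁ : triple e q p e ≡ true
      in₁ rewrite ⁅⁆-self e | ⁅⁆-other (e≢q ∘ sym) | ⁅⁆-other (e≢p ∘ sym) = refl
      in₂ : triple e v z e ≡ true
      in₂ rewrite ⁅⁆-self e | ⁅⁆-other (e≢v ∘ sym) | ⁅⁆-other (e≢z ∘ sym) = refl
    ...   | inj₂ _ | inj₁ refl = respects (λ y → solve 5 (λ e q p v z → e :+ q :+ p :+ z :+ v := e :+ q :+ p :+ v :+ z) refl
                              (⁅ e ⁆ y) (⁅ q ⁆ y) (⁅ p ⁆ y) (⁅ v ⁆ y) (⁅ z ⁆ y)) r
    ...   | inj₂ e≢x | inj₂ v≢x with triple-true e q p {x} (≢-cases ne (triple-false e≢x v≢x (x≢z ∘ sym)))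
    ...     | inj₁ refl = contradiction refl e≢x
    ...     | inj₂ (inj₁ refl) = contradiction (respects (λ y → solve 4 (λ e q p z → e :+ q :+ p :+ z :+ q := e :+ p :+ z) refl
                       (⁅ e ⁆ y) (⁅ q ⁆ y) (⁅ p ⁆ y) (⁅ z ⁆ y)) r) ¬epz
    ...     | inj₂ (inj₂ refl) = contradiction (respects (λ y → solve 4 (λ e q p z → e :+ q :+ p :+ z :+ p := e :+ q :+ z) refl
                       (⁅ e ⁆ y) (⁅ q ⁆ y) (⁅ p ⁆ y) (⁅ z ⁆ y)) r) ¬eqz

    rotate : ∀ {e q p v z} → R (triple e v q △ ⁅ z ⁆ △ ⁅ p ⁆) → R (triple e q p △ ⁅ v ⁆ △ ⁅ z ⁆)
    rotate {e} {q} {p} {v} {z} = respects (λ y → solve 5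
      (λ e q p v z → e :+ v :+ q :+ z :+ p := e :+ q :+ p :+ v :+ z) refl
      (⁅ e ⁆ y) (⁅ q ⁆ y) (⁅ p ⁆ y) (⁅ v ⁆ y) (⁅ z ⁆ y))

module _ {N} {X : Subsetᵇ N} (F G : Family X) where
  private
    module F = Family F
    module G = Family G

    _∈X : Fin N → Set
    a ∈X = X a ≡ true

  record Common₃ : Set where
    field
      a b c : Fin N
      a≢b : a ≢ b
      a≢c : a ≢ c
      b≢c : b ≢ c
      inF : F.R (triple a b c)
      inG : G.R (triple a b c)

  record Common₅ : Set where
    field
      a b c d e : Fin N
      a≢b : a ≢ b
      a≢c : a ≢ c
      a≢d : a ≢ d
      a≢e : a ≢ e
      b≢c : b ≢ c
      b≢d : b ≢ d
      b≢e : b ≢ e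
      c≢d : c ≢ d
      c≢e : c ≢ e
      d≢e : d ≢ e
      inF : F.R (triple a b c △ ⁅ d ⁆ △ ⁅ e ⁆)
      inG : G.R (triple a b c △ ⁅ d ⁆ △ ⁅ e ⁆)

  module _ (no₃ : ¬ Common₃) (no₅ : ¬ Common₅) where

    decide : ∀ {P Q : Set} → Dec P → Dec Q → Colour
    decide (yes _) _ = red
    decide (no _) (yes _) = blue
    decide (no _) (no _) = neither

    col : Fin N → Fin N → Fin N → Colour
    col a b c = decide (F.R? (triple a b c)) (G.R? (triple a b c))

    Dist : Fin N → Fin N → Fin N → Set
    Dist = Distinct₃ _∈X col

    red⇒F : ∀ {a b c} → col a b c ≡ red → F.R (triple a b c)
    red⇒F {a} {b} {c} p with F.R? (triple a b c) | G.R? (triple a b c)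
    ... | yes r | _ = r
    red⇒F () | no _ | yes _
    red⇒F () | no _ | no _

    blue⇒G : ∀ {a b c} → col a b c ≡ blue → G.R (triple a b c)
    blue⇒G {a} {b} {c} p with F.R? (triple a b c) | G.R? (triple a b c)
    blue⇒G () | yes _ | _
    ... | no _ | yes r = r
    blue⇒G () | no _ | no _

    F⇒red : ∀ {a b c} → F.R (triple a b c) → col a b c ≡ red
    F⇒red {a} {b} {c} p with F.R? (triple a b c) | G.R? (triple a b c)
    ... | yes r | _ = refl
    ... | no q | _ = contradiction p q

    disjoint : ∀ {a b c} → a ≢ b → a ≢ c → b ≢ c → F.R (triple a b c) → ¬ G.R (triple a b c)
    disjoint p q r f g = no₃ record { a≢b = p ; a≢c = q ; b≢c = r ; inF = f ; inG = g }

    G⇒blue : ∀ {a b c} → a ≢ b → a ≢ c → b ≢ c → G.R (triple a b c) → col a b c ≡ blue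
    G⇒blue {a} {b} {c} p q r g with F.R? (triple a b c) | G.R? (triple a b c)
    ... | yes f | _ = contradiction g (disjoint p q r f)
    ... | no _ | yes _ = refl
    ... | no _ | no ng = contradiction g ng

    not-red : ∀ {a b c} → col a b c ≡ blue → ¬ F.R (triple a b c)
    not-red p f = contradiction (trans (sym p) (F⇒red f)) λ ()

    not-blue : ∀ {a b c} → Dist a b c → col a b c ≡ red → ¬ G.R (triple a b c)
    not-blue d p g = contradiction (trans (sym p) (G⇒blue (Distinct₃.a≢b d) (Distinct₃.a≢c d) (Distinct₃.b≢c d) g)) λ ()

    decide-cong : ∀ {P Q P′ Q′ : Set} (p : Dec P) (q : Dec Q) (p′ : Dec P′) (q′ : Dec Q′) →
                  (P → P′) → (P′ → P) → (Q → Q′) → (Q′ → Q) → decide p q ≡ decide p′ q′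
    decide-cong (yes _) _ (yes _) _ _ _ _ _ = refl
    decide-cong (yes x) _ (no y) _ f _ _ _ = contradiction (f x) y
    decide-cong (no x) _ (yes y) _ _ g _ _ = contradiction (g y) x
    decide-cong (no _) (yes _) (no _) (yes _) _ _ _ _ = refl
    decide-cong (no _) (yes x) (no _) (no y) _ _ f _ = contradiction (f x) y
    decide-cong (no _) (no x) (no _) (yes y) _ _ _ g = contradiction (g y) x
    decide-cong (no _) (no _) (no _) (no _) _ _ _ _ = refl

    is-true : ∀ {c d} → does (c ≟ᶜ d) ≡ true → c ≡ d
    is-true {c} {d} p with c ≟ᶜ d
    ... | yes q = q

    true-is : ∀ {c d} → c ≡ d → does (c ≟ᶜ d) ≡ true
    true-is {c} {d} p = dec-true (c ≟ᶜ d) p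

    or-map : ∀ {A B C A′ B′ C′ : Set} → (A → A′) → (B → B′) → (C → C′) → A ⊎ B ⊎ C → A′ ⊎ B′ ⊎ C′
    or-map f g h = Sum.map f (Sum.map g h)

    module Four (H : Family X) {κ : Colour}
                (to : ∀ {a b c} → Dist a b c → Family.R H (triple a b c) → col a b c ≡ κ)
                (from : ∀ {a b c} → col a b c ≡ κ → Family.R H (triple a b c)) where

      four : ∀ {a b c d} → Dist a b c → Dist a b d → Dist a c d → Dist b c d →
             not (exactlyOne (does (col a b c ≟ᶜ κ)) (does (col a b d ≟ᶜ κ)) (does (col a c d ≟ᶜ κ)) (does (col b c d ≟ᶜ κ))) ≡ true
      four {a} {b} {c} {d} abc abd acd bcd = not-one _ _ _ _
        (λ p → or-map (put abd) (put acd) (put bcd)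
          (another H (Distinct₃.c∈ abd) a≢d b≢d c≢d (get p)))
        (λ p → or-map (put abc) (put acd ∘ R-swap₂₃ H) (put bcd ∘ R-swap₂₃ H)
          (another H (Distinct₃.c∈ abc) a≢c b≢c (c≢d ∘ sym) (get p)))
        (λ p → or-map (put abc ∘ R-swap₂₃ H) (put abd ∘ R-swap₂₃ H) (put bcd ∘ R-swap₁₂ H ∘ R-swap₂₃ H)
          (another H (Distinct₃.b∈ abc) a≢b (b≢c ∘ sym) (b≢d ∘ sym) (get p)))
        (λ p → or-map (put abc ∘ R-swap₁₂ H ∘ R-swap₂₃ H) (put abd ∘ R-swap₁₂ H ∘ R-swap₂₃ H) (put acd ∘ R-swap₁₂ H ∘ R-swap₂₃ H)
          (another H (Distinct₃.a∈ abc) (a≢b ∘ sym) (a≢c ∘ sym) (a≢d ∘ sym) (get p)))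
        where
        a≢b = Distinct₃.a≢b abc
        a≢c = Distinct₃.a≢c abc
        b≢c = Distinct₃.b≢c abc
        a≢d = Distinct₃.a≢c abd
        b≢d = Distinct₃.b≢c abd
        c≢d = Distinct₃.b≢c acd
        put : ∀ {x y z} → Dist x y z → Family.R H (triple x y z) → does (col x y z ≟ᶜ κ) ≡ true
        put d r = true-is (to d r)
        get : ∀ {x y z} → does (col x y z ≟ᶜ κ) ≡ true → Family.R H (triple x y z)
        get p = from (is-true p)

    system : TripleSystem _∈X col
    system = record
      { swap₁₂ = λ a b c → decide-cong (F.R? _) (G.R? _) (F.R? _) (G.R? _) (R-swap₁₂ F) (R-swap₁₂ F) (R-swap₁₂ G) (R-swap₁₂ G)
      ; swap₂₃ = λ a b c → decide-cong (F.R? _) (G.R? _) (F.R? _) (G.R? _) (R-swap₂₃ F) (R-swap₂₃ F) (R-swap₂₃ G) (R-swap₂₃ G)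
      ; four = λ p q r s → cong₂ _∧_
          (Four.four F {red} (λ _ → F⇒red) red⇒F p q r s)
          (Four.four G {blue} (λ { (distinct₃ u v w _ _ _) → G⇒blue u v w }) blue⇒G p q r s)
      ; pentagon-free = pentagon
      ; extend = ext
      }
      where
      pentagon : ∀ {e q p v z} → Dist e q p → Dist e p v → Dist e v z → Dist e q v → Dist e q z → Dist e p z →
        col e q p ≡ red → col e p v ≡ red → col e v z ≡ red →
        col e q v ≡ blue → col e q z ≡ blue → col e p z ≡ blue → ⊥
      pentagon {e} {q} {p} {v} {z} dqp dpv dvz dqv dqz dpz eqp epv evz eqv eqz epz =
        no₅ record { a≢b = e≢q ; a≢c = e≢p ; a≢d = e≢v ; a≢e = e≢z ; b≢c = q≢p ; b≢d = q≢v ; b≢e = q≢z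
                   ; c≢d = p≢v ; c≢e = p≢z ; d≢e = v≢z ; inF = inF ; inG = rotate G {z = z} inG }
        where
        e≢q = Distinct₃.a≢b dqp
        e≢p = Distinct₃.a≢c dqp
        q≢p = Distinct₃.b≢c dqp
        e≢v = Distinct₃.a≢c dpv
        p≢v = Distinct₃.b≢c dpv
        e≢z = Distinct₃.a≢c dvz
        v≢z = Distinct₃.b≢c dvz
        q≢v = Distinct₃.b≢c dqv
        q≢z = Distinct₃.b≢c dqz
        p≢z = Distinct₃.b≢c dpz
        inF : F.R (triple e q p △ ⁅ v ⁆ △ ⁅ z ⁆)
        inF = quintuple F (red⇒F eqp) (red⇒F evz) q≢z p≢z v≢z e≢z e≢v e≢q e≢p (not-red epz) (not-red eqz)
        -- The blue pairs at `e` form the path `v q z p`, so the argument for `F` applies to `G`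
        -- with the elements permuted accordingly.
        inG : G.R (triple e v q △ ⁅ z ⁆ △ ⁅ p ⁆)
        inG = quintuple G (R-swap₂₃ G (blue⇒G eqv)) (R-swap₂₃ G (blue⇒G epz)) (p≢v ∘ sym) q≢p (p≢z ∘ sym) e≢p e≢z e≢v e≢q
                (not-blue dqp eqp)
                (λ g → not-blue dpv epv (R-swap₂₃ G g))
      ext : ∀ {c} → Chromatic c → ∀ {a b} → a ≢ b → a ∈X → b ∈X → ∃ λ x → Dist a b x × col a b x ≡ c
      ext isRed a≢b a∈ b∈ with extendPair F a≢b a∈ b∈
      ... | x , x≢a , x≢b , x∈ , r = x , distinct₃ a≢b (x≢a ∘ sym) (x≢b ∘ sym) a∈ b∈ x∈ , F⇒red r
      ext isBlue a≢b a∈ b∈ with extendPair G a≢b a∈ b∈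
      ... | x , x≢a , x≢b , x∈ , r = x , distinct₃ a≢b (x≢a ∘ sym) (x≢b ∘ sym) a∈ b∈ x∈ , G⇒blue a≢b (x≢a ∘ sym) (x≢b ∘ sym) r

    -- In the link of `a`, the set of all its vertices is a module because no vertex lies outside,
    -- and it contains `b` and `c`.
    no-disjoint-families : ∀ {a b c} → a ≢ b → a ≢ c → b ≢ c → a ∈X → b ∈X → c ∈X → ⊥
    no-disjoint-families {a} {b} {c} a≢b a≢c b≢c a∈ b∈ c∈ =
      L.no-module V (All.tabulate λ p → vert (∈-filter⁻ P? {xs = allFin N} p)) (Uniqueₚ.filter⁺ P? (Uniqueₚ.allFin⁺ N))
        (λ {y} vy y∉V → contradiction (∈-filter⁺ P? (∈-allFin y) (L.Vertex.x∈ vy , L.Vertex.e≢x vy)) y∉V)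
        (two (∈-filter⁺ P? (∈-allFin b) (b∈ , a≢b)) (∈-filter⁺ P? (∈-allFin c) (c∈ , a≢c)) b≢c)
        (<-wellFounded _)
      where
      module L = Link _∈X col system a a∈
      P? : ∀ x → Dec (x ∈X × a ≢ x)
      P? x = (X x Bool.≟ true) ×-dec ¬? (a Fin.≟ x)
      V = filter P? (allFin N)
      vert : ∀ {x} → x ∈ allFin N × (x ∈X × a ≢ x) → L.Vertex x
      vert (_ , p , q) = L.vertex p q
      two : ∀ {W : List (Fin N)} {x y} → x ∈ W → y ∈ W → x ≢ y → 2 ℕ.≤ length W
      two {_ ∷ _ ∷ _} _ _ _ = s≤s (s≤s z≤n)
      two {_ ∷ []} (here refl) (here refl) ne = contradiction refl ne

-- Points, odd cuts and packings

private module S = SemiringSum (CommutativeRing.semiring ℤₚ.+-*-commutativeRing)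
private module B = SemiringSum (CommutativeRing.semiring Boolₚ.xor-∧-commutativeRing)

-- Opaque so that unification recovers f from ∑ f and ⨁ f.
opaque
  ∑ : ∀ {k} → (Fin k → ℤ) → ℤ
  ∑ = S.sum

  ⨁ : ∀ {k} → (Fin k → Bool) → Bool
  ⨁ = B.sum

  ∑-cong : ∀ {k} {f g : Fin k → ℤ} → f ≗ g → ∑ f ≡ ∑ g
  ∑-cong = S.sum-cong-≗

  ∑-+ : ∀ {k} (f g : Fin k → ℤ) → ∑ (λ i → f i + g i) ≡ ∑ f + ∑ g
  ∑-+ = S.∑-distrib-+

  ∑-swap : ∀ {k l} (f : Fin k → Fin l → ℤ) → ∑ (λ i → ∑ (f i)) ≡ ∑ (λ j → ∑ (λ i → f i j))
  ∑-swap = S.∑-comm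

  ∑-* : ∀ {k} a (f : Fin k → ℤ) → a * ∑ f ≡ ∑ (λ i → a * f i)
  ∑-* = S.*-distribˡ-sum

  ∑-suc : ∀ {k} (f : Fin (suc k) → ℤ) → ∑ f ≡ f zero + ∑ (f ∘ suc)
  ∑-suc f = refl

  ∑-0 : ∀ k → ∑ {k} (λ _ → 0ℤ) ≡ 0ℤ
  ∑-0 = S.sum-replicate-zero

  ⨁-cong : ∀ {k} {f g : Fin k → Bool} → f ≗ g → ⨁ f ≡ ⨁ g
  ⨁-cong = B.sum-cong-≗

  ⨁-xor : ∀ {k} (f g : Fin k → Bool) → ⨁ (λ i → f i xor g i) ≡ ⨁ f xor ⨁ g
  ⨁-xor = B.∑-distrib-+

  ⨁-swap : ∀ {k l} (f : Fin k → Fin l → Bool) → ⨁ (λ i → ⨁ (f i)) ≡ ⨁ (λ j → ⨁ (λ i → f i j))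
  ⨁-swap = B.∑-comm

  ⨁-∧ : ∀ {k} a (f : Fin k → Bool) → a ∧ ⨁ f ≡ ⨁ (λ i → a ∧ f i)
  ⨁-∧ = B.*-distribˡ-sum

  ⨁-0 : ∀ k → ⨁ {k} (λ _ → false) ≡ false
  ⨁-0 = B.sum-replicate-zero

-- Inequalities over ℤ are proved by exhibiting the difference of the two sides.
≤-via : ∀ {a b} u → 0ℤ ≤ u → u ≡ b - a → a ≤ b
≤-via u p refl = ℤₚ.0≤i-j⇒j≤i p

diff : ∀ {a b} → a ≤ b → 0ℤ ≤ b - a
diff = ℤₚ.i≤j⇒0≤j-i

0≤+ : ∀ {a b} → 0ℤ ≤ a → 0ℤ ≤ b → 0ℤ ≤ a + b
0≤+ p q = ℤₚ.+-mono-≤ p q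

0≤* : ∀ {a b} → 0ℤ ≤ a → 0ℤ ≤ b → 0ℤ ≤ a * b
0≤* {+ a} {+ b} _ _ = subst (0ℤ ≤_) (ℤₚ.pos-* a b) (+≤+ z≤n)

⟦_⟧ : Bool → ℤ
⟦ true ⟧ = 1ℤ
⟦ false ⟧ = 0ℤ

⟦⟧-nonneg : ∀ b → 0ℤ ≤ ⟦ b ⟧
⟦⟧-nonneg true = +≤+ z≤n
⟦⟧-nonneg false = +≤+ z≤n

2^_ : ℕ → ℤ
2^ k = + (2 ℕ.^ k)

2^-pos : ∀ k → 0ℤ < 2^ k
2^-pos k = ℤ.+<+ (ℕₚ.m^n>0 2 k)

2^-nonneg : ∀ k → 0ℤ ≤ 2^ k
2^-nonneg k = +≤+ z≤n

2^-+ : ∀ j k → 2^ (j ℕ.+ k) ≡ 2^ j * 2^ k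
2^-+ j k = trans (cong +_ (ℕₚ.^-distribˡ-+-* 2 j k)) (ℤₚ.pos-* (2 ℕ.^ j) (2 ℕ.^ k))

opaque
  unfolding ∑ ⨁

  ∑-nonneg : ∀ {k} (f : Fin k → ℤ) → (∀ i → 0ℤ ≤ f i) → 0ℤ ≤ ∑ f
  ∑-nonneg {zero} f p = +≤+ z≤n
  ∑-nonneg {suc k} f p = 0≤+ (p zero) (∑-nonneg (f ∘ suc) (p ∘ suc))

  ∑-mono : ∀ {k} {f g : Fin k → ℤ} → (∀ i → f i ≤ g i) → ∑ f ≤ ∑ g
  ∑-mono {zero} p = +≤+ z≤n
  ∑-mono {suc k} p = ℤₚ.+-mono-≤ (p zero) (∑-mono (p ∘ suc))

  ∑-term : ∀ {k} (f : Fin k → ℤ) → (∀ i → 0ℤ ≤ f i) → ∀ i → f i ≤ ∑ f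
  ∑-term f p zero = ℤₚ.≤-trans (ℤₚ.≤-reflexive (sym (ℤₚ.+-identityʳ _))) (ℤₚ.+-monoʳ-≤ (f zero) (∑-nonneg (f ∘ suc) (p ∘ suc)))
  ∑-term f p (suc i) = ℤₚ.≤-trans (∑-term (f ∘ suc) (p ∘ suc) i)
    (ℤₚ.≤-trans (ℤₚ.≤-reflexive (sym (ℤₚ.+-identityˡ _))) (ℤₚ.+-monoˡ-≤ _ (p zero)))

  ≤0∧0≤ : ∀ {a} → a ≤ 0ℤ → 0ℤ ≤ a → a ≡ 0ℤ
  ≤0∧0≤ = ℤₚ.≤-antisym

  ∑-zero⇒ : ∀ {k} (f : Fin k → ℤ) → (∀ i → 0ℤ ≤ f i) → ∑ f ≡ 0ℤ → ∀ i → f i ≡ 0ℤ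
  ∑-zero⇒ f p eq i = ≤0∧0≤ (subst (f i ≤_) eq (∑-term f p i)) (p i)

  ∑-positive⇒ : ∀ {k} (f : Fin k → ℤ) → 0ℤ < ∑ f → ∃ λ i → 0ℤ < f i
  ∑-positive⇒ {zero} f p = contradiction p (ℤₚ.<-irrefl refl)
  ∑-positive⇒ {suc k} f p with 0ℤ ℤ.<? f zero
  ... | yes q = zero , q
  ... | no q with ∑-positive⇒ (f ∘ suc) (ℤₚ.<-≤-trans p (ℤₚ.≤-trans (ℤₚ.+-monoˡ-≤ _ (ℤₚ.≮⇒≥ q)) (ℤₚ.≤-reflexive (ℤₚ.+-identityˡ _))))
  ...   | i , r = suc i , r

  ⨁-true⇒ : ∀ {k} (f : Fin k → Bool) → ⨁ f ≡ true → ∃ λ i → f i ≡ true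
  ⨁-true⇒ {suc k} f p with f zero in eq
  ... | true = zero , eq
  ... | false with ⨁-true⇒ (f ∘ suc) p
  ...   | i , q = suc i , q

  ∑-linear : ∀ {k} (α β : ℤ) (f g : Fin k → ℤ) → ∑ (λ i → α * f i - β * g i) ≡ α * ∑ f - β * ∑ g
  ∑-linear {zero} α β f g = lem α β
    where
    lem : ∀ α β → 0ℤ ≡ α * 0ℤ - β * 0ℤ
    lem = solve-∀
  ∑-linear {suc k} α β f g = trans (cong (λ s → α * f zero - β * g zero + s) (∑-linear α β (f ∘ suc) (g ∘ suc)))
    (lem α β (f zero) (g zero) (∑ (f ∘ suc)) (∑ (g ∘ suc)))
    where
    lem : ∀ α β a b s t → α * a - β * b + (α * s - β * t) ≡ α * (a + s) - β * (b + t)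
    lem = solve-∀

-- Contraction keeps the index types and only marks vertices as no longer `alive`. So a contraction
-- has the same edges as the original, some of them now loops, and joins can be compared directly.
record Graft (m n : ℕ) : Set where
  field
    src tgt : Fin m → Fin n
    T : Subsetᵇ n
    alive : Subsetᵇ n
    src-alive : ∀ e → alive (src e) ≡ true
    tgt-alive : ∀ e → alive (tgt e) ≡ true
    T-alive : ∀ x → T x ≡ true → alive x ≡ true

  cut : Subsetᵇ n → Subsetᵇ m
  cut U e = U (src e) xor U (tgt e)

  odd : Subsetᵇ n → Bool
  odd U = ⨁ λ x → U x ∧ T x

  weight : (Fin m → ℤ) → Subsetᵇ n → ℤ
  weight c U = ∑ λ e → ⟦ cut U e ⟧ * c e

  -- Parity is demanded for all cuts and not only for stars, because the cuts of a contraction are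
  -- cuts of the original graph.
  Join : Subsetᵇ m → Set
  Join J = ∀ U → ⨁ (λ e → J e ∧ cut U e) ≡ odd U

  cut-cong : ∀ {U V} → U ≗ V → cut U ≗ cut V
  cut-cong p e = cong₂ _xor_ (p (src e)) (p (tgt e))

  odd-cong : ∀ {U V} → U ≗ V → odd U ≡ odd V
  odd-cong p = ⨁-cong λ x → cong (_∧ T x) (p x)

  weight-cong : ∀ c {U V} → U ≗ V → weight c U ≡ weight c V
  weight-cong c p = ∑-cong λ e → cong (λ b → ⟦ b ⟧ * c e) (cut-cong p e)

record Point (m : ℕ) : Set where
  constructor point
  field
    wt : Fin m → ℤ
    tot : ℤ
open Point public

infix 8 _∙_⊖_∙_
_∙_⊖_∙_ : ∀ {m} → ℤ → Point m → ℤ → Point m → Point m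
α ∙ p ⊖ β ∙ q = point (λ e → α * wt p e - β * wt q e) (α * tot p - β * tot q)

χ : ∀ {m} → Subsetᵇ m → Point m
χ J = point (λ e → ⟦ J e ⟧) 1ℤ

load : ∀ {m} → List (Subsetᵇ m) → Fin m → ℤ
load [] e = 0ℤ
load (J ∷ Js) e = ⟦ J e ⟧ + load Js e

load-++ : ∀ {m} (Js Ks : List (Subsetᵇ m)) e → load (Js ++ Ks) e ≡ load Js e + load Ks e
load-++ [] Ks e = sym (ℤₚ.+-identityˡ _)
load-++ (J ∷ Js) Ks e = trans (cong (ℤ._+_ ⟦ J e ⟧) (load-++ Js Ks e)) (sym (ℤₚ.+-assoc ⟦ J e ⟧ _ _))

load-replicate : ∀ {m} k (J : Subsetᵇ m) e → load (replicate k J) e ≡ + k * ⟦ J e ⟧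
load-replicate zero J e = refl
load-replicate (suc k) J e = trans (cong (ℤ._+_ ⟦ J e ⟧) (load-replicate k J e)) (lem (+ k) ⟦ J e ⟧)
  where
  lem : ∀ k j → j + k * j ≡ (1ℤ + k) * j
  lem = solve-∀

load-nonneg : ∀ {m} (Js : List (Subsetᵇ m)) e → 0ℤ ≤ load Js e
load-nonneg [] e = +≤+ z≤n
load-nonneg (J ∷ Js) e = 0≤+ (⟦⟧-nonneg (J e)) (load-nonneg Js e)

load-member : ∀ {m} {Js : List (Subsetᵇ m)} {J} → J ∈ Js → ∀ e → ⟦ J e ⟧ ≤ load Js e
load-member {Js = J ∷ Js} (here refl) e = ≤-via (load Js e) (load-nonneg Js e) (lem ⟦ J e ⟧ (load Js e))
  where
  lem : ∀ j l → l ≡ j + l - j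
  lem = solve-∀
load-member {Js = K ∷ Js} {J} (there p) e = ℤₚ.≤-trans (load-member p e)
  (≤-via ⟦ K e ⟧ (⟦⟧-nonneg (K e)) (lem ⟦ K e ⟧ (load Js e)))
  where
  lem : ∀ j l → j ≡ j + l - l
  lem = solve-∀

load-positive⇒ : ∀ {m} (Js : List (Subsetᵇ m)) e → 0ℤ < load Js e → ∃ λ J → J ∈ Js × J e ≡ true
load-positive⇒ [] e p = contradiction p (ℤₚ.<-irrefl refl)
load-positive⇒ (J ∷ Js) e p with J e in eq
... | true = J , here refl , eq
... | false with load-positive⇒ Js e (subst (0ℤ <_) (ℤₚ.+-identityˡ _) p)
...   | K , q , r = K , there q , r

module Weights {m n} (G : Graft m n) where
  open Graft G

  weight-linear : ∀ α β c d U → weight (λ e → α * c e - β * d e) U ≡ α * weight c U - β * weight d U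
  weight-linear α β c d U = trans (∑-cong λ e → lem α β ⟦ cut U e ⟧ (c e) (d e)) (∑-linear α β (λ e → ⟦ cut U e ⟧ * c e) (λ e → ⟦ cut U e ⟧ * d e))
    where
    lem : ∀ α β b c d → b * (α * c - β * d) ≡ α * (b * c) - β * (b * d)
    lem = solve-∀

  weight-mono : ∀ {c d} U → (∀ e → c e ≤ d e) → weight c U ≤ weight d U
  weight-mono {c} {d} U p = ∑-mono λ e → go (cut U e) (p e)
    where
    go : ∀ b {x y} → x ≤ y → ⟦ b ⟧ * x ≤ ⟦ b ⟧ * y
    go true {x} {y} q = subst₂ _≤_ (sym (ℤₚ.*-identityˡ x)) (sym (ℤₚ.*-identityˡ y)) q
    go false _ = +≤+ z≤n

  weight-nonneg : ∀ {c} U → (∀ e → 0ℤ ≤ c e) → 0ℤ ≤ weight c U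
  weight-nonneg U p = ∑-nonneg _ λ e → 0≤* (⟦⟧-nonneg (cut U e)) (p e)

  -- Names for the inequalities of the cone, so that one ratio test treats all kinds alike. Vertex
  -- sets are vectors here and not functions because the inequalities have to be listed.
  data Con : Set where
    edge : Fin m → Con
    total : Con
    cutset : Subset n → Con

  Admissible : Con → Set
  Admissible (edge _) = ⊤
  Admissible total = ⊤
  Admissible (cutset U) = odd (lookup U) ≡ true

  val : Con → Point m → ℤ
  val (edge e) p = wt p e
  val total p = tot p
  val (cutset U) p = weight (wt p) (lookup U) - tot p

  val-linear : ∀ i α p β q → val i (α ∙ p ⊖ β ∙ q) ≡ α * val i p - β * val i q
  val-linear (edge e) α p β q = refl
  val-linear total α p β q = refl
  val-linear (cutset U) α p β q =
    trans (cong (_- (α * tot p - β * tot q)) (weight-linear α β (wt p) (wt q) (lookup U)))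
          (lem α β (weight (wt p) (lookup U)) (weight (wt q) (lookup U)) (tot p) (tot q))
    where
    lem : ∀ α β a b s t → α * a - β * b - (α * s - β * t) ≡ α * (a - s) - β * (b - t)
    lem = solve-∀

  Valid : Point m → Set
  Valid p = ∀ i → Admissible i → 0ℤ ≤ val i p

  valid-cut : ∀ {p} → Valid p → ∀ U → odd U ≡ true → tot p ≤ weight (wt p) U
  valid-cut {p} v U o = subst (tot p ≤_) (weight-cong (wt p) (lookup∘tabulate U))
    (ℤₚ.0≤i-j⇒j≤i (v (cutset (tabulate U)) (trans (odd-cong (lookup∘tabulate U)) o)))

  crossing-pos : ∀ {J} → Join J → ∀ U → odd U ≡ true → 1ℤ ≤ weight (wt (χ J)) U
  crossing-pos {J} j U o with ⨁-true⇒ _ (trans (j U) o)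
  ... | e , p = ℤₚ.≤-trans (ℤₚ.≤-reflexive (sym (lem (J e) (cut U e) p))) (∑-term _ (λ e → 0≤* (⟦⟧-nonneg (cut U e)) (⟦⟧-nonneg (J e))) e)
    where
    lem : ∀ a b → a ∧ b ≡ true → ⟦ b ⟧ * ⟦ a ⟧ ≡ 1ℤ
    lem true true _ = refl

  join-valid : ∀ {J} → Join J → Valid (χ J)
  join-valid {J} j (edge e) _ = ⟦⟧-nonneg (J e)
  join-valid j total _ = +≤+ z≤n
  join-valid j (cutset U) o = diff (crossing-pos j (lookup U) o)

  record Good (p : Point m) : Set where
    constructor good
    field
      exponent : ℕ
      joins : List (Subsetᵇ m)
      areJoins : All Join joins
      count : + length joins ≡ 2^ exponent * tot p
      packed : ∀ e → load joins e ≤ 2^ exponent * wt p e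

  -- Add 2^k · a copies of J to the given packing.
  good-step : ∀ {q J} j (a : ℕ) → Join J → Good (2^ j ∙ q ⊖ + a ∙ χ J) → Good q
  good-step {q} {J} j a jJ (good k Js js cnt pck) =
    good (k ℕ.+ j) (Js ++ replicate (2 ℕ.^ k ℕ.* a) J) (Allₚ.++⁺ js (Allₚ.replicate⁺ _ jJ)) cnt′ pck′
    where
    scaled : + (2 ℕ.^ k ℕ.* a) ≡ 2^ k * + a
    scaled = ℤₚ.pos-* (2 ℕ.^ k) a
    cnt′ : + length (Js ++ replicate (2 ℕ.^ k ℕ.* a) J) ≡ 2^ (k ℕ.+ j) * tot q
    cnt′ = trans (cong +_ (trans (Listₚ.length-++ Js) (cong (length Js ℕ.+_) (Listₚ.length-replicate _))))
             (trans (ℤₚ.pos-+ (length Js) _) (trans (cong₂ _+_ cnt scaled)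
               (trans (lem (2^ k) (2^ j) (tot q) (+ a)) (cong (_* tot q) (sym (2^-+ k j))))))
      where
      lem : ∀ k j t a → k * (j * t - a * 1ℤ) + k * a ≡ k * j * t
      lem = solve-∀
    pck′ : ∀ e → load (Js ++ replicate (2 ℕ.^ k ℕ.* a) J) e ≤ 2^ (k ℕ.+ j) * wt q e
    pck′ e = subst₂ _≤_ (sym (trans (load-++ Js _ e) (cong (ℤ._+_ (load Js e))
                 (trans (load-replicate (2 ℕ.^ k ℕ.* a) J e) (cong (_* ⟦ J e ⟧) scaled)))))
               (trans (lem (2^ k) (2^ j) (wt q e) (+ a) ⟦ J e ⟧) (cong (_* wt q e) (sym (2^-+ k j))))
               (ℤₚ.+-monoˡ-≤ (2^ k * + a * ⟦ J e ⟧) (pck e))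
      where
      lem : ∀ k j c a b → k * (j * c - a * b) + k * a * b ≡ k * j * c
      lem = solve-∀

  total-val : Con → List (Subsetᵇ m) → ℤ
  total-val i [] = 0ℤ
  total-val i (J ∷ Js) = val i (χ J) + total-val i Js

  total-edge : ∀ e Js → total-val (edge e) Js ≡ load Js e
  total-edge e [] = refl
  total-edge e (J ∷ Js) = cong (ℤ._+_ ⟦ J e ⟧) (total-edge e Js)

  total-total : ∀ Js → total-val total Js ≡ + length Js
  total-total [] = refl
  total-total (J ∷ Js) = cong (ℤ._+_ 1ℤ) (total-total Js)

  weight-load : ∀ J Js U → weight (load (J ∷ Js)) U ≡ weight (wt (χ J)) U + weight (load Js) U
  weight-load J Js U = trans (∑-cong λ e → ℤₚ.*-distribˡ-+ ⟦ cut U e ⟧ ⟦ J e ⟧ (load Js e)) (∑-+ (λ e → ⟦ cut U e ⟧ * ⟦ J e ⟧) (λ e → ⟦ cut U e ⟧ * load Js e))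

  weight-0 : ∀ U → weight (λ _ → 0ℤ) U ≡ 0ℤ
  weight-0 U = trans (∑-cong λ e → ℤₚ.*-zeroʳ ⟦ cut U e ⟧) (∑-0 m)

  total-cut : ∀ U Js → total-val (cutset U) Js ≡ weight (load Js) (lookup U) - + length Js
  total-cut U [] = sym (cong (_- 0ℤ) (weight-0 (lookup U)))
  total-cut U (J ∷ Js) = trans (cong (ℤ._+_ (val (cutset U) (χ J))) (total-cut U Js))
    (trans (lem (weight (wt (χ J)) (lookup U)) (weight (load Js) (lookup U)) (+ length Js))
      (cong (_- + length (J ∷ Js)) (sym (weight-load J Js (lookup U)))))
    where
    lem : ∀ a b l → a - 1ℤ + (b - l) ≡ a + b - (1ℤ + l)
    lem = solve-∀

  good-val : ∀ {p} (g : Good p) i → total-val i (Good.joins g) ≤ 2^ (Good.exponent g) * val i p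
  good-val (good k Js js cnt pck) (edge e) = subst (_≤ _) (sym (total-edge e Js)) (pck e)
  good-val (good k Js js cnt pck) total = ℤₚ.≤-reflexive (trans (total-total Js) cnt)
  good-val {p} (good k Js js cnt pck) (cutset U) = subst₂ _≤_ (sym (total-cut U Js))
      (trans (cong₂ _-_ (trans (∑-cong λ e → lem ⟦ cut (lookup U) e ⟧ (2^ k) (wt p e)) (sym (∑-* (2^ k) (λ e → ⟦ cut (lookup U) e ⟧ * wt p e)))) cnt)
             (lem₂ (2^ k) (weight (wt p) (lookup U)) (tot p)))
      (ℤₚ.+-monoˡ-≤ (- (+ length Js)) (weight-mono (lookup U) pck))
    where
    lem : ∀ b k c → b * (k * c) ≡ k * (b * c)
    lem = solve-∀
    lem₂ : ∀ k w t → k * w - k * t ≡ k * (w - t)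
    lem₂ = solve-∀

  total-val-nonneg : ∀ i → Admissible i → ∀ {Js} → All Join Js → 0ℤ ≤ total-val i Js
  total-val-nonneg i ad [] = +≤+ z≤n
  total-val-nonneg i ad (j ∷ js) = 0≤+ (join-valid j i ad) (total-val-nonneg i ad js)

  total-val-zero⇒ : ∀ i → Admissible i → ∀ {Js} → All Join Js → total-val i Js ≤ 0ℤ → ∀ {J} → J ∈ Js → val i (χ J) ≡ 0ℤ
  total-val-zero⇒ i ad {K ∷ Js} (j ∷ js) le J∈ = go J∈
    where
    a = val i (χ K)
    b = total-val i Js
    lem₁ : ∀ a b → b + (0ℤ - (a + b)) ≡ 0ℤ - a
    lem₁ = solve-∀
    lem₂ : ∀ a b → a + (0ℤ - (a + b)) ≡ 0ℤ - b
    lem₂ = solve-∀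
    go : ∀ {J} → J ∈ K ∷ Js → val i (χ J) ≡ 0ℤ
    go (here refl) = ≤0∧0≤ (≤-via _ (0≤+ (total-val-nonneg i ad js) (diff le)) (lem₁ a b)) (join-valid j i ad)
    go (there p) = total-val-zero⇒ i ad js (≤-via _ (0≤+ (join-valid j i ad) (diff le)) (lem₂ a b)) p

  -- Complementary slackness: the slacks of the joins are nonnegative, and their sum is at most a
  -- multiple of the slack of `p`.
  good-tight : ∀ {p} (g : Good p) {i} → Admissible i → val i p ≡ 0ℤ → ∀ {J} → J ∈ Good.joins g → val i (χ J) ≡ 0ℤ
  good-tight g {i} ad eq = total-val-zero⇒ i ad (Good.areJoins g)
    (subst (total-val i (Good.joins g) ≤_) (trans (cong (2^ (Good.exponent g) *_) eq) (ℤₚ.*-zeroʳ (2^ (Good.exponent g)))) (good-val g i))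

  -- Every join crosses `U`, so the number of joins is at most the load of the cut, and this is at
  -- most its scaled weight. Tightness makes the two ends equal, so the gaps on the single edges,
  -- which are nonnegative, all vanish.
  good-saturated : ∀ {p} (g : Good p) U → odd U ≡ true → weight (wt p) U ≡ tot p → ∀ e → cut U e ≡ true →
                   load (Good.joins g) e ≡ 2^ (Good.exponent g) * wt p e
  good-saturated {p} g@(good k Js js cnt pck) U o eq e ce = sym (ℤₚ.i-j≡0⇒i≡j (2^ k * wt p e) (load Js e)
      (trans (sym (ℤₚ.*-identityˡ _)) (subst (λ b → ⟦ b ⟧ * (2^ k * wt p e - load Js e) ≡ 0ℤ) ce (∑-zero⇒ f nonneg zeroSum e))))
    where
    f : Fin m → ℤ
    f e = ⟦ cut U e ⟧ * (2^ k * wt p e - load Js e)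
    nonneg : ∀ e → 0ℤ ≤ f e
    nonneg e = 0≤* (⟦⟧-nonneg (cut U e)) (diff (pck e))
    lower : + length Js ≤ weight (load Js) U
    lower = go js
      where
      go : ∀ {Js} → All Join Js → + length Js ≤ weight (load Js) U
      go [] = ℤₚ.≤-reflexive (sym (weight-0 U))
      go {J ∷ Js} (j ∷ js) = subst (+ length (J ∷ Js) ≤_) (sym (weight-load J Js U)) (ℤₚ.+-mono-≤ (crossing-pos j U o) (go js))
    total≡ : ∑ f ≡ 2^ k * weight (wt p) U - weight (load Js) U
    total≡ = trans (∑-cong λ e → lem ⟦ cut U e ⟧ (2^ k) (wt p e) (load Js e))
               (trans (∑-linear (2^ k) 1ℤ (λ e → ⟦ cut U e ⟧ * wt p e) (λ e → ⟦ cut U e ⟧ * load Js e)) (cong (λ z → 2^ k * weight (wt p) U - z) (ℤₚ.*-identityˡ _)))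
      where
      lem : ∀ b k c l → b * (k * c - l) ≡ k * (b * c) - 1ℤ * (b * l)
      lem = solve-∀
    zeroSum : ∑ f ≡ 0ℤ
    zeroSum = ≤0∧0≤ (subst (_≤ 0ℤ) (sym total≡) (ℤₚ.i≤j⇒i-j≤0
                (subst (_≤ weight (load Js) U) (trans cnt (cong (2^ k *_) (sym eq))) lower))) (∑-nonneg f nonneg)

  good-double : ∀ {p} (g : Good p) → Σ (Good p) λ h → Good.exponent h ≡ suc (Good.exponent g)
  good-double {p} (good k Js js cnt pck) = good (suc k) (Js ++ Js) (Allₚ.++⁺ js js)
      (trans (cong +_ (Listₚ.length-++ Js)) (trans (ℤₚ.pos-+ (length Js) (length Js)) (trans (cong₂ _+_ cnt cnt) (twice (tot p)))))
      (λ e → subst₂ _≤_ (sym (load-++ Js Js e)) (twice (wt p e)) (ℤₚ.+-mono-≤ (pck e) (pck e))) , refl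
    where
    lem : ∀ a x → a * x + a * x ≡ + 2 * a * x
    lem = solve-∀
    twice : ∀ x → 2^ k * x + 2^ k * x ≡ 2^ (suc k) * x
    twice x = trans (lem (2^ k) x) (cong (_* x) (sym (2^-+ 1 k)))

  -- Gluing two packings requires a common exponent.
  good-raise : ∀ {p} (g : Good p) j → Σ (Good p) λ h → Good.exponent h ≡ j ℕ.+ Good.exponent g
  good-raise g zero = g , refl
  good-raise g (suc j) with good-raise g j
  ... | h , eq with good-double h
  ...   | i , eq′ = i , trans eq′ (cong suc eq)

-- Stars, trails and compatible joins

card : ∀ {k} → (Fin k → Bool) → ℕ
card {zero} f = 0
card {suc k} f with f zero
... | true = suc (card (f ∘ suc))
... | false = card (f ∘ suc)

card-≤ : ∀ {k} (f g : Fin k → Bool) → (∀ i → f i ≡ true → g i ≡ true) → card f ℕ.≤ card g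
card-≤ {zero} f g p = z≤n
card-≤ {suc k} f g p with f zero in eqf | g zero in eqg
... | true | true = s≤s (card-≤ (f ∘ suc) (g ∘ suc) (p ∘ suc))
... | true | false = contradiction (trans (sym (p zero eqf)) eqg) λ ()
... | false | true = ℕₚ.m≤n⇒m≤1+n (card-≤ (f ∘ suc) (g ∘ suc) (p ∘ suc))
... | false | false = card-≤ (f ∘ suc) (g ∘ suc) (p ∘ suc)

card-< : ∀ {k} (f g : Fin k → Bool) → (∀ i → f i ≡ true → g i ≡ true) →
         ∀ j → f j ≡ false → g j ≡ true → card f ℕ.< card g
card-< {suc k} f g p zero fj gj with f zero | g zero
... | false | true = s≤s (card-≤ (f ∘ suc) (g ∘ suc) (p ∘ suc))
card-< {suc k} f g p (suc j) fj gj with f zero in eqf | g zero in eqg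
... | true | true = s≤s (card-< (f ∘ suc) (g ∘ suc) (p ∘ suc) j fj gj)
... | true | false = contradiction (trans (sym (p zero eqf)) eqg) λ ()
... | false | true = ℕₚ.m≤n⇒m≤1+n (card-< (f ∘ suc) (g ∘ suc) (p ∘ suc) j fj gj)
... | false | false = card-< (f ∘ suc) (g ∘ suc) (p ∘ suc) j fj gj

∧-split : ∀ a {b} → a ∧ b ≡ true → a ≡ true × b ≡ true
∧-split true p = refl , p

xor-sub : ∀ {a b} → (b ≡ true → a ≡ true) → a xor b ≡ true → a ≡ true × b ≡ false
xor-sub {true} {false} _ _ = refl , refl
xor-sub {false} {true} f _ = contradiction (f refl) λ ()
xor-sub {true} {true} _ ()
xor-sub {false} {false} _ ()

∧-join : ∀ {a b} → a ≡ true → b ≡ true → a ∧ b ≡ true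
∧-join refl refl = refl

⨁-△ : ∀ {k} (f g h : Fin k → Bool) → ⨁ (λ i → (f △ g) i ∧ h i) ≡ ⨁ (λ i → f i ∧ h i) xor ⨁ (λ i → g i ∧ h i)
⨁-△ f g h = trans (⨁-cong λ i → Boolₚ.∧-distribʳ-xor (h i) (f i) (g i)) (⨁-xor (λ i → f i ∧ h i) (λ i → g i ∧ h i))

⁅⁆-suc : ∀ {k} (a i : Fin k) → ⁅ suc a ⁆ (suc i) ≡ ⁅ a ⁆ i
⁅⁆-suc a i with toSum (a Fin.≟ i)
... | inj₁ refl = trans (⁅⁆-self (suc a)) (sym (⁅⁆-self a))
... | inj₂ p = trans (⁅⁆-other (λ { refl → p refl })) (sym (⁅⁆-other p))

opaque
  unfolding ∑ ⨁

  ⨁-single : ∀ {k} (a : Fin k) (h : Fin k → Bool) → ⨁ (λ i → ⁅ a ⁆ i ∧ h i) ≡ h a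
  ⨁-single {suc k} zero h = trans (cong₂ _xor_ (cong (_∧ h zero) (⁅⁆-self zero))
    (trans (⨁-cong λ i → cong (_∧ h (suc i)) (⁅⁆-other λ ())) (⨁-0 k))) (Boolₚ.xor-identityʳ (h zero))
  ⨁-single {suc k} (suc a) h = trans (cong (λ b → b ∧ h zero xor ⨁ (λ i → ⁅ suc a ⁆ (suc i) ∧ h (suc i))) (⁅⁆-other λ ()))
    (trans (⨁-cong λ i → cong (_∧ h (suc i)) (⁅⁆-suc a i)) (⨁-single a (h ∘ suc)))

⁅⁆-comm : ∀ {k} (a b : Fin k) → ⁅ a ⁆ b ≡ ⁅ b ⁆ a
⁅⁆-comm a b with toSum (a Fin.≟ b)
... | inj₁ refl = refl
... | inj₂ p = trans (⁅⁆-other p) (sym (⁅⁆-other (p ∘ sym)))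

⁅⁆-true : ∀ {k} (a b : Fin k) → ⁅ a ⁆ b ≡ true → a ≡ b
⁅⁆-true a b p with toSum (a Fin.≟ b)
... | inj₁ q = q
... | inj₂ q = contradiction (trans (sym p) (⁅⁆-other q)) λ ()

∑-⁅⁆ : ∀ {k} (d : Fin k) → ∑ (λ e → ⟦ ⁅ d ⁆ e ⟧) ≡ 1ℤ
∑-⁅⁆ {suc k} zero = trans (∑-suc (λ e → ⟦ ⁅ zero ⁆ e ⟧)) (cong₂ _+_ (cong ⟦_⟧ (⁅⁆-self zero))
  (trans (∑-cong λ i → cong ⟦_⟧ (⁅⁆-other {a = zero} {suc i} λ ())) (∑-0 k)))
∑-⁅⁆ {suc k} (suc d) = trans (∑-suc (λ e → ⟦ ⁅ suc d ⁆ e ⟧))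
  (trans (cong₂ _+_ (cong ⟦_⟧ (⁅⁆-other {a = suc d} {zero} λ ())) (∑-cong λ i → cong ⟦_⟧ (⁅⁆-suc d i)))
    (trans (ℤₚ.+-identityˡ _) (∑-⁅⁆ d)))

∑-△ : ∀ {k} (A : Fin k → Bool) d → A d ≡ false → ∑ (λ e → ⟦ (A △ ⁅ d ⁆) e ⟧) ≡ ∑ (λ e → ⟦ A e ⟧) + 1ℤ
∑-△ A d d∉A = trans (∑-cong split) (trans (∑-+ (λ e → ⟦ A e ⟧) (λ e → ⟦ ⁅ d ⁆ e ⟧))
                (cong (ℤ._+_ (∑ (λ e → ⟦ A e ⟧))) (∑-⁅⁆ d)))
  where
  split : ∀ e → ⟦ (A △ ⁅ d ⁆) e ⟧ ≡ ⟦ A e ⟧ + ⟦ ⁅ d ⁆ e ⟧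
  split e with toSum (d Fin.≟ e)
  ... | inj₁ refl rewrite d∉A | ⁅⁆-self d = refl
  ... | inj₂ p rewrite ⁅⁆-other p = trans (cong ⟦_⟧ (Boolₚ.xor-identityʳ (A e))) (sym (ℤₚ.+-identityʳ _))

∑-triple : ∀ {k} {a b c : Fin k} → a ≢ b → a ≢ c → b ≢ c → ∑ (λ e → ⟦ triple a b c e ⟧) ≡ + 3
∑-triple {a = a} {b} {c} p q r = trans (∑-cong λ e → cong ⟦_⟧ (triple-def a b c e))
  (trans (∑-△ (⁅ a ⁆ △ ⁅ b ⁆) c (cong₂ _xor_ (⁅⁆-other q) (⁅⁆-other r)))
    (cong (_+ 1ℤ) (trans (∑-△ ⁅ a ⁆ b (⁅⁆-other p)) (cong (_+ 1ℤ) (∑-⁅⁆ a)))))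

⨁-partner : ∀ {k} (h : Fin k → Bool) → ⨁ h ≡ false → ∀ f → h f ≡ true → ∃ λ g → g ≢ f × h g ≡ true
⨁-partner h even f hf with ⨁-true⇒ (h △ ⁅ f ⁆) odd′
  where
  odd′ : ⨁ (h △ ⁅ f ⁆) ≡ true
  odd′ = trans (⨁-xor h ⁅ f ⁆) (cong₂ _xor_ even
    (trans (⨁-cong λ i → sym (Boolₚ.∧-identityʳ (⁅ f ⁆ i))) (⨁-single f (λ _ → true))))
... | g , p with toSum (g Fin.≟ f)
...   | inj₁ refl = contradiction (trans (sym p) (cong₂ _xor_ hf (⁅⁆-self f))) λ ()
...   | inj₂ g≢f = g , g≢f , trans (sym (Boolₚ.xor-identityʳ (h g))) (trans (cong (h g xor_) (sym (⁅⁆-other (g≢f ∘ sym)))) p)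

module Stars {m n} (G : Graft m n) where
  open Graft G
  open Weights G

  star : Fin n → Subsetᵇ m
  star x = cut ⁅ x ⁆

  ends : ∀ x e → star x e ≡ true → (src e ≡ x × tgt e ≢ x) ⊎ (tgt e ≡ x × src e ≢ x)
  ends x e p with toSum (x Fin.≟ src e) | toSum (x Fin.≟ tgt e)
  ... | inj₁ refl | inj₁ q = contradiction (trans (sym p) (cong₂ _xor_ (⁅⁆-self x) (trans (cong ⁅ x ⁆ (sym q)) (⁅⁆-self x)))) λ ()
  ... | inj₁ refl | inj₂ q = inj₁ (refl , q ∘ sym)
  ... | inj₂ q | inj₁ refl = inj₂ (refl , q ∘ sym)
  ... | inj₂ q | inj₂ r = contradiction (trans (sym p) (cong₂ _xor_ (⁅⁆-other q) (⁅⁆-other r))) λ ()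

  star-ends : ∀ e y → star y e ≡ ⁅ src e ⁆ y xor ⁅ tgt e ⁆ y
  star-ends e y = cong₂ _xor_ (⁅⁆-comm y (src e)) (⁅⁆-comm y (tgt e))

  cut-stars : ∀ U e → cut U e ≡ ⨁ (λ x → U x ∧ star x e)
  cut-stars U e = sym (trans (⨁-cong λ x → trans (cong (U x ∧_) (star-ends e x)) (Boolₚ.∧-comm (U x) _))
    (trans (⨁-△ ⁅ src e ⁆ ⁅ tgt e ⁆ U) (cong₂ _xor_ (⨁-single (src e) U) (⨁-single (tgt e) U))))

  -- A cut is the symmetric difference of the stars of its vertices, and parity is additive.
  join-from-stars : ∀ {J} → (∀ x → ⨁ (λ e → J e ∧ star x e) ≡ T x) → Join J
  join-from-stars {J} p U = begin
    ⨁ (λ e → J e ∧ cut U e)                        ≡⟨ ⨁-cong (λ e → cong (J e ∧_) (cut-stars U e)) ⟩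
    ⨁ (λ e → J e ∧ ⨁ (λ x → U x ∧ star x e))       ≡⟨ ⨁-cong (λ e → ⨁-∧ (J e) (λ x → U x ∧ star x e)) ⟩
    ⨁ (λ e → ⨁ (λ x → J e ∧ (U x ∧ star x e)))     ≡⟨ ⨁-swap (λ e x → J e ∧ (U x ∧ star x e)) ⟩
    ⨁ (λ x → ⨁ (λ e → J e ∧ (U x ∧ star x e)))     ≡⟨ ⨁-cong (λ x → ⨁-cong (λ e → flip-∧ (J e) (U x) (star x e))) ⟩
    ⨁ (λ x → ⨁ (λ e → U x ∧ (J e ∧ star x e)))     ≡⟨ ⨁-cong (λ x → ⨁-∧ (U x) (λ e → J e ∧ star x e)) ⟨
    ⨁ (λ x → U x ∧ ⨁ (λ e → J e ∧ star x e))       ≡⟨ ⨁-cong (λ x → cong (U x ∧_) (p x)) ⟩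
    ⨁ (λ x → U x ∧ T x)                            ∎
    where
    open ≡-Reasoning
    flip-∧ : ∀ a b c → a ∧ (b ∧ c) ≡ b ∧ (a ∧ c)
    flip-∧ a b c = trans (sym (Boolₚ.∧-assoc a b c)) (trans (cong (_∧ c) (Boolₚ.∧-comm a b)) (Boolₚ.∧-assoc b a c))

  odd-star : ∀ x → odd ⁅ x ⁆ ≡ T x
  odd-star x = ⨁-single x T

  module Trail (D : Subsetᵇ m) (W : Subsetᵇ n) (even : ∀ x → W x ≡ true → ⨁ (λ e → D e ∧ star x e) ≡ false) where

    record Trail (a : Fin m) : Set where
      field
        K : Subsetᵇ m
        K⊆D : ∀ e → K e ≡ true → D e ≡ true
        closed : ∀ x → W x ≡ true → ⨁ (λ e → K e ∧ star x e) ≡ false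
        b : Fin m
        b≢a : b ≢ a
        b∈D : D b ≡ true
        b∈cut : cut W b ≡ true
        trace : ∀ e → K e ∧ cut W e ≡ ⁅ a ⁆ e xor ⁅ b ⁆ e

    grow : ∀ {a} (K : Subsetᵇ m) → (∀ e → K e ≡ true → D e ≡ true) →
           (∀ e → K e ∧ cut W e ≡ ⁅ a ⁆ e) → ∀ x → W x ≡ true →
           (∀ y → W y ≡ true → ⨁ (λ e → K e ∧ star y e) ≡ ⁅ x ⁆ y) →
           Acc ℕ._<_ (card (D △ K)) → Trail a
    grow {a} K K⊆D trace x x∈W cur (acc rs) with ⨁-true⇒ (λ e → (D △ K) e ∧ star x e)
        (trans (⨁-△ D K (star x)) (cong₂ _xor_ (even x x∈W) (trans (cur x x∈W) (⁅⁆-self x))))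
    ... | g , p = go (cut W g) refl
      where
      fresh : D g ≡ true × K g ≡ false
      fresh = xor-sub (K⊆D g) (proj₁ (∧-split ((D △ K) g) p))
      g∈D = proj₁ fresh
      g∉K = proj₂ fresh
      g∋x : star x g ≡ true
      g∋x = proj₂ (∧-split ((D △ K) g) p)
      K′ = K △ ⁅ g ⁆
      K′⊆D : ∀ e → K′ e ≡ true → D e ≡ true
      K′⊆D e q with toSum (g Fin.≟ e)
      ... | inj₁ refl = g∈D
      ... | inj₂ g≢e = K⊆D e (trans (sym (trans (cong (K e xor_) (⁅⁆-other g≢e)) (Boolₚ.xor-identityʳ (K e)))) q)
      cur′ : ∀ y → W y ≡ true → ⨁ (λ e → K′ e ∧ star y e) ≡ ⁅ x ⁆ y xor star y g
      cur′ y y∈W = trans (⨁-△ K ⁅ g ⁆ (star y)) (cong₂ _xor_ (cur y y∈W) (⨁-single g (star y)))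
      trace′ : ∀ e → K′ e ∧ cut W e ≡ ⁅ a ⁆ e xor (⁅ g ⁆ e ∧ cut W e)
      trace′ e = trans (Boolₚ.∧-distribʳ-xor (cut W e) (K e) (⁅ g ⁆ e)) (cong (_xor (⁅ g ⁆ e ∧ cut W e)) (trace e))
      at-g : ∀ {b} → cut W g ≡ b → ∀ e → ⁅ g ⁆ e ∧ cut W e ≡ ⁅ g ⁆ e ∧ b
      at-g eq e with toSum (g Fin.≟ e)
      ... | inj₁ refl = cong (⁅ g ⁆ g ∧_) eq
      ... | inj₂ q = trans (cong (_∧ cut W e) (⁅⁆-other q)) (sym (cong (_∧ _) (⁅⁆-other q)))
      endpoints : ∃ λ y → y ≢ x × cut W g ≡ not (W y) × (∀ z → ⁅ x ⁆ z xor star z g ≡ ⁅ y ⁆ z)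
      cancel : ∀ {u v z} → u ≡ x → ⁅ x ⁆ z xor (⁅ u ⁆ z xor ⁅ v ⁆ z) ≡ ⁅ v ⁆ z
      cancel {v = v} {z} refl = trans (sym (Boolₚ.xor-assoc (⁅ x ⁆ z) _ _)) (cong (_xor ⁅ v ⁆ z) (Boolₚ.xor-same (⁅ x ⁆ z)))
      endpoints with ends x g g∋x
      ... | inj₁ (sx , t≢x) = tgt g , t≢x , cong (_xor W (tgt g)) (trans (cong W sx) x∈W) ,
              λ z → trans (cong (⁅ x ⁆ z xor_) (star-ends g z)) (cancel sx)
      ... | inj₂ (tx , s≢x) = src g , s≢x , trans (Boolₚ.xor-comm (W (src g)) _) (cong (_xor W (src g)) (trans (cong W tx) x∈W)) ,
              λ z → trans (cong (⁅ x ⁆ z xor_) (trans (star-ends g z) (Boolₚ.xor-comm (⁅ src g ⁆ z) _))) (cancel tx)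
      y = proj₁ endpoints
      side = proj₁ (proj₂ (proj₂ endpoints))
      other = proj₂ (proj₂ (proj₂ endpoints))
      go : ∀ b → cut W g ≡ b → Trail a
      go true eq = record
        { K = K′ ; K⊆D = K′⊆D ; b = g ; b∈D = g∈D ; b∈cut = eq
        ; closed = λ z z∈W → trans (cur′ z z∈W) (trans (other z) (⁅⁆-other (λ { refl → contradiction (trans (sym eq) (trans side (cong not z∈W))) λ () })))
        ; b≢a = λ { refl → contradiction (trans (sym g∉K) (proj₁ (∧-split (K a) (trans (trace a) (⁅⁆-self a))))) λ () }
        ; trace = λ e → trans (trace′ e) (cong (⁅ a ⁆ e xor_) (trans (at-g eq e) (Boolₚ.∧-identityʳ _)))
        }
      go false eq = grow K′ K′⊆D
        (λ e → trans (trace′ e) (trans (cong (⁅ a ⁆ e xor_) (trans (at-g eq e) (Boolₚ.∧-zeroʳ _))) (Boolₚ.xor-identityʳ _)))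
        y (not-false (trans (sym side) eq)) (λ z z∈W → trans (cur′ z z∈W) (other z))
        (rs (card-< (D △ K′) (D △ K) shrink g g-out g-in))
        where
        not-false : ∀ {b} → not b ≡ false → b ≡ true
        not-false {true} _ = refl
        g-in : (D △ K) g ≡ true
        g-in = cong₂ _xor_ g∈D g∉K
        g-out : (D △ K′) g ≡ false
        g-out = cong₂ _xor_ g∈D (cong₂ _xor_ g∉K (⁅⁆-self g))
        shrink : ∀ e → (D △ K′) e ≡ true → (D △ K) e ≡ true
        shrink e q with toSum (g Fin.≟ e)
        ... | inj₁ refl = g-in
        ... | inj₂ g≢e = trans (cong (D e xor_) (sym (trans (cong (K e xor_) (⁅⁆-other g≢e)) (Boolₚ.xor-identityʳ (K e))))) q

    trail : ∀ a → D a ≡ true → cut W a ≡ true → Trail a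
    trail a a∈D a∈cut = start (W (src a)) (W (tgt a)) refl refl a∈cut
      where
      trace₀ : ∀ e → ⁅ a ⁆ e ∧ cut W e ≡ ⁅ a ⁆ e
      trace₀ e with toSum (a Fin.≟ e)
      ... | inj₁ refl = trans (cong (⁅ a ⁆ a ∧_) a∈cut) (Boolₚ.∧-identityʳ _)
      ... | inj₂ q = trans (cong (_∧ cut W e) (⁅⁆-other q)) (sym (⁅⁆-other q))
      sub : ∀ e → ⁅ a ⁆ e ≡ true → D e ≡ true
      sub e q = subst (λ e → D e ≡ true) (⁅⁆-true a e q) a∈D
      cur₀ : ∀ x z → W z ≡ true → star z a ≡ ⁅ x ⁆ z → ⨁ (λ e → ⁅ a ⁆ e ∧ star z e) ≡ ⁅ x ⁆ z
      cur₀ x z z∈W q = trans (⨁-single a (star z)) q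
      start : ∀ p q → W (src a) ≡ p → W (tgt a) ≡ q → p xor q ≡ true → Trail a
      start true false s t _ = grow ⁅ a ⁆ sub trace₀ (src a) s (λ z z∈W → cur₀ (src a) z z∈W
        (trans (star-ends a z) (trans (cong (⁅ src a ⁆ z xor_) (⁅⁆-other (λ { refl → contradiction (trans (sym t) z∈W) λ () }))) (Boolₚ.xor-identityʳ _))))
        (<-wellFounded _)
      start false true s t _ = grow ⁅ a ⁆ sub trace₀ (tgt a) t (λ z z∈W → cur₀ (tgt a) z z∈W
        (trans (star-ends a z) (cong (_xor ⁅ tgt a ⁆ z) (⁅⁆-other (λ { refl → contradiction (trans (sym s) z∈W) λ () })))))
        (<-wellFounded _)

  module Cut (U : Subsetᵇ n) where

    ∁U : Subsetᵇ n
    ∁U x = not (U x)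

    cut-∁ : cut ∁U ≗ cut U
    cut-∁ e = Boolₚ.xor-annihilates-not (U (src e)) (U (tgt e))

    glue : Subsetᵇ m → Subsetᵇ m → Subsetᵇ m
    glue J K e = Bool.if U (src e) ∨ U (tgt e) then J e else K e

    glue-inside : ∀ J K {e} → U (src e) ∨ U (tgt e) ≡ true → glue J K e ≡ J e
    glue-inside J K p rewrite p = refl

    glue-outside : ∀ J K {e} → U (src e) ∨ U (tgt e) ≡ false → glue J K e ≡ K e
    glue-outside J K p rewrite p = refl

    glue-cut : ∀ J K {e} → cut U e ≡ true → glue J K e ≡ J e
    glue-cut J K {e} p = glue-inside J K (xor⇒∨ (U (src e)) p)
      where
      xor⇒∨ : ∀ a {b} → a xor b ≡ true → a ∨ b ≡ true
      xor⇒∨ true _ = refl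
      xor⇒∨ false p = p

  module Compatible (s : Subsetᵇ m) (tight : Subsetᵇ n) where

    -- Parity and uniqueness are tested only inside `W`. A set that passes on one side of a cut can
    -- then be combined with one that passes on the other side.
    record Local (W : Subsetᵇ n) (J : Subsetᵇ m) : Set where
      field
        parity : ∀ x → W x ≡ true → ⨁ (λ e → J e ∧ star x e) ≡ T x
        support : ∀ e → J e ≡ true → s e ≡ true
        unique : ∀ x → W x ≡ true → tight x ≡ true → ∀ e f → J e ∧ star x e ≡ true → J f ∧ star x f ≡ true → e ≡ f

    local? : ∀ W J → Dec (Local W J)
    local? W J with Finₚ.all? (λ x → (W x Bool.≟ true) →-dec (⨁ (λ e → J e ∧ star x e) Bool.≟ T x))
                  | Finₚ.all? (λ e → (J e Bool.≟ true) →-dec (s e Bool.≟ true))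
                  | Finₚ.all? (λ x → (W x Bool.≟ true) →-dec ((tight x Bool.≟ true) →-dec
                      (Finₚ.all? λ e → Finₚ.all? λ f → (J e ∧ star x e Bool.≟ true) →-dec ((J f ∧ star x f Bool.≟ true) →-dec (e Fin.≟ f)))))
    ... | yes p | yes q | yes r = yes record { parity = p ; support = q ; unique = r }
    ... | no p | _ | _ = no λ l → p (Local.parity l)
    ... | yes _ | no q | _ = no λ l → q (Local.support l)
    ... | yes _ | yes _ | no r = no λ l → r (Local.unique l)

    local-cong : ∀ {W J K} → J ≗ K → Local W J → Local W K
    local-cong p l = record
      { parity = λ x w → trans (⨁-cong λ e → cong (_∧ star x e) (sym (p e))) (parity x w)
      ; support = λ e k → support e (trans (p e) k)
      ; unique = λ x w t e f a b → unique x w t e f (trans (cong (_∧ star x e) (p e)) a) (trans (cong (_∧ star x f) (p f)) b)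
      }
      where open Local l

    -- The witness is a vector, so membership can be decided by search.
    Trace : Subsetᵇ n → Subsetᵇ m → Set
    Trace W R = ∃ λ (J : Subset m) → Local W (lookup J) × (∀ e → lookup J e ∧ cut W e ≡ R e)

    trace-of : ∀ {W R} J → Local W J → (∀ e → J e ∧ cut W e ≡ R e) → Trace W R
    trace-of {W} J l t = tabulate J , local-cong (sym ∘ lookup∘tabulate J) l ,
      λ e → trans (cong (_∧ cut W e) (lookup∘tabulate J e)) (t e)

    -- A trail in the symmetric difference of the two sets enters `W` through `a` and leaves it
    -- through `b`. Adding it to `J₁` alters the trace in exactly these two edges.
    exchange : ∀ {W A B} → Trace W A → Trace W B → ∀ a → A a ≢ B a →
               ∃ λ b → b ≢ a × A b ≢ B b × Trace W (A △ ⁅ a ⁆ △ ⁅ b ⁆)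
    exchange {W} {A} {B} (J₁′ , l₁ , t₁) (J₂′ , l₂ , t₂) a Aa≢Ba = b , b≢a , Ab≢Bb , trace-of J local trace′
      where
      J₁ = lookup J₁′
      J₂ = lookup J₂′
      D = J₁ △ J₂
      module L₁ = Local l₁
      module L₂ = Local l₂
      even : ∀ x → W x ≡ true → ⨁ (λ e → D e ∧ star x e) ≡ false
      even x w = trans (⨁-△ J₁ J₂ (star x)) (trans (cong₂ _xor_ (L₁.parity x w) (L₂.parity x w)) (Boolₚ.xor-same (T x)))
      differ : ∀ p q c {u v} → p ∧ c ≡ u → q ∧ c ≡ v → u ≢ v → p xor q ≡ true × c ≡ true
      differ true false true _ _ _ = refl , refl
      differ false true true _ _ _ = refl , refl
      differ true true c refl refl ne = contradiction refl ne
      differ false false c refl refl ne = contradiction refl ne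
      differ true false false refl refl ne = contradiction refl ne
      differ false true false refl refl ne = contradiction refl ne
      found = differ (J₁ a) (J₂ a) (cut W a) (t₁ a) (t₂ a) Aa≢Ba
      open Trail.Trail (Trail.trail D W even a (proj₁ found) (proj₂ found))
      J = J₁ △ K
      Ab≢Bb : A b ≢ B b
      Ab≢Bb eq = clash (J₁ b) (J₂ b) b∈D (trans (sym (at {J₁′} {A} t₁)) (trans eq (at {J₂′} {B} t₂)))
        where
        at : ∀ {J : Subset m} {R} → (∀ e → lookup J e ∧ cut W e ≡ R e) → R b ≡ lookup J b
        at {J} t = trans (sym (t b)) (trans (cong (lookup J b ∧_) b∈cut) (Boolₚ.∧-identityʳ _))
        clash : ∀ p q → p xor q ≡ true → p ≢ q
        clash true true () _
        clash false false () _
        clash true false _ ()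
        clash false true _ ()
      trace′ : ∀ e → J e ∧ cut W e ≡ (A △ ⁅ a ⁆ △ ⁅ b ⁆) e
      trace′ e = trans (Boolₚ.∧-distribʳ-xor (cut W e) (J₁ e) (K e))
        (trans (cong₂ _xor_ (t₁ e) (trace e)) (sym (Boolₚ.xor-assoc (A e) (⁅ a ⁆ e) (⁅ b ⁆ e))))
      origin : ∀ e → J e ≡ true → (J₁ e ≡ true × K e ≡ false) ⊎ (J₁ e ≡ false × K e ≡ true × J₂ e ≡ true)
      origin e p with J₁ e in eq₁ | K e in eqk
      ... | true | false = inj₁ (refl , refl)
      ... | false | true = inj₂ (refl , refl , trans (cong (_xor J₂ e) (sym eq₁)) (K⊆D e eqk))
      origin e () | true | true
      origin e () | false | false
      -- At a tight vertex K takes both or neither of the edges in which J₁ and J₂ differ.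
      mixed : ∀ x → W x ≡ true → tight x ≡ true → ∀ e f → star x e ≡ true → star x f ≡ true →
              J₁ e ≡ true → K e ≡ false → J₁ f ≡ false → K f ≡ true → J₂ f ≡ true → ⊥
      mixed x w t e f se sf j₁e ke j₁f kf j₂f with ⨁-partner _ (closed x w) f (∧-join kf sf)
      ... | g , g≢f , p with ∧-split (K g) p
      ...   | kg , sg with J₁ g in eq
      ...     | true = contradiction (trans (sym kg) (trans (cong K (L₁.unique x w t g e (∧-join eq sg) (∧-join j₁e se))) ke)) λ ()
      ...     | false = g≢f (L₂.unique x w t g f (∧-join (trans (cong (_xor J₂ g) (sym eq)) (K⊆D g kg)) sg) (∧-join j₂f sf))
      local : Local W J
      local = record
        { parity = λ x w → trans (⨁-△ J₁ K (star x)) (trans (cong₂ _xor_ (L₁.parity x w) (closed x w)) (Boolₚ.xor-identityʳ _))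
        ; support = λ e p → sup e (origin e p)
        ; unique = λ x w t e f p q → uniq x w t e f (∧-split (J e) p) (∧-split (J f) q)
        }
        where
        sup : ∀ e → (J₁ e ≡ true × K e ≡ false) ⊎ (J₁ e ≡ false × K e ≡ true × J₂ e ≡ true) → s e ≡ true
        sup e (inj₁ (p , _)) = L₁.support e p
        sup e (inj₂ (_ , _ , p)) = L₂.support e p
        uniq : ∀ x → W x ≡ true → tight x ≡ true → ∀ e f → J e ≡ true × star x e ≡ true → J f ≡ true × star x f ≡ true → e ≡ f
        uniq x w t e f (je , se) (jf , sf) with origin e je | origin f jf
        ... | inj₁ (p , _) | inj₁ (q , _) = L₁.unique x w t e f (∧-join p se) (∧-join q sf)
        ... | inj₂ (_ , _ , p) | inj₂ (_ , _ , q) = L₂.unique x w t e f (∧-join p se) (∧-join q sf)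
        ... | inj₁ (p , k) | inj₂ (p′ , k′ , q′) = ⊥-elim (mixed x w t e f se sf p k p′ k′ q′)
        ... | inj₂ (p′ , k′ , q′) | inj₁ (p , k) = ⊥-elim (mixed x w t f e sf se p k p′ k′ q′)

    Compat : Subsetᵇ m → Set
    Compat = Local (λ _ → true)

    restrict : ∀ {J} W → Compat J → Local W J
    restrict W l = record { parity = λ x _ → parity x refl ; support = support ; unique = λ x _ → unique x refl }
      where open Local l

    compat-join : ∀ {J} → Compat J → Join J
    compat-join l = join-from-stars λ x → Local.parity l x refl

    module _ (U : Subsetᵇ n) where

      open Cut U

      module _ {J K R : Subsetᵇ m} (lJ : Local U J) (lK : Local ∁U K)
               (tJ : ∀ e → J e ∧ cut U e ≡ R e) (tK : ∀ e → K e ∧ cut ∁U e ≡ R e) where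

        private
          H = glue J K

        glue-trace : ∀ e → H e ∧ cut U e ≡ R e
        glue-trace e = trans (go (cut U e) refl) (tJ e)
          where
          go : ∀ b → cut U e ≡ b → H e ∧ cut U e ≡ J e ∧ cut U e
          go true eq = cong (_∧ cut U e) (glue-cut J K eq)
          go false eq rewrite eq = trans (Boolₚ.∧-zeroʳ _) (sym (Boolₚ.∧-zeroʳ _))

        same-on-cut : ∀ {e} → cut U e ≡ true → J e ≡ K e
        same-on-cut {e} p = begin
          J e                   ≡⟨ Boolₚ.∧-identityʳ _ ⟨
          J e ∧ true            ≡⟨ cong (J e ∧_) p ⟨
          J e ∧ cut U e         ≡⟨ trans (tJ e) (sym (tK e)) ⟩
          K e ∧ cut ∁U e        ≡⟨ cong (K e ∧_) (trans (cut-∁ e) p) ⟩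
          K e ∧ true            ≡⟨ Boolₚ.∧-identityʳ _ ⟩
          K e                   ∎
          where open ≡-Reasoning

        at-inside : ∀ x → U x ≡ true → ∀ e → star x e ≡ true → H e ≡ J e
        at-inside x x∈U e se with ends x e se
        ... | inj₁ (refl , _) = glue-inside J K (cong (_∨ U (tgt e)) x∈U)
        ... | inj₂ (refl , _) = glue-inside J K (trans (cong (U (src e) ∨_) x∈U) (Boolₚ.∨-zeroʳ _))

        at-outside : ∀ x → U x ≡ false → ∀ e → star x e ≡ true → H e ≡ K e
        at-outside x x∉U e se with ends x e se
        ... | inj₁ (refl , _) = go (U (tgt e)) refl
          where
          go : ∀ b → U (tgt e) ≡ b → H e ≡ K e
          go true eq = trans (glue-cut J K c) (same-on-cut c)
            where c = cong₂ _xor_ x∉U eq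
          go false eq = glue-outside J K (cong₂ _∨_ x∉U eq)
        ... | inj₂ (refl , _) = go (U (src e)) refl
          where
          go : ∀ b → U (src e) ≡ b → H e ≡ K e
          go true eq = trans (glue-cut J K c) (same-on-cut c)
            where c = cong₂ _xor_ eq x∉U
          go false eq = glue-outside J K (cong₂ _∨_ eq x∉U)

        masked : ∀ {L : Subsetᵇ m} {x : Fin n} → (∀ e → star x e ≡ true → H e ≡ L e) → ∀ e → H e ∧ star x e ≡ L e ∧ star x e
        masked {L} {x} p e with star x e in eq
        ... | true = cong (_∧ true) (p e eq)
        ... | false = trans (Boolₚ.∧-zeroʳ _) (sym (Boolₚ.∧-zeroʳ _))

        private
          module LJ = Local lJ
          module LK = Local lK

        glue-compat : Compat H
        glue-compat = record { parity = λ x _ → par x (U x) refl ; support = sup ; unique = λ x _ → uni x (U x) refl }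
          where
          par : ∀ x b → U x ≡ b → ⨁ (λ e → H e ∧ star x e) ≡ T x
          par x true eq = trans (⨁-cong (masked {J} {x} (at-inside x eq))) (LJ.parity x eq)
          par x false eq = trans (⨁-cong (masked {K} {x} (at-outside x eq))) (LK.parity x (cong not eq))
          sup : ∀ e → H e ≡ true → s e ≡ true
          sup e p = go (U (src e) ∨ U (tgt e)) refl
            where
            go : ∀ b → U (src e) ∨ U (tgt e) ≡ b → s e ≡ true
            go true eq = LJ.support e (trans (sym (glue-inside J K eq)) p)
            go false eq = LK.support e (trans (sym (glue-outside J K eq)) p)
          uni : ∀ x b → U x ≡ b → tight x ≡ true → ∀ e f → H e ∧ star x e ≡ true → H f ∧ star x f ≡ true → e ≡ f
          uni x true eq t e f p q = LJ.unique x eq t e f (trans (sym (masked {J} {x} (at-inside x eq) e)) p)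
                                                         (trans (sym (masked {J} {x} (at-inside x eq) f)) q)
          uni x false eq t e f p q = LK.unique x (cong not eq) t e f (trans (sym (masked {K} {x} (at-outside x eq) e)) p)
                                                                     (trans (sym (masked {K} {x} (at-outside x eq) f)) q)

      crossing : Subsetᵇ m → ℤ
      crossing J = weight (wt (χ J)) U

      crossing-trace : ∀ J {R : Subsetᵇ m} → (∀ e → J e ∧ cut U e ≡ R e) → crossing J ≡ ∑ (λ e → ⟦ R e ⟧)
      crossing-trace J t = ∑-cong λ e → trans (times (J e) (cut U e)) (cong ⟦_⟧ (t e))
        where
        times : ∀ a b → ⟦ b ⟧ * ⟦ a ⟧ ≡ ⟦ a ∧ b ⟧
        times true true = refl
        times true false = refl
        times false true = refl
        times false false = refl

      -- A search over all edge sets decides the claim and permits an argument by contradiction: a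
      -- common trace of three or five edges would glue to the desired join, and two families
      -- without one do not exist.
      three-or-five : ∀ {J a b c} → Compat J →
        a ≢ b → a ≢ c → b ≢ c → J a ∧ cut U a ≡ true → J b ∧ cut U b ≡ true → J c ∧ cut U c ≡ true →
        (∀ e → J e ∧ cut U e ≡ true → ∃ λ K → Compat K × (∀ f → K f ∧ cut U f ≡ ⁅ e ⁆ f)) →
        ∃ λ K → Compat K × (crossing K ≡ + 3 ⊎ crossing K ≡ + 5)
      three-or-five {J} {a} {b} {c} lJ a≢b a≢c b≢c a∈ b∈ c∈ single with anySubset? (λ K → local? (λ _ → true) (lookup K)
            ×-dec ((crossing (lookup K) ℤ.≟ + 3) ⊎-dec (crossing (lookup K) ℤ.≟ + 5)))
      ... | yes (K , p) = lookup K , p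
      ... | no none = ⊥-elim (no-disjoint-families FU FV no₃ no₅ a≢b a≢c b≢c a∈ b∈ c∈)
        where
        X : Subsetᵇ m
        X e = J e ∧ cut U e
        family : ∀ W → cut W ≗ cut U → Family X
        family W cw = record
          { R = Trace W
          ; R? = λ A → anySubset? λ K → local? W (lookup K) ×-dec Finₚ.all? (λ e → lookup K e ∧ cut W e Bool.≟ A e)
          ; respects = λ { p (K , l , t) → K , l , λ e → trans (t e) (p e) }
          ; exchange = exchange
          ; singletons = sing
          ; whole = trace-of J (restrict W lJ) (λ e → cong (J e ∧_) (cw e))
          }
          where
          sing : ∀ e → X e ≡ true → Trace W ⁅ e ⁆
          sing e e∈ with single e e∈
          ... | K , l , t = trace-of K (restrict W l) λ f → trans (cong (K f ∧_) (cw f)) (t f)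
        FU = family U (λ _ → refl)
        FV = family ∁U cut-∁
        combine : ∀ {R} → Trace U R → Trace ∁U R → ∃ λ K → Compat (lookup K) × crossing (lookup K) ≡ ∑ (λ e → ⟦ R e ⟧)
        combine {R} (J₁ , l₁ , t₁) (J₂ , l₂ , t₂) = tabulate H , local-cong (sym ∘ lookup∘tabulate H) (glue-compat l₁ l₂ t₁ t₂) ,
            crossing-trace (lookup (tabulate H)) {R} (λ e → trans (cong (_∧ cut U e) (lookup∘tabulate H e)) (glue-trace l₁ l₂ t₁ t₂ e))
          where
          H = glue (lookup J₁) (lookup J₂)
        no₃ : ¬ Common₃ FU FV
        no₃ record { a≢b = p ; a≢c = q ; b≢c = r ; inF = f ; inG = g } with combine f g
        ... | K , l , t = none (K , l , inj₁ (trans t (∑-triple p q r)))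
        no₅ : ¬ Common₅ FU FV
        no₅ record { a = a ; b = b ; c = c ; d = d ; e = e ; a≢b = ab ; a≢c = ac ; a≢d = ad ; a≢e = ae ; b≢c = bc ; b≢d = bd
                   ; b≢e = be ; c≢d = cd ; c≢e = ce ; d≢e = de ; inF = f ; inG = g } with combine f g
        ... | K , l , t = none (K , l , inj₂ (trans t (trans
              (∑-△ (triple a b c △ ⁅ d ⁆) e (cong₂ _xor_ (triple-false ae be ce) (⁅⁆-other de)))
              (cong (_+ 1ℤ) (trans (∑-△ (triple a b c) d (triple-false ad bd cd)) (cong (_+ 1ℤ) (∑-triple ab ac bc)))))))

-- Contraction and gluing along a tight cut

∑-one⇒ : ∀ {k} (R : Fin k → Bool) → ∑ (λ e → ⟦ R e ⟧) ≡ 1ℤ → ∃ λ d → R ≗ ⁅ d ⁆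
∑-one⇒ R eq with ∑-positive⇒ (λ e → ⟦ R e ⟧) (subst (0ℤ <_) (sym eq) (ℤ.+<+ (s≤s z≤n)))
... | d , pos = d , same
  where
  Rd : R d ≡ true
  Rd = pos⇒ (R d) pos
    where
    pos⇒ : ∀ b → 0ℤ < ⟦ b ⟧ → b ≡ true
    pos⇒ true _ = refl
    pos⇒ false (ℤ.+<+ ())
  A = R △ ⁅ d ⁆
  A△d : ∀ e → (A △ ⁅ d ⁆) e ≡ R e
  A△d e = trans (Boolₚ.xor-assoc (R e) (⁅ d ⁆ e) (⁅ d ⁆ e)) (trans (cong (R e xor_) (Boolₚ.xor-same (⁅ d ⁆ e))) (Boolₚ.xor-identityʳ (R e)))
  A-empty : ∑ (λ e → ⟦ A e ⟧) ≡ 0ℤ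
  A-empty = +-cancelʳ 1ℤ (∑ (λ e → ⟦ A e ⟧)) 0ℤ
    (trans (sym (∑-△ A d (cong₂ _xor_ Rd (⁅⁆-self d)))) (trans (∑-cong λ e → cong ⟦_⟧ (A△d e)) eq))
  zero⇒ : ∀ {b} → ⟦ b ⟧ ≡ 0ℤ → b ≡ false
  zero⇒ {false} _ = refl
  xor-false : ∀ a {b} → a xor b ≡ false → a ≡ b
  xor-false true {true} _ = refl
  xor-false false p = sym p
  same : R ≗ ⁅ d ⁆
  same e = xor-false (R e) (zero⇒ (∑-zero⇒ _ (λ e → ⟦⟧-nonneg (A e)) A-empty e))

module _ {m n} (G : Graft m n) where
  open Graft G

  -- The fibres of `ρ` are to be contracted. By idempotence each fibre that is not empty contains
  -- exactly one fixed point, which represents it.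
  record Retraction : Set where
    field
      ρ : Fin n → Fin n
      idem : ∀ x → ρ (ρ x) ≡ ρ x
      preserves : ∀ x → alive x ≡ true → alive (ρ x) ≡ true

  module _ (r : Retraction) where
    open Retraction r

    contract : Graft m n
    contract = record
      { src = ρ ∘ src
      ; tgt = ρ ∘ tgt
      ; T = T′
      ; alive = alive′
      ; src-alive = λ e → live (src e) (src-alive e)
      ; tgt-alive = λ e → live (tgt e) (tgt-alive e)
      ; T-alive = T′-alive
      }
      where
      T′ : Subsetᵇ n
      T′ y = ⨁ λ x → T x ∧ ⁅ ρ x ⁆ y
      alive′ : Subsetᵇ n
      alive′ y = alive y ∧ ⁅ ρ y ⁆ y
      live : ∀ x → alive x ≡ true → alive′ (ρ x) ≡ true
      live x p = ∧-join (preserves x p) (trans (cong (λ z → ⁅ z ⁆ (ρ x)) (idem x)) (⁅⁆-self (ρ x)))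
      T′-alive : ∀ y → T′ y ≡ true → alive′ y ≡ true
      T′-alive y p with ⨁-true⇒ (λ x → T x ∧ ⁅ ρ x ⁆ y) p
      ... | x , q with ∧-split (T x) q
      ...   | Tx , eq = subst (λ y → alive′ y ≡ true) (⁅⁆-true (ρ x) y eq) (live x (T-alive x Tx))

    odd-contract : ∀ U → Graft.odd contract U ≡ odd (U ∘ ρ)
    odd-contract U = begin
      ⨁ (λ y → U y ∧ ⨁ (λ x → T x ∧ ⁅ ρ x ⁆ y))      ≡⟨ ⨁-cong (λ y → ⨁-∧ (U y) (λ x → T x ∧ ⁅ ρ x ⁆ y)) ⟩
      ⨁ (λ y → ⨁ (λ x → U y ∧ (T x ∧ ⁅ ρ x ⁆ y)))    ≡⟨ ⨁-swap (λ y x → U y ∧ (T x ∧ ⁅ ρ x ⁆ y)) ⟩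
      ⨁ (λ x → ⨁ (λ y → U y ∧ (T x ∧ ⁅ ρ x ⁆ y)))    ≡⟨ ⨁-cong (λ x → ⨁-cong (λ y → shuffle (U y) (T x) (⁅ ρ x ⁆ y))) ⟩
      ⨁ (λ x → ⨁ (λ y → T x ∧ (⁅ ρ x ⁆ y ∧ U y)))    ≡⟨ ⨁-cong (λ x → ⨁-∧ (T x) (λ y → ⁅ ρ x ⁆ y ∧ U y)) ⟨
      ⨁ (λ x → T x ∧ ⨁ (λ y → ⁅ ρ x ⁆ y ∧ U y))      ≡⟨ ⨁-cong (λ x → cong (T x ∧_) (⨁-single (ρ x) U)) ⟩
      ⨁ (λ x → T x ∧ U (ρ x))                         ≡⟨ ⨁-cong (λ x → Boolₚ.∧-comm (T x) (U (ρ x))) ⟩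
      ⨁ (λ x → U (ρ x) ∧ T x)                         ∎
      where
      open ≡-Reasoning
      shuffle : ∀ a b c → a ∧ (b ∧ c) ≡ b ∧ (c ∧ a)
      shuffle a b c = trans (Boolₚ.∧-comm a (b ∧ c)) (Boolₚ.∧-assoc b c a)

    valid-contract : ∀ {p} → Weights.Valid G p → Weights.Valid contract p
    valid-contract v (Weights.edge e) _ = v (Weights.edge e) _
    valid-contract v Weights.total _ = v Weights.total _
    valid-contract v (Weights.cutset U) o = diff (Weights.valid-cut G v (lookup U ∘ ρ) (trans (sym (odd-contract (lookup U))) o))

    contract-fewer : ∀ {x} → alive x ≡ true → ρ x ≢ x → card (Graft.alive contract) ℕ.< card alive
    contract-fewer {x} a ne = card-< _ _ (λ y p → proj₁ (∧-split (alive y) p)) x (∧-false (⁅⁆-other ne)) a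
      where
      ∧-false : ∀ {a b} → b ≡ false → a ∧ b ≡ false
      ∧-false {a} refl = Boolₚ.∧-zeroʳ a

    join-contract : ∀ {J} → Graft.Join contract J → ∀ U → ⨁ (λ e → J e ∧ cut (U ∘ ρ) e) ≡ odd (U ∘ ρ)
    join-contract j U = trans (j U) (odd-contract U)

  open Weights G
  open Stars G

  -- `r₁` moves only vertices outside `U` and `r₂` only vertices inside, and neither changes the
  -- side of a vertex. So `U` still defines the same cut in both contractions.
  module Glue (U : Subsetᵇ n) (r₁ r₂ : Retraction)
              (fix₁ : ∀ x → U x ≡ true → Retraction.ρ r₁ x ≡ x) (stay₁ : ∀ x → U x ≡ false → U (Retraction.ρ r₁ x) ≡ false)
              (fix₂ : ∀ x → U x ≡ false → Retraction.ρ r₂ x ≡ x) (stay₂ : ∀ x → U x ≡ true → U (Retraction.ρ r₂ x) ≡ true) where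
    open Cut U

    private
      ρ₁ = Retraction.ρ r₁
      ρ₂ = Retraction.ρ r₂
      G₁ = contract r₁
      G₂ = contract r₂

    Once : Subsetᵇ m → Set
    Once J = ∃ λ d → cut U d ≡ true × (∀ e → J e ∧ cut U e ≡ ⁅ d ⁆ e)

    U-fixed₁ : ∀ x → U (ρ₁ x) ≡ U x
    U-fixed₁ x with U x in eq
    ... | true = trans (cong U (fix₁ x eq)) eq
    ... | false = stay₁ x eq

    U-fixed₂ : ∀ x → U (ρ₂ x) ≡ U x
    U-fixed₂ x with U x in eq
    ... | true = stay₂ x eq
    ... | false = trans (cong U (fix₂ x eq)) eq

    -- The part of `V` inside `U` is its own preimage under `ρ₁`, so its parity can be read off in
    -- the contraction.
    parity₁ : ∀ {J} → Graft.Join G₁ J → ∀ V → ⨁ (λ e → J e ∧ cut (λ x → V x ∧ U x) e) ≡ odd (λ x → V x ∧ U x)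
    parity₁ {J} j V = subst₂ _≡_ (⨁-cong λ e → cong (J e ∧_) (cut-cong {(λ x → V (ρ₁ x) ∧ U (ρ₁ x))} {(λ x → V x ∧ U x)} same e)) (odd-cong {(λ x → V (ρ₁ x) ∧ U (ρ₁ x))} {(λ x → V x ∧ U x)} same) (join-contract r₁ j (λ x → V x ∧ U x))
      where
      same : ∀ x → V (ρ₁ x) ∧ U (ρ₁ x) ≡ V x ∧ U x
      same x with U x in eq
      ... | true = cong₂ _∧_ (cong V (fix₁ x eq)) (trans (cong U (fix₁ x eq)) eq)
      ... | false = trans (trans (cong (V (ρ₁ x) ∧_) (stay₁ x eq)) (Boolₚ.∧-zeroʳ _)) (sym (Boolₚ.∧-zeroʳ _))

    parity₂ : ∀ {J} → Graft.Join G₂ J → ∀ V → ⨁ (λ e → J e ∧ cut (λ x → V x ∧ not (U x)) e) ≡ odd (λ x → V x ∧ not (U x))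
    parity₂ {J} j V = subst₂ _≡_ (⨁-cong λ e → cong (J e ∧_) (cut-cong {(λ x → V (ρ₂ x) ∧ not (U (ρ₂ x)))} {(λ x → V x ∧ not (U x))} same e)) (odd-cong {(λ x → V (ρ₂ x) ∧ not (U (ρ₂ x)))} {(λ x → V x ∧ not (U x))} same) (join-contract r₂ j (λ x → V x ∧ not (U x)))
      where
      same : ∀ x → V (ρ₂ x) ∧ not (U (ρ₂ x)) ≡ V x ∧ not (U x)
      same x with U x in eq
      ... | false = cong₂ _∧_ (cong V (fix₂ x eq)) (cong not (trans (cong U (fix₂ x eq)) eq))
      ... | true = trans (trans (cong (λ b → V (ρ₂ x) ∧ not b) (stay₂ x eq)) (Boolₚ.∧-zeroʳ _)) (sym (Boolₚ.∧-zeroʳ _))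

    -- Split `V` into its parts inside and outside `U`. Edges in the cut of the first part have an
    -- end in `U`, where the glued set is `J`. Edges in the cut of the second either avoid `U`,
    -- where it is `K`, or cross `U`, where both agree.
    glue-join : ∀ {J K} → Graft.Join G₁ J → Graft.Join G₂ K → (∀ e → cut U e ≡ true → J e ≡ K e) → Join (glue J K)
    glue-join {J} {K} j k agree V = begin
      ⨁ (λ e → H e ∧ cut V e)                                       ≡⟨ ⨁-cong (λ e → cong (H e ∧_) (cut-split e)) ⟩
      ⨁ (λ e → H e ∧ (cut V₁ e xor cut V₂ e))                       ≡⟨ ⨁-cong (λ e → Boolₚ.∧-distribˡ-xor (H e) _ _) ⟩
      ⨁ (λ e → (H e ∧ cut V₁ e) xor (H e ∧ cut V₂ e))               ≡⟨ ⨁-xor (λ e → H e ∧ cut V₁ e) (λ e → H e ∧ cut V₂ e) ⟩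
      ⨁ (λ e → H e ∧ cut V₁ e) xor ⨁ (λ e → H e ∧ cut V₂ e)         ≡⟨ cong₂ _xor_ (⨁-cong on₁) (⨁-cong on₂) ⟩
      ⨁ (λ e → J e ∧ cut V₁ e) xor ⨁ (λ e → K e ∧ cut V₂ e)         ≡⟨ cong₂ _xor_ (parity₁ j V) (parity₂ k V) ⟩
      odd V₁ xor odd V₂                                             ≡⟨ ⨁-xor (λ x → V₁ x ∧ T x) (λ x → V₂ x ∧ T x) ⟨
      ⨁ (λ x → (V₁ x ∧ T x) xor (V₂ x ∧ T x))                       ≡⟨ ⨁-cong (λ x → trans (sym (Boolₚ.∧-distribʳ-xor (T x) (V₁ x) (V₂ x))) (cong (_∧ T x) (sym (split (V x) (U x))))) ⟩
      odd V                                                         ∎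
      where
      open ≡-Reasoning
      H = glue J K
      V₁ V₂ : Subsetᵇ n
      V₁ x = V x ∧ U x
      V₂ x = V x ∧ not (U x)
      split : ∀ a b → a ≡ (a ∧ b) xor (a ∧ not b)
      split true true = refl
      split true false = refl
      split false _ = refl
      interchange : ∀ a b c d → (a xor b) xor (c xor d) ≡ (a xor c) xor (b xor d)
      interchange a b c d = solve 4 (λ a b c d → (a :+ b) :+ (c :+ d) := (a :+ c) :+ (b :+ d)) refl a b c d
        where open xor-∧-Solver
      cut-split : ∀ e → cut V e ≡ cut V₁ e xor cut V₂ e
      cut-split e = trans (cong₂ _xor_ (split (V (src e)) (U (src e))) (split (V (tgt e)) (U (tgt e))))
        (interchange (V₁ (src e)) (V₂ (src e)) (V₁ (tgt e)) (V₂ (tgt e)))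
      touches : ∀ a b c d → (a ∧ b) xor (c ∧ d) ≡ true → b ∨ d ≡ true
      touches a true c d _ = refl
      touches a false c true _ = refl
      touches true false true false ()
      touches true false false false ()
      touches false false true false ()
      touches false false false false ()
      masked : ∀ {L : Subsetᵇ m} {V} → (∀ e → cut V e ≡ true → H e ≡ L e) → ∀ e → H e ∧ cut V e ≡ L e ∧ cut V e
      masked {L} {V} p e with cut V e in eq
      ... | true = cong (_∧ true) (p e eq)
      ... | false = trans (Boolₚ.∧-zeroʳ _) (sym (Boolₚ.∧-zeroʳ _))
      on₁ : ∀ e → H e ∧ cut V₁ e ≡ J e ∧ cut V₁ e
      on₁ = masked {J} {V₁} λ e p → glue-inside J K (touches (V (src e)) (U (src e)) (V (tgt e)) (U (tgt e)) p)
      on₂ : ∀ e → H e ∧ cut V₂ e ≡ K e ∧ cut V₂ e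
      on₂ = masked {K} {V₂} λ e p → go e (touches (V (src e)) (not (U (src e))) (V (tgt e)) (not (U (tgt e))) p)
        where
        either : ∀ a b → not a ∨ not b ≡ true → a xor b ≡ true ⊎ a ∨ b ≡ false
        either true true ()
        either true false _ = inj₁ refl
        either false true _ = inj₁ refl
        either false false _ = inj₂ refl
        go : ∀ e → not (U (src e)) ∨ not (U (tgt e)) ≡ true → H e ≡ K e
        go e q with either (U (src e)) (U (tgt e)) q
        ... | inj₁ c = trans (glue-cut J K c) (agree e c)
        ... | inj₂ c = glue-outside J K c

    record Merged (Js Ks : List (Subsetᵇ m)) : Set where
      field
        Hs : List (Subsetᵇ m)
        hs : All Join Hs
        same-length : length Hs ≡ length Js
        inside : ∀ e → U (src e) ∨ U (tgt e) ≡ true → load Hs e ≡ load Js e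
        outside : ∀ e → U (src e) ∨ U (tgt e) ≡ false → load Hs e ≡ load Ks e

    -- The partner of `J` may be any member of the other list that uses the same edge of the cut.
    -- Equal loads guarantee that there is one, and they remain equal when both are removed.
    merge : ∀ Js Ks → All (Graft.Join G₁) Js → All Once Js → All (Graft.Join G₂) Ks → All Once Ks →
            (∀ e → cut U e ≡ true → load Js e ≡ load Ks e) → length Js ≡ length Ks → Merged Js Ks
    merge [] [] _ _ _ _ _ _ = record { Hs = [] ; hs = [] ; same-length = refl ; inside = λ _ _ → refl ; outside = λ _ _ → refl }
    merge (J ∷ Js) Ks (j ∷ js) ((d , d∈ , once) ∷ onces) ks onceKs eq len
      with load-positive⇒ Ks d (subst (0ℤ <_) (eq d d∈) (ℤₚ.<-≤-trans (subst (λ b → 0ℤ < ⟦ b ⟧) (sym Jd) (ℤ.+<+ (s≤s z≤n)))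
             (load-member {Js = J ∷ Js} (Data.List.Relation.Unary.Any.here refl) d)))
      where
      import Data.List.Relation.Unary.Any
      Jd : J d ≡ true
      Jd = proj₁ (∧-split (J d) (trans (once d) (⁅⁆-self d)))
    ... | K , K∈ , Kd with ∈-∃++ K∈
    ...   | As , Bs , refl with Allₚ.++⁻ʳ As ks | Allₚ.++⁻ʳ As onceKs
    ...     | k ∷ bs | (d′ , _ , once′) ∷ onceBs = record
      { Hs = glue J K ∷ Merged.Hs rest
      ; hs = glue-join {J} {K} j k agree ∷ Merged.hs rest
      ; same-length = cong suc (Merged.same-length rest)
      ; inside = λ e p → cong₂ _+_ (cong ⟦_⟧ (glue-inside J K p)) (Merged.inside rest e p)
      ; outside = λ e p → trans (cong₂ _+_ (cong ⟦_⟧ (glue-outside J K p)) (Merged.outside rest e p)) (sym (load-remove e))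
      }
      where
      d′≡d : d′ ≡ d
      d′≡d = ⁅⁆-true d′ d (trans (sym (once′ d)) (∧-join Kd d∈))
      agree : ∀ e → cut U e ≡ true → J e ≡ K e
      agree e c = begin
        J e                ≡⟨ Boolₚ.∧-identityʳ _ ⟨
        J e ∧ true         ≡⟨ cong (J e ∧_) c ⟨
        J e ∧ cut U e      ≡⟨ once e ⟩
        ⁅ d ⁆ e            ≡⟨ cong (λ x → ⁅ x ⁆ e) d′≡d ⟨
        ⁅ d′ ⁆ e           ≡⟨ once′ e ⟨
        K e ∧ cut U e      ≡⟨ cong (K e ∧_) c ⟩
        K e ∧ true         ≡⟨ Boolₚ.∧-identityʳ _ ⟩
        K e                ∎
        where open ≡-Reasoning
      load-remove : ∀ e → load (As ++ K ∷ Bs) e ≡ ⟦ K e ⟧ + load (As ++ Bs) e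
      load-remove e = trans (load-++ As (K ∷ Bs) e) (trans (lem (load As e) ⟦ K e ⟧ (load Bs e)) (cong (ℤ._+_ ⟦ K e ⟧) (sym (load-++ As Bs e))))
        where
        lem : ∀ a k b → a + (k + b) ≡ k + (a + b)
        lem = solve-∀
      eq′ : ∀ e → cut U e ≡ true → load Js e ≡ load (As ++ Bs) e
      eq′ e c = +-cancelˡ ⟦ J e ⟧ _ _ (trans (eq e c) (trans (load-remove e) (cong (λ b → ⟦ b ⟧ + load (As ++ Bs) e) (sym (agree e c)))))
      len′ : length Js ≡ length (As ++ Bs)
      len′ = ℕₚ.suc-injective (trans len (trans (Listₚ.length-++ As) (trans (ℕₚ.+-suc (length As) (length Bs)) (cong suc (sym (Listₚ.length-++ As))))))
      rest = merge Js (As ++ Bs) js onces (Allₚ.++⁺ (Allₚ.++⁻ˡ As ks) bs) (Allₚ.++⁺ (Allₚ.++⁻ˡ As onceKs) onceBs) eq′ len′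

    -- Along a tight cut both packings use the same edges, so their joins can be matched up.
    glue-good : ∀ {p} → odd U ≡ true → weight (wt p) U ≡ tot p → Weights.Good G₁ p → Weights.Good G₂ p → Good p
    glue-good {p} o tightU g₁ g₂ = record
      { exponent = k
      ; joins = Merged.Hs M
      ; areJoins = Merged.hs M
      ; count = trans (cong +_ (Merged.same-length M)) (Weights.Good.count h₁)
      ; packed = λ e → pck e (U (src e) ∨ U (tgt e)) refl
      }
      where
      raised₁ = Weights.good-raise G₁ g₁ (Weights.Good.exponent g₂)
      raised₂ = Weights.good-raise G₂ g₂ (Weights.Good.exponent g₁)
      h₁ = proj₁ raised₁
      h₂ = proj₁ raised₂
      k = Weights.Good.exponent h₁
      k≡ : Weights.Good.exponent h₂ ≡ k
      k≡ = trans (proj₂ raised₂) (trans (ℕₚ.+-comm (Weights.Good.exponent g₁) _) (sym (proj₂ raised₁)))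
      Js = Weights.Good.joins h₁
      Ks = Weights.Good.joins h₂
      module _ (r : Retraction) (fixed : ∀ x → U (Retraction.ρ r x) ≡ U x) where
        private
          C = contract r
          U′ = tabulate U
          same : ∀ x → lookup U′ (Retraction.ρ r x) ≡ U x
          same x = trans (lookup∘tabulate U _) (fixed x)
          oddC : ∀ {V} → (∀ x → V (Retraction.ρ r x) ≡ U x) → Graft.odd C V ≡ true
          oddC {V} eq = trans (odd-contract r V) (trans (odd-cong {V ∘ Retraction.ρ r} {U} eq) o)
          V₀ = lookup U′ ∘ Retraction.ρ r
        once-in : (h : Weights.Good C p) → ∀ {J} → J ∈ Weights.Good.joins h → Once J
        once-in h {J} J∈ = d , proj₂ (∧-split (J d) (trans (eq d) (⁅⁆-self d))) , eq
          where
          tight : Weights.val C (Weights.cutset U′) (χ J) ≡ 0ℤ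
          tight = Weights.good-tight C h {Weights.cutset U′} (oddC {lookup U′} same) (trans (cong (_- tot p) (weight-cong (wt p) {V₀} {U} same)) (trans (cong (_- tot p) tightU) (ℤₚ.i≡j⇒i-j≡0 {tot p} refl))) J∈
          times : ∀ a b → ⟦ a ∧ b ⟧ ≡ ⟦ b ⟧ * ⟦ a ⟧
          times true true = refl
          times true false = refl
          times false true = refl
          times false false = refl
          one : ∑ (λ e → ⟦ J e ∧ cut U e ⟧) ≡ 1ℤ
          one = trans (∑-cong λ e → times (J e) (cut U e)) (trans (sym (weight-cong (wt (χ J)) {V₀} {U} same)) (ℤₚ.i-j≡0⇒i≡j (weight (wt (χ J)) V₀) 1ℤ tight))
          found = ∑-one⇒ (λ e → J e ∧ cut U e) one
          d = proj₁ found
          eq = proj₂ found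
        full : (h : Weights.Good C p) → ∀ e → cut U e ≡ true → load (Weights.Good.joins h) e ≡ 2^ (Weights.Good.exponent h) * wt p e
        full h e c = Weights.good-saturated C h U (oddC {U} fixed) (trans (weight-cong (wt p) {U ∘ Retraction.ρ r} {U} fixed) tightU) e
          (trans (cut-cong {U ∘ Retraction.ρ r} {U} fixed e) c)
      M : Merged Js Ks
      M = merge Js Ks (Weights.Good.areJoins h₁) (All.tabulate (λ {J} → once-in r₁ U-fixed₁ h₁ {J}))
            (Weights.Good.areJoins h₂) (All.tabulate (λ {J} → once-in r₂ U-fixed₂ h₂ {J}))
            (λ e c → trans (full r₁ U-fixed₁ h₁ e c) (sym (trans (full r₂ U-fixed₂ h₂ e c) (cong (λ k → 2^ k * wt p e) k≡))))
            (ℤₚ.+-injective (trans (Weights.Good.count h₁) (sym (trans (Weights.Good.count h₂) (cong (λ k → 2^ k * tot p) k≡)))))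
      pck : ∀ e b → U (src e) ∨ U (tgt e) ≡ b → load (Merged.Hs M) e ≤ 2^ k * wt p e
      pck e true eq = subst (_≤ 2^ k * wt p e) (sym (Merged.inside M e eq)) (Weights.Good.packed h₁ e)
      pck e false eq = subst₂ _≤_ (sym (Merged.outside M e eq)) (cong (λ k → 2^ k * wt p e) k≡) (Weights.Good.packed h₂ e)

-- Boundary points

0<⇒≢0 : ∀ {a} → 0ℤ < a → a ≢ 0ℤ
0<⇒≢0 p refl = ℤₚ.<-irrefl refl p

≢0⇒0< : ∀ {a} → 0ℤ ≤ a → a ≢ 0ℤ → 0ℤ < a
≢0⇒0< p q = ℤₚ.≤∧≢⇒< p (q ∘ sym)

0<-* : ∀ {a b} → 0ℤ < a → 0ℤ < b → 0ℤ < a * b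
0<-* {+ suc a} {+ suc b} _ _ = ℤ.+<+ (s≤s z≤n)
0<-* {+ zero} (ℤ.+<+ ()) _
0<-* {+ suc a} {+ zero} _ (ℤ.+<+ ())

*-cancel-0≤ : ∀ {a b} → 0ℤ < a → 0ℤ ≤ a * b → 0ℤ ≤ b
*-cancel-0≤ {+ suc a} {b} _ p = ℤₚ.*-cancelˡ-≤-pos 0ℤ b (+ suc a) (subst (_≤ + suc a * b) (sym (ℤₚ.*-zeroʳ (+ suc a))) p)
*-cancel-0≤ {+ zero} (ℤ.+<+ ()) _

0<⇒1≤ : ∀ {a} → 0ℤ < a → 1ℤ ≤ a
0<⇒1≤ {+ suc a} _ = +≤+ (s≤s z≤n)
0<⇒1≤ {+ zero} (ℤ.+<+ ())

-- The ratio test: `i` minimises the quotient of `f` by `g` among the indices with positive `g`. In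
-- cross-multiplied form the comparison with an index where `g` is not positive holds by itself for
-- nonnegative `f`.
Minimal : ∀ {A : Set} (f g : A → ℤ) (L : List A) → A → Set
Minimal f g L i = 0ℤ < g i × (∀ {j} → j ∈ L → f i * g j ≤ f j * g i)

minimal-or-none : ∀ {A : Set} (f g : A → ℤ) (L : List A) → (∀ {i} → i ∈ L → 0ℤ ≤ f i) →
                  (∀ {i} → i ∈ L → g i ≤ 0ℤ) ⊎ (∃ λ i → i ∈ L × Minimal f g L i)
minimal-or-none f g [] nn = inj₁ λ ()
minimal-or-none f g (h ∷ L) nn = go (minimal-or-none f g L (nn ∘ there)) (0ℤ ℤ.<? g h)
  where
  fh = nn (here refl)
  ≤-neg : ∀ {i j} → 0ℤ ≤ f i → 0ℤ ≤ f j → 0ℤ < g i → g j ≤ 0ℤ → f i * g j ≤ f j * g i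
  ≤-neg {i} {j} fi fj gi gj = ≤-via (f j * g i + f i * (0ℤ - g j)) (0≤+ (0≤* fj (ℤₚ.<⇒≤ gi)) (0≤* fi (diff gj))) (lem (f i) (f j) (g i) (g j))
    where
    lem : ∀ fi fj gi gj → fj * gi + fi * (0ℤ - gj) ≡ fj * gi - fi * gj
    lem = solve-∀
  go : (∀ {i} → i ∈ L → g i ≤ 0ℤ) ⊎ (∃ λ i → i ∈ L × Minimal f g L i) → Dec (0ℤ < g h) →
       (∀ {i} → i ∈ h ∷ L → g i ≤ 0ℤ) ⊎ (∃ λ i → i ∈ h ∷ L × Minimal f g (h ∷ L) i)
  go (inj₁ none) (no q) = inj₁ λ { (here refl) → ℤₚ.≮⇒≥ q ; (there p) → none p }
  go (inj₁ none) (yes q) = inj₂ (h , here refl , q , λ { (here refl) → ℤₚ.≤-refl ; (there p) → ≤-neg fh (nn (there p)) q (none p) })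
  go (inj₂ (i , i∈ , gi , min)) (no q) = inj₂ (i , there i∈ , gi , λ { (here refl) → ≤-neg (nn (there i∈)) fh gi (ℤₚ.≮⇒≥ q) ; (there p) → min p })
  go (inj₂ (i , i∈ , gi , min)) (yes q) = pick (f i * g h ℤ.≤? f h * g i)
    where
    pick : Dec (f i * g h ≤ f h * g i) → (∀ {i} → i ∈ h ∷ L → g i ≤ 0ℤ) ⊎ (∃ λ i → i ∈ h ∷ L × Minimal f g (h ∷ L) i)
    pick (yes le) = inj₂ (i , there i∈ , gi , λ { (here refl) → le ; (there p) → min p })
    pick (no gt) = inj₂ (h , here refl , q , λ { (here refl) → ℤₚ.≤-refl ; (there p) → best p })
      where
      h≤i : f h * g i ≤ f i * g h
      h≤i = ℤₚ.<⇒≤ (ℤₚ.≰⇒> gt)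
      best : ∀ {j} → j ∈ L → f h * g j ≤ f j * g h
      best {j} j∈ = sign (0ℤ ℤ.≤? g j)
        where
        sign : Dec (0ℤ ≤ g j) → f h * g j ≤ f j * g h
        sign (no neg) = ≤-neg fh (nn (there j∈)) q (ℤₚ.<⇒≤ (ℤₚ.≰⇒> neg))
        -- The quotient at `h` is at most that at `i`, which is at most that at `j`. Multiplying by
        -- `g i` expresses this chain without division.
        sign (yes pos) = ℤₚ.0≤i-j⇒j≤i (*-cancel-0≤ gi (subst (0ℤ ≤_) (lem (f h) (f i) (f j) (g h) (g i) (g j))
          (0≤+ (0≤* (ℤₚ.<⇒≤ q) (diff (min j∈))) (0≤* pos (diff h≤i)))))
          where
          lem : ∀ fh fi fj gh gi gj → gh * (fj * gi - fi * gj) + gj * (fi * gh - fh * gi) ≡ gi * (fj * gh - fh * gj)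
          lem = solve-∀

count-≤ : ∀ {A : Set} {P Q : A → Set} (P? : Decidable P) (Q? : Decidable Q) (L : List A) →
          (∀ {i} → i ∈ L → P i → Q i) → length (filter P? L) ℕ.≤ length (filter Q? L)
count-≤ P? Q? [] sub = z≤n
count-≤ P? Q? (h ∷ L) sub with P? h | Q? h
... | yes p | yes q = s≤s (count-≤ P? Q? L (sub ∘ there))
... | yes p | no q = contradiction (sub (here refl) p) q
... | no p | yes q = ℕₚ.m≤n⇒m≤1+n (count-≤ P? Q? L (sub ∘ there))
... | no p | no q = count-≤ P? Q? L (sub ∘ there)

count-< : ∀ {A : Set} {P Q : A → Set} (P? : Decidable P) (Q? : Decidable Q) (L : List A) →
          (∀ {i} → i ∈ L → P i → Q i) → ∀ {i} → i ∈ L → Q i → ¬ P i → length (filter P? L) ℕ.< length (filter Q? L)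
count-< P? Q? (h ∷ L) sub (here refl) qi ¬pi with P? h | Q? h
... | yes p | _ = contradiction p ¬pi
... | no p | yes q = s≤s (count-≤ P? Q? L (sub ∘ there))
... | no p | no q = contradiction qi q
count-< P? Q? (h ∷ L) sub (there i∈) qi ¬pi with P? h | Q? h
... | yes p | yes q = s≤s (count-< P? Q? L (sub ∘ there) i∈ qi ¬pi)
... | yes p | no q = contradiction (sub (here refl) p) q
... | no p | yes q = ℕₚ.m≤n⇒m≤1+n (count-< P? Q? L (sub ∘ there) i∈ qi ¬pi)
... | no p | no q = count-< P? Q? L (sub ∘ there) i∈ qi ¬pi

∈-allSubsets : ∀ {n} (S : Subset n) → S ∈ allSubsets n
∈-allSubsets [] = here refl
∈-allSubsets (true ∷ S) = ∈-++⁺ˡ (∈-map⁺ (true ∷_) (∈-allSubsets S))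
∈-allSubsets {suc n} (false ∷ S) = ∈-++⁺ʳ (map (true ∷_) (allSubsets n)) (∈-map⁺ (false ∷_) (∈-allSubsets S))

-- The list of inequalities and rays to the boundary

module Constraints {m n} (G : Graft m n) where
  open Graft G
  open Weights G

  odd? : Decidable (λ (U : Subset n) → odd (lookup U) ≡ true)
  odd? U = odd (lookup U) Bool.≟ true

  cons : List Con
  cons = total ∷ map edge (allFin m) ++ map cutset (filter odd? (allSubsets n))

  ∈-cons : ∀ i → Admissible i → i ∈ cons
  ∈-cons (edge e) _ = there (∈-++⁺ˡ (∈-map⁺ edge (∈-allFin e)))
  ∈-cons total _ = here refl
  ∈-cons (cutset U) o = there (∈-++⁺ʳ (map edge (allFin m)) (∈-map⁺ cutset (∈-filter⁺ odd? (∈-allSubsets U) o)))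

  cons-admissible : ∀ {i} → i ∈ cons → Admissible i
  cons-admissible (here refl) = tt
  cons-admissible {i} (there i∈) = go (∈-++⁻ (map edge (allFin m)) i∈)
    where
    go : i ∈ map edge (allFin m) ⊎ i ∈ map cutset (filter odd? (allSubsets n)) → Admissible i
    go (inj₁ p) with ∈-map⁻ edge p
    ... | e , _ , refl = tt
    go (inj₂ p) with ∈-map⁻ cutset p
    ... | U , q , refl = proj₂ (∈-filter⁻ odd? {xs = allSubsets n} q)

  Min : Point m → Point m → Con → Set
  Min x v = Minimal (λ i → val i x) (λ i → val i v) cons

  min? : ∀ x v i → Dec (Min x v i)
  min? x v i = go (0ℤ ℤ.<? val i v) (All.all? (λ j → val i x * val j v ℤ.≤? val j x * val i v) cons)
    where
    go : Dec (0ℤ < val i v) → Dec (All (λ j → val i x * val j v ≤ val j x * val i v) cons) → Dec (Min x v i)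
    go (no p) _ = no λ q → p (proj₁ q)
    go (yes p) (no q) = no λ r → q (All.tabulate (λ j∈ → proj₂ r j∈))
    go (yes p) (yes q) = yes (p , λ j∈ → All.lookup q j∈)

  -- Up to the factor `val i v`, which keeps it integral, this is the point where the ray from `x`
  -- in direction `-v` meets the inequality `i`.
  ray : Con → Point m → Point m → Point m
  ray i x v = val i v ∙ x ⊖ val i x ∙ v

  ray-valid : ∀ {x v i} → Min x v i → Valid (ray i x v)
  ray-valid {x} {v} {i} (_ , min) j ad = subst (0ℤ ≤_) (trans (lem (val i v) (val j x) (val i x) (val j v)) (sym (val-linear j (val i v) x (val i x) v)))
      (diff (min (∈-cons j ad)))
    where
    lem : ∀ b f a g → f * b - a * g ≡ b * f - a * g
    lem = solve-∀

  ray-zero : ∀ x v i → val i (ray i x v) ≡ 0ℤ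
  ray-zero x v i = trans (val-linear i (val i v) x (val i x) v) (lem (val i v) (val i x))
    where
    lem : ∀ b a → b * a - a * b ≡ 0ℤ
    lem = solve-∀

  minimizer : ∀ {x v} → Valid x → ∀ i → Admissible i → 0ℤ < val i v → ∃ λ j → j ∈ cons × Min x v j
  minimizer {x} {v} vx i ad pos = go (minimal-or-none (λ i → val i x) (λ i → val i v) cons (λ {j} j∈ → vx j (cons-admissible j∈)))
    where
    go : (∀ {j} → j ∈ cons → val j v ≤ 0ℤ) ⊎ (∃ λ j → j ∈ cons × Min x v j) → ∃ λ j → j ∈ cons × Min x v j
    go (inj₁ none) = contradiction (none (∈-cons i ad)) (ℤₚ.<⇒≱ pos)
    go (inj₂ r) = r

  good-trivial : ∀ {x} → Valid x → tot x ≡ 0ℤ → Good x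
  good-trivial vx eq = good 0 [] [] (sym (trans (ℤₚ.*-identityˡ _) eq)) λ e → subst (0ℤ ≤_) (sym (ℤₚ.*-identityˡ _)) (vx (edge e) tt)

-- Tight stars, trivial cuts and the measure of the induction

module Measure {m n} (G : Graft m n) where
  open Graft G
  open Weights G
  open Stars G
  open Constraints G

  supp : Point m → Subsetᵇ m
  supp x e = not (does (wt x e ℤ.≟ 0ℤ))

  -- Membership in `T` is included because only then is the star an odd cut.
  tight : Point m → Subsetᵇ n
  tight x v = T v ∧ does (weight (wt x) ⁅ v ⁆ ℤ.≟ tot x)

  μ : Point m → ℕ
  μ x = card (supp x) ℕ.+ card (not ∘ tight x)

  does-true : ∀ {P : Set} (d : Dec P) → does d ≡ true → P
  does-true (yes p) _ = p

  does-false : ∀ {P : Set} (d : Dec P) → does d ≡ false → ¬ P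
  does-false (no p) _ = p

  not-supp : ∀ {x e} → supp x e ≡ false → wt x e ≡ 0ℤ
  not-supp {x} {e} p = does-true (wt x e ℤ.≟ 0ℤ) (not-false p)
    where
    not-false : ∀ {b} → not b ≡ false → b ≡ true
    not-false {true} _ = refl

  zero-not-supp : ∀ {x e} → wt x e ≡ 0ℤ → supp x e ≡ false
  zero-not-supp {x} {e} p = cong not (dec-true (wt x e ℤ.≟ 0ℤ) p)

  in-supp : ∀ {x e} → supp x e ≡ true → wt x e ≢ 0ℤ
  in-supp {x} {e} p = does-false (wt x e ℤ.≟ 0ℤ) (not-true p)
    where
    not-true : ∀ {b} → not b ≡ true → b ≡ false
    not-true {false} _ = refl

  nonzero-supp : ∀ {x e} → wt x e ≢ 0ℤ → supp x e ≡ true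
  nonzero-supp {x} {e} p = cong not (dec-false (wt x e ℤ.≟ 0ℤ) p)

  tight-T : ∀ {x v} → tight x v ≡ true → T v ≡ true
  tight-T {x} {v} p = proj₁ (∧-split (T v) p)

  tight-weight : ∀ {x v} → tight x v ≡ true → weight (wt x) ⁅ v ⁆ ≡ tot x
  tight-weight {x} {v} p = does-true (weight (wt x) ⁅ v ⁆ ℤ.≟ tot x) (proj₂ (∧-split (T v) p))

  tight-intro : ∀ {x v} → T v ≡ true → weight (wt x) ⁅ v ⁆ ≡ tot x → tight x v ≡ true
  tight-intro {x} {v} p q = ∧-join p (dec-true (weight (wt x) ⁅ v ⁆ ℤ.≟ tot x) q)

  starCon : Fin n → Con
  starCon v = cutset (tabulate ⁅ v ⁆)

  starCon-admissible : ∀ {v} → T v ≡ true → Admissible (starCon v)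
  starCon-admissible {v} p = trans (odd-cong (lookup∘tabulate ⁅ v ⁆)) (trans (odd-star v) p)

  starCon-val : ∀ v x → val (starCon v) x ≡ weight (wt x) ⁅ v ⁆ - tot x
  starCon-val v x = cong (_- tot x) (weight-cong (wt x) (lookup∘tabulate ⁅ v ⁆))

  tight-val : ∀ {x v} → tight x v ≡ true → val (starCon v) x ≡ 0ℤ
  tight-val {x} {v} p = trans (starCon-val v x) (ℤₚ.i≡j⇒i-j≡0 (tight-weight p))

  val-tight : ∀ {x v} → T v ≡ true → val (starCon v) x ≡ 0ℤ → tight x v ≡ true
  val-tight {x} {v} p q = tight-intro p (ℤₚ.i-j≡0⇒i≡j _ (tot x) (trans (sym (starCon-val v x)) q))

  record Nontrivial (U : Subsetᵇ n) : Set where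
    constructor nontrivial
    field
      {x y z w} : Fin n
      alive-x : alive x ≡ true
      alive-y : alive y ≡ true
      alive-z : alive z ≡ true
      alive-w : alive w ≡ true
      x≢y : x ≢ y
      z≢w : z ≢ w
      x∈ : U x ≡ true
      y∈ : U y ≡ true
      z∉ : U z ≡ false
      w∉ : U w ≡ false

  two? : ∀ (U : Subsetᵇ n) b → Dec (∃ λ x → ∃ λ y → (alive x ≡ true × alive y ≡ true) × (x ≢ y × (U x ≡ b × U y ≡ b)))
  two? U b = Finₚ.any? λ x → Finₚ.any? λ y →
    ((alive x Bool.≟ true) ×-dec (alive y Bool.≟ true)) ×-dec (¬? (x Fin.≟ y) ×-dec ((U x Bool.≟ b) ×-dec (U y Bool.≟ b)))

  nontrivial? : ∀ U → Dec (Nontrivial U)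
  nontrivial? U = go (two? U true) (two? U false)
    where
    go : Dec (∃ λ x → ∃ λ y → (alive x ≡ true × alive y ≡ true) × (x ≢ y × (U x ≡ true × U y ≡ true))) →
         Dec (∃ λ x → ∃ λ y → (alive x ≡ true × alive y ≡ true) × (x ≢ y × (U x ≡ false × U y ≡ false))) → Dec (Nontrivial U)
    go (yes (x , y , (ax , ay) , ne , ux , uy)) (yes (z , w , (az , aw) , ne′ , uz , uw)) =
      yes (nontrivial ax ay az aw ne ne′ ux uy uz uw)
    go (no p) _ = no λ { (nontrivial ax ay az aw ne ne′ ux uy uz uw) → p (_ , _ , (ax , ay) , ne , ux , uy) }
    go (yes _) (no p) = no λ { (nontrivial ax ay az aw ne ne′ ux uy uz uw) → p (_ , _ , (az , aw) , ne′ , uz , uw) }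

  -- The cut of the set of all vertices has no edges. If it were odd, `tot x` would be at most 0.
  total-even : ∀ {x} → Valid x → 0ℤ < tot x → odd (λ _ → true) ≡ false
  total-even {x} vx pos = go (odd (λ _ → true)) refl
    where
    go : ∀ b → odd (λ _ → true) ≡ b → b ≡ false
    go false _ = refl
    go true o = contradiction (subst (tot x ≤_) empty (valid-cut vx (λ _ → true) o)) (ℤₚ.<⇒≱ pos)
      where
      empty : weight (wt x) (λ _ → true) ≡ 0ℤ
      empty = ∑-0 m

  -- Both sides contain an odd number of elements of `T`, so a side with fewer than two living
  -- vertices has exactly one, and it lies in `T`.
  trivial-cut : odd (λ _ → true) ≡ false → ∀ U → odd U ≡ true → ¬ Nontrivial U →
                ∃ λ v → T v ≡ true × (∀ e → cut U e ≡ star v e)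
  trivial-cut even U o triv = go (two? U true) (two? U false)
    where
    member : ∃ λ v → U v ∧ T v ≡ true
    member = ⨁-true⇒ _ o
    odd-complement : odd (not ∘ U) ≡ true
    odd-complement = trans (sym (Boolₚ.not-involutive _)) (cong not (trans (sym flip) even))
      where
      flip : odd (λ _ → true) ≡ not (odd (not ∘ U))
      flip = trans (⨁-cong λ x → trans (split (U x) (T x)) refl) (trans (⨁-xor (λ x → U x ∧ T x) (λ x → not (U x) ∧ T x)) (cong (_xor odd (not ∘ U)) o))
        where
        split : ∀ a b → true ∧ b ≡ (a ∧ b) xor (not a ∧ b)
        split true b = sym (Boolₚ.xor-identityʳ b)
        split false b = refl
    comember : ∃ λ v → not (U v) ∧ T v ≡ true
    comember = ⨁-true⇒ _ odd-complement
    single : ∀ (V : Subsetᵇ n) v → V v ∧ T v ≡ true →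
             ¬ (∃ λ x → ∃ λ y → (alive x ≡ true × alive y ≡ true) × (x ≢ y × (V x ≡ true × V y ≡ true))) →
             ∀ x → alive x ≡ true → V x ≡ ⁅ v ⁆ x
    single V v vT lone x ax = settle (toSum (v Fin.≟ x)) (V x) refl
      where
      Vv = proj₁ (∧-split (V v) vT)
      settle : v ≡ x ⊎ v ≢ x → ∀ b → V x ≡ b → V x ≡ ⁅ v ⁆ x
      settle (inj₁ refl) b eq = trans Vv (sym (⁅⁆-self v))
      settle (inj₂ ne) true eq = contradiction (v , x , (T-alive v (proj₂ (∧-split (V v) vT)) , ax) , ne , Vv , eq) lone
      settle (inj₂ ne) false eq = trans eq (sym (⁅⁆-other ne))
    not-true : ∀ {b} → not b ≡ true → b ≡ false
    not-true {false} _ = refl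
    go : Dec (∃ λ x → ∃ λ y → (alive x ≡ true × alive y ≡ true) × (x ≢ y × (U x ≡ true × U y ≡ true))) →
         Dec (∃ λ x → ∃ λ y → (alive x ≡ true × alive y ≡ true) × (x ≢ y × (U x ≡ false × U y ≡ false))) →
         ∃ λ v → T v ≡ true × (∀ e → cut U e ≡ star v e)
    go (no lone) _ = v , proj₂ (∧-split (U v) vT) , λ e → cong₂ _xor_ (at (src e) (src-alive e)) (at (tgt e) (tgt-alive e))
      where
      v = proj₁ member
      vT = proj₂ member
      at = single U v vT lone
    go (yes _) (no lone) = v , proj₂ (∧-split (not (U v)) vT) , λ e → trans (sym (Boolₚ.xor-annihilates-not (U (src e)) (U (tgt e))))
        (cong₂ _xor_ (at (src e) (src-alive e)) (at (tgt e) (tgt-alive e)))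
      where
      v = proj₁ comember
      vT = proj₂ comember
      at = single (not ∘ U) v vT λ { (x , y , a , ne , p , q) → lone (x , y , a , ne , not-true p , not-true q) }
    go (yes (x , y , (ax , ay) , ne , ux , uy)) (yes (z , w , (az , aw) , ne′ , uz , uw)) =
      contradiction (nontrivial ax ay az aw ne ne′ ux uy uz uw) triv

  collapse : ∀ (U : Subsetᵇ n) z → alive z ≡ true → U z ≡ false → Retraction G
  collapse U z az z∉ = record
    { ρ = λ x → Bool.if U x then x else z
    ; idem = λ x → go₁ x (U x) refl
    ; preserves = λ x a → go₂ x a (U x)
    }
    where
    go₁ : ∀ x b → U x ≡ b → (Bool.if U (Bool.if b then x else z) then (Bool.if b then x else z) else z) ≡ (Bool.if U x then x else z)
    go₁ x true eq = refl
    go₁ x false eq rewrite eq | z∉ = refl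
    go₂ : ∀ x → alive x ≡ true → ∀ b → alive (Bool.if b then x else z) ≡ true
    go₂ x a true = a
    go₂ x a false = az

  module _ (IH : ∀ (H : Graft m n) → card (Graft.alive H) ℕ.< card alive → ∀ {x} → Weights.Valid H x → Weights.Good H x) where

    -- Each side in turn is contracted to one of its vertices, and the second living vertex on that
    -- side makes the contraction smaller.
    nontrivial-good : ∀ {x} → Valid x → ∀ U → odd U ≡ true → weight (wt x) U ≡ tot x → Nontrivial U → Good x
    nontrivial-good {p} vp U o eq (nontrivial {x} {y} {z} {w} ax ay az aw x≢y z≢w x∈ y∈ z∉ w∉) =
      Glue.glue-good G U r₁ r₂ (λ v u → if-true u) (λ v u → trans (cong U (if-false u)) z∉)
        (λ v u → if-true (cong not u)) (λ v u → trans (cong U (if-false (cong not u))) x∈) o eq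
        (IH (contract G r₁) (contract-fewer G r₁ aw (λ q → z≢w (trans (sym (if-false w∉)) q))) (valid-contract G r₁ vp))
        (IH (contract G r₂) (contract-fewer G r₂ ay (λ q → x≢y (trans (sym (if-false (cong not y∈))) q))) (valid-contract G r₂ vp))
      where
      r₁ = collapse U z az z∉
      r₂ = collapse (not ∘ U) x ax (cong not x∈)
      if-true : ∀ {b} {u v : Fin n} → b ≡ true → (Bool.if b then u else v) ≡ u
      if-true refl = refl
      if-false : ∀ {b} {u v : Fin n} → b ≡ false → (Bool.if b then u else v) ≡ v
      if-false refl = refl

-- The induction step

⟦⟧-0 : ∀ {b} → ⟦ b ⟧ ≡ 0ℤ → b ≡ false
⟦⟧-0 {false} _ = refl

⟦⟧-≤1 : ∀ b → ⟦ b ⟧ ≤ 1ℤ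
⟦⟧-≤1 true = ℤₚ.≤-refl
⟦⟧-≤1 false = +≤+ z≤n

⟦⟧-* : ∀ a b → ⟦ b ⟧ * ⟦ a ⟧ ≡ ⟦ a ∧ b ⟧
⟦⟧-* true true = refl
⟦⟧-* true false = refl
⟦⟧-* false true = refl
⟦⟧-* false false = refl

∑-remove : ∀ {k} (R : Fin k → Bool) {d} → R d ≡ true → ∑ (λ e → ⟦ R e ⟧) ≡ ∑ (λ e → ⟦ (R △ ⁅ d ⁆) e ⟧) + 1ℤ
∑-remove R {d} Rd = trans (∑-cong λ e → cong ⟦_⟧ (sym (back e))) (∑-△ (R △ ⁅ d ⁆) d (cong₂ _xor_ Rd (⁅⁆-self d)))
  where
  back : ∀ e → (R △ ⁅ d ⁆ △ ⁅ d ⁆) e ≡ R e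
  back e = trans (Boolₚ.xor-assoc (R e) (⁅ d ⁆ e) (⁅ d ⁆ e)) (trans (cong (R e xor_) (Boolₚ.xor-same (⁅ d ⁆ e))) (Boolₚ.xor-identityʳ (R e)))

∑-inhabited : ∀ {k} (R : Fin k → Bool) → 0ℤ < ∑ (λ e → ⟦ R e ⟧) → ∃ λ d → R d ≡ true
∑-inhabited R pos = d , pos⇒ (R d) (proj₂ found)
  where
  found = ∑-positive⇒ (λ e → ⟦ R e ⟧) pos
  d = proj₁ found
  pos⇒ : ∀ b → 0ℤ < ⟦ b ⟧ → b ≡ true
  pos⇒ true _ = refl
  pos⇒ false (ℤ.+<+ ())

△-member : ∀ {k} {R : Fin k → Bool} {d e} → R d ≡ true → (R △ ⁅ d ⁆) e ≡ true → e ≢ d × R e ≡ true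
△-member {R = R} {d} {e} Rd p = ne , trans (sym (Boolₚ.xor-identityʳ (R e))) (trans (cong (R e xor_) (sym (⁅⁆-other (ne ∘ sym)))) p)
  where
  ne : e ≢ d
  ne refl = contradiction (trans (sym p) (cong₂ _xor_ Rd (⁅⁆-self d))) λ ()

three-members : ∀ {k} (R : Fin k → Bool) → + 3 ≤ ∑ (λ e → ⟦ R e ⟧) →
  ∃ λ a → ∃ λ b → ∃ λ c → (a ≢ b × a ≢ c × b ≢ c) × (R a ≡ true × R b ≡ true × R c ≡ true)
three-members R le = a , b , c , (b≢a ∘ sym , c≢a ∘ sym , c≢b ∘ sym) , (Ra , Rb , Rc)
  where
  drop-one : ∀ {x y} k → + suc k ≤ x → x ≡ y + 1ℤ → + k ≤ y
  drop-one {x} {y} k le refl = ≤-via (y + 1ℤ - + suc k) (diff le) (trans (cong (λ z → y + 1ℤ - z) (ℤₚ.pos-+ 1 k)) (lem y (+ k)))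
    where
    lem : ∀ y k → y + 1ℤ - (1ℤ + k) ≡ y - k
    lem = solve-∀
  pos : ∀ {x} k → + suc k ≤ x → 0ℤ < x
  pos k le = ℤₚ.<-≤-trans (ℤ.+<+ (s≤s z≤n)) le
  A = ∑-inhabited R (pos 2 le)
  a = proj₁ A
  Ra = proj₂ A
  R₁ = R △ ⁅ a ⁆
  le₁ = drop-one 2 le (∑-remove R Ra)
  B = ∑-inhabited R₁ (pos 1 le₁)
  b = proj₁ B
  R₁b = proj₂ B
  b≢a = proj₁ (△-member {R = R} Ra R₁b)
  Rb = proj₂ (△-member {R = R} Ra R₁b)
  R₂ = R₁ △ ⁅ b ⁆
  le₂ = drop-one 1 le₁ (∑-remove R₁ R₁b)
  C = ∑-inhabited R₂ (pos 0 le₂)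
  c = proj₁ C
  R₁c = △-member {R = R₁} R₁b (proj₂ C)
  c≢b = proj₁ R₁c
  c≢a = proj₁ (△-member {R = R} Ra (proj₂ R₁c))
  Rc = proj₂ (△-member {R = R} Ra (proj₂ R₁c))

∑-≤-size : ∀ {k} (f : Fin k → ℤ) → (∀ i → f i ≤ 1ℤ) → ∑ f ≤ + k
∑-≤-size {zero} f p = ℤₚ.≤-reflexive (trans (∑-cong {g = λ _ → 0ℤ} λ ()) (∑-0 0))
∑-≤-size {suc k} f p = subst (_≤ + suc k) (sym (∑-suc f)) (ℤₚ.+-mono-≤ (p zero) (∑-≤-size (f ∘ suc) (p ∘ suc)))

Annihilates : ∀ {k} → (Fin k → ℤ) → (Fin k → ℤ) → Set
Annihilates d r = ∑ (λ i → r i * d i) ≡ 0ℤ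

-- Gaussian elimination.
kernel-vector : ∀ {k} (rows : List (Fin k → ℤ)) → length rows ℕ.< k →
                ∃ λ d → (∃ λ i → d i ≢ 0ℤ) × All (Annihilates d) rows
kernel-vector {suc k} rows lt = go (Any.any? (λ r → ¬? (r zero ℤ.≟ 0ℤ)) rows)
  where
  go : Dec (Any (λ r → r zero ≢ 0ℤ) rows) → ∃ λ d → (∃ λ i → d i ≢ 0ℤ) × All (Annihilates d) rows
  go (no none) = unit , (zero , λ ()) , All.tabulate kills
    where
    unit : Fin (suc k) → ℤ
    unit zero = 1ℤ
    unit (suc _) = 0ℤ
    kills : ∀ {r} → r ∈ rows → Annihilates unit r
    kills {r} r∈ = trans (∑-suc (λ i → r i * unit i)) (cong₂ _+_ (trans (ℤₚ.*-identityʳ _) (settle (r zero ℤ.≟ 0ℤ)))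
                     (trans (∑-cong λ i → ℤₚ.*-zeroʳ (r (suc i))) (∑-0 k)))
      where
      settle : Dec (r zero ≡ 0ℤ) → r zero ≡ 0ℤ
      settle (yes z) = z
      settle (no nz) = contradiction (lose r∈ nz) none
  go (yes some) = let (r , r∈ , r₀) = find some; (as , bs , eq) = ∈-∃++ r∈ in eliminate r as bs eq r₀
    where
    eliminate : ∀ r as bs → rows ≡ as ++ r ∷ bs → r zero ≢ 0ℤ → ∃ λ d → (∃ λ i → d i ≢ 0ℤ) × All (Annihilates d) rows
    eliminate r as bs refl r₀ = d , nonzero , Allₚ.++⁺ (Allₚ.++⁻ˡ as others) (pivot ∷ Allₚ.++⁻ʳ as others)
      where
      reduce : (Fin (suc k) → ℤ) → Fin k → ℤ
      reduce s j = r zero * s (suc j) - s zero * r (suc j)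
      short : length (map reduce (as ++ bs)) ℕ.< k
      short = subst (ℕ._< k) (sym (trans (Listₚ.length-map reduce (as ++ bs)) (Listₚ.length-++ as)))
                (ℕₚ.≤-pred (subst (ℕ._< suc k) (trans (Listₚ.length-++ as) (ℕₚ.+-suc (length as) (length bs))) lt))
      IH = kernel-vector (map reduce (as ++ bs)) short
      d′ = proj₁ IH
      tail-sum : (Fin (suc k) → ℤ) → ℤ
      tail-sum s = ∑ (λ j → s (suc j) * d′ j)
      d : Fin (suc k) → ℤ
      -- Scaling the other coordinates by the pivot avoids division; this coordinate is chosen so
      -- that the pivot row is annihilated.
      d zero = - tail-sum r
      d (suc j) = r zero * d′ j
      expand : ∀ s → ∑ (λ i → s i * d i) ≡ r zero * tail-sum s - s zero * tail-sum r
      expand s = trans (∑-suc (λ i → s i * d i)) (trans (cong (ℤ._+_ (s zero * d zero))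
          (trans (∑-cong λ j → lem (s (suc j)) (r zero) (d′ j)) (sym (∑-* (r zero) (λ j → s (suc j) * d′ j)))))
          (lem₂ (s zero) (tail-sum r) (r zero) (tail-sum s)))
        where
        lem : ∀ s r d → s * (r * d) ≡ r * (s * d)
        lem = solve-∀
        lem₂ : ∀ s t r u → s * (- t) + r * u ≡ r * u - s * t
        lem₂ = solve-∀
      pivot : Annihilates d r
      pivot = trans (expand r) (lem (r zero) (tail-sum r))
        where
        lem : ∀ a b → a * b - a * b ≡ 0ℤ
        lem = solve-∀
      others : All (Annihilates d) (as ++ bs)
      others = All.map (λ {s} z → trans (expand s) (trans (sym (∑-linear (r zero) (s zero) (λ j → s (suc j) * d′ j) (λ j → r (suc j) * d′ j)))
                 (trans (∑-cong λ j → lem (r zero) (s zero) (s (suc j)) (r (suc j)) (d′ j)) z))) (Allₚ.map⁻ (proj₂ (proj₂ IH)))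
        where
        lem : ∀ a b s r d → a * (s * d) - b * (r * d) ≡ (a * s - b * r) * d
        lem = solve-∀
      nonzero : ∃ λ i → d i ≢ 0ℤ
      nonzero = let (j , nz) = proj₁ (proj₂ IH) in suc j , λ z → settle j nz (ℤₚ.i*j≡0⇒i≡0∨j≡0 (r zero) z)
        where
        settle : ∀ j → d′ j ≢ 0ℤ → r zero ≡ 0ℤ ⊎ d′ j ≡ 0ℤ → ⊥
        settle j nz (inj₁ z) = r₀ z
        settle j nz (inj₂ z) = nz z

∑-select : ∀ {k} (d : Fin k) (f : Fin k → ℤ) → ∑ (λ i → ⟦ ⁅ d ⁆ i ⟧ * f i) ≡ f d
∑-select {suc k} zero f = trans (∑-suc (λ i → ⟦ ⁅ zero ⁆ i ⟧ * f i)) (trans (cong₂ _+_ (trans (cong (λ b → ⟦ b ⟧ * f zero) (⁅⁆-self zero)) (ℤₚ.*-identityˡ _))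
  (trans (∑-cong λ i → cong (λ b → ⟦ b ⟧ * f (suc i)) (⁅⁆-other {a = zero} {suc i} λ ())) (∑-0 k))) (ℤₚ.+-identityʳ _))
∑-select {suc k} (suc d) f = trans (∑-suc (λ i → ⟦ ⁅ suc d ⁆ i ⟧ * f i)) (trans (cong₂ _+_ (cong (λ b → ⟦ b ⟧ * f zero) (⁅⁆-other {a = suc d} {zero} λ ()))
  (trans (∑-cong λ i → cong (λ b → ⟦ b ⟧ * f (suc i)) (⁅⁆-suc d i)) (∑-select d (f ∘ suc)))) (ℤₚ.+-identityˡ _))

∑-two : ∀ {k} (f : Fin k → ℤ) → (∀ i → 0ℤ ≤ f i) → ∀ {i j} → i ≢ j → f i + f j ≤ ∑ f
∑-two f nn {i} {j} ne = subst (_≤ ∑ f) (trans (∑-cong λ l → split l) (trans (∑-+ (λ l → ⟦ ⁅ i ⁆ l ⟧ * f l) (λ l → ⟦ ⁅ j ⁆ l ⟧ * f l))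
    (cong₂ _+_ (∑-select i f) (∑-select j f)))) (∑-mono λ l → le l)
  where
  R : _ → ℤ
  R l = (⟦ ⁅ i ⁆ l ⟧ + ⟦ ⁅ j ⁆ l ⟧) * f l
  split : ∀ l → R l ≡ ⟦ ⁅ i ⁆ l ⟧ * f l + ⟦ ⁅ j ⁆ l ⟧ * f l
  split l = ℤₚ.*-distribʳ-+ (f l) ⟦ ⁅ i ⁆ l ⟧ ⟦ ⁅ j ⁆ l ⟧
  le : ∀ l → R l ≤ f l
  le l = settle (toSum (i Fin.≟ l)) (toSum (j Fin.≟ l))
    where
    settle : i ≡ l ⊎ i ≢ l → j ≡ l ⊎ j ≢ l → R l ≤ f l
    settle (inj₁ refl) (inj₁ refl) = contradiction refl ne
    settle (inj₁ refl) (inj₂ q) rewrite ⁅⁆-self i | ⁅⁆-other q = ℤₚ.≤-reflexive (ℤₚ.*-identityˡ _)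
    settle (inj₂ p) (inj₁ refl) rewrite ⁅⁆-self j | ⁅⁆-other p = ℤₚ.≤-reflexive (ℤₚ.*-identityˡ _)
    settle (inj₂ p) (inj₂ q) rewrite ⁅⁆-other p | ⁅⁆-other q = nn l

∑-three : ∀ {k} (f : Fin k → ℤ) → (∀ i → 0ℤ ≤ f i) → ∀ {i j l} → i ≢ j → i ≢ l → j ≢ l → f i + f j + f l ≤ ∑ f
∑-three f nn {i} {j} {l} ij il jl = ℤₚ.≤-trans (ℤₚ.≤-reflexive (cong₂ _+_ (cong₂ _+_ (sym (off il)) (sym (off jl))) refl))
    (ℤₚ.≤-trans (ℤₚ.+-monoˡ-≤ (f l) (∑-two f′ nn′ ij)) (ℤₚ.≤-reflexive total≡))
  where
  f′ : _ → ℤ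
  f′ x = (1ℤ - ⟦ ⁅ l ⁆ x ⟧) * f x
  0≤1-⟦_⟧ : ∀ b → 0ℤ ≤ 1ℤ - ⟦ b ⟧
  0≤1-⟦ true ⟧ = +≤+ z≤n
  0≤1-⟦ false ⟧ = +≤+ z≤n
  nn′ : ∀ x → 0ℤ ≤ f′ x
  nn′ x = 0≤* 0≤1-⟦ ⁅ l ⁆ x ⟧ (nn x)
  off : ∀ {x} → x ≢ l → f′ x ≡ f x
  off {x} ne = trans (cong (λ b → (1ℤ - ⟦ b ⟧) * f x) (⁅⁆-other (ne ∘ sym))) (ℤₚ.*-identityˡ _)
  total≡ : ∑ f′ + f l ≡ ∑ f
  total≡ = trans (cong (ℤ._+_ (∑ f′)) (sym (∑-select l f))) (trans (sym (∑-+ f′ (λ x → ⟦ ⁅ l ⁆ x ⟧ * f x)))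
    (∑-cong λ x → lem′ ⟦ ⁅ l ⁆ x ⟧ (f x)))
    where
    lem′ : ∀ b f → (1ℤ - b) * f + b * f ≡ f
    lem′ = solve-∀

gather : ∀ {k} {A : Set} {B : Fin k → Set} → (∀ i → A ⊎ B i) → A ⊎ (∀ i → B i)
gather {zero} f = inj₂ λ ()
gather {suc k} {A} {B} f = go (f zero) (gather (f ∘ suc))
  where
  go : A ⊎ B zero → A ⊎ (∀ i → B (suc i)) → A ⊎ (∀ i → B i)
  go (inj₁ a) _ = inj₁ a
  go (inj₂ b) (inj₁ a) = inj₁ a
  go (inj₂ b) (inj₂ bs) = inj₂ λ { zero → b ; (suc i) → bs i }

length-filter : ∀ {k} (P : Fin k → Bool) → + length (filter (λ x → P x Bool.≟ true) (allFin k)) ≡ ∑ (λ x → ⟦ P x ⟧)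
length-filter {zero} P = sym (trans (∑-cong {g = λ _ → 0ℤ} λ ()) (∑-0 0))
length-filter {suc k} P = trans (cong +_ (go (P zero) refl)) (trans (cast (P zero)) (trans (cong (ℤ._+_ ⟦ P zero ⟧) (length-filter (P ∘ suc))) (sym (∑-suc (λ x → ⟦ P x ⟧)))))
  where
  tl : ℕ
  tl = length (filter (λ x → P (suc x) Bool.≟ true) (allFin k))
  add : Bool → ℕ → ℕ
  add true l = suc l
  add false l = l
  cast : ∀ b → + add b tl ≡ ⟦ b ⟧ + + tl
  cast true = refl
  cast false = sym (ℤₚ.+-identityˡ _)
  tails : filter (λ x → P x Bool.≟ true) (Data.List.tabulate {n = k} suc) ≡ map suc (filter (λ x → P (suc x) Bool.≟ true) (allFin k))
  tails = trans (cong (filter (λ x → P x Bool.≟ true)) (sym (Listₚ.map-tabulate (λ i → i) suc))) (filter-map (allFin k))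
    where
    filter-map : ∀ L → filter (λ x → P x Bool.≟ true) (map suc L) ≡ map suc (filter (λ x → P (suc x) Bool.≟ true) L)
    filter-map [] = refl
    filter-map (x ∷ L) with P (suc x) Bool.≟ true
    ... | yes _ = cong (suc x ∷_) (filter-map L)
    ... | no _ = filter-map L
  len-tails : length (filter (λ x → P x Bool.≟ true) (Data.List.tabulate {n = k} suc)) ≡ tl
  len-tails = trans (cong length tails) (Listₚ.length-map Fin.suc (filter (λ x → P (suc x) Bool.≟ true) (allFin k)))
  go : ∀ b → P zero ≡ b → length (filter (λ x → P x Bool.≟ true) (allFin (suc k))) ≡ add (P zero) tl
  go b eq with P zero Bool.≟ true
  ... | yes p = trans (cong suc len-tails) (cong (λ b → add b tl) (sym p))
  ... | no np = trans len-tails (cong (λ b → add b tl) (sym (Boolₚ.¬-not np)))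

∑-1 : ∀ k → ∑ {k} (λ _ → 1ℤ) ≡ + k
∑-1 zero = trans (∑-cong {g = λ _ → 0ℤ} λ ()) (∑-0 0)
∑-1 (suc k) = trans (∑-suc {k} (λ _ → 1ℤ)) (cong (ℤ._+_ 1ℤ) (∑-1 k))

-- Points whose tight odd cuts are all trivial

module Step {m n} (G : Graft m n)
  (IHG : ∀ (H : Graft m n) → card (Graft.alive H) ℕ.< card (Graft.alive G) → ∀ {x} → Weights.Valid H x → Weights.Good H x)
  (p : Point m) (vp : Weights.Valid G p) (pos : 0ℤ < tot p)
  (IHμ : ∀ {q} → Weights.Valid G q → Measure.μ G q ℕ.< Measure.μ G p → Weights.Good G q)
  (prime : ∀ U → Graft.odd G U ≡ true → Graft.weight G (wt p) U ≡ tot p → ¬ Measure.Nontrivial G U)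
  where
  open Graft G
  open Weights G
  open Constraints G
  open Measure G
  open Stars G

  even : odd (λ _ → true) ≡ false
  even = total-even vp pos

  -- The linear span of the smallest face of the cone that contains `p`.
  Forced : Point m → Set
  Forced q = ∀ i → Admissible i → val i p ≡ 0ℤ → val i q ≡ 0ℤ

  forced-supp : ∀ {q} → Forced q → ∀ e → supp q e ≡ true → supp p e ≡ true
  forced-supp {q} f e s = nonzero-supp {p} λ z → in-supp {q} s (f (edge e) tt z)

  forced-tight : ∀ {q} → Forced q → ∀ v → tight p v ≡ true → tight q v ≡ true
  forced-tight {q} f v t = val-tight {q} (tight-T {p} t) (f (starCon v) (starCon-admissible (tight-T {p} t)) (tight-val {p} t))

  forced-loose : ∀ {q} → Forced q → ∀ v → not (tight q v) ≡ true → not (tight p v) ≡ true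
  forced-loose {q} f v = go (tight p v) refl
    where
    go : ∀ b → tight p v ≡ b → not (tight q v) ≡ true → not b ≡ true
    go false _ _ = refl
    go true t nt = contradiction (trans (sym nt) (cong not (forced-tight {q} f v t))) λ ()

  -- A new tight cut either is nontrivial and G is contracted along it, or it is a star and μ drops.
  boundary-good : ∀ {q} → Valid q → Forced q → ∀ i → Admissible i → val i q ≡ 0ℤ → val i p ≢ 0ℤ → Good q
  boundary-good {q} vq f (edge e) _ z nz = IHμ vq (ℕₚ.+-mono-<-≤
    (card-< (supp q) (supp p) (forced-supp {q} f) e (zero-not-supp {q} z) (nonzero-supp {p} nz))
    (card-≤ _ _ (forced-loose {q} f)))
  boundary-good vq f total _ z nz = good-trivial vq z
  boundary-good {q} vq f (cutset U) o z nz = go (nontrivial? (lookup U))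
    where
    tightU : weight (wt q) (lookup U) ≡ tot q
    tightU = ℤₚ.i-j≡0⇒i≡j _ (tot q) z
    go : Dec (Nontrivial (lookup U)) → Good q
    go (yes nt) = nontrivial-good IHG vq (lookup U) o tightU nt
    go (no tr) = IHμ vq (ℕₚ.+-mono-≤-< (card-≤ _ _ (forced-supp {q} f))
        (card-< (not ∘ tight q) (not ∘ tight p) (forced-loose {q} f) v (cong not tq) (loose (tight p v) refl)))
      where
      triv = trivial-cut even (lookup U) o tr
      v = proj₁ triv
      Tv = proj₁ (proj₂ triv)
      cutv = proj₂ (proj₂ triv)
      weights : ∀ x → weight (wt x) (lookup U) ≡ weight (wt x) ⁅ v ⁆
      weights x = ∑-cong λ e → cong (λ b → ⟦ b ⟧ * wt x e) (cutv e)
      tq : tight q v ≡ true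
      tq = tight-intro {q} Tv (trans (sym (weights q)) tightU)
      loose : ∀ b → tight p v ≡ b → not (tight p v) ≡ true
      loose false eq = cong not eq
      loose true eq = contradiction (ℤₚ.i≡j⇒i-j≡0 (trans (weights p) (tight-weight {p} eq))) nz

  open Compatible (supp p) (tight p)

  compat-star : ∀ {J} → Compat J → ∀ v → tight p v ≡ true → weight (wt (χ J)) ⁅ v ⁆ ≡ 1ℤ
  compat-star {J} c v t = trans (∑-cong λ e → trans (⟦⟧-* (J e) (star v e)) (cong ⟦_⟧ (alone e))) (∑-⁅⁆ d)
    where
    found = ⨁-true⇒ (λ e → J e ∧ star v e) (trans (Local.parity c v refl) (tight-T {p} t))
    d = proj₁ found
    alone : ∀ e → J e ∧ star v e ≡ ⁅ d ⁆ e
    alone e = go (J e ∧ star v e) refl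
      where
      go : ∀ b → J e ∧ star v e ≡ b → J e ∧ star v e ≡ ⁅ d ⁆ e
      go true eq = trans eq (sym (trans (cong (λ x → ⁅ x ⁆ e) (Local.unique c v refl t d e (proj₂ found) eq)) (⁅⁆-self e)))
      go false eq = trans eq (sym (⁅⁆-other λ { refl → contradiction (trans (sym (proj₂ found)) eq) λ () }))

  -- By `prime` a tight odd cut is the star of a tight vertex, and a compatible join meets such a
  -- star once.
  compat-forced : ∀ {J} → Compat J → Forced (χ J)
  compat-forced {J} c (edge e) _ z = go (J e) refl
    where
    go : ∀ b → J e ≡ b → ⟦ J e ⟧ ≡ 0ℤ
    go false eq = cong ⟦_⟧ eq
    go true eq = contradiction z (in-supp {p} (Local.support c e eq))
  compat-forced c total _ z = contradiction z (0<⇒≢0 pos)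
  compat-forced {J} c (cutset U) o z = trans (cong (_- 1ℤ) (trans (weights (χ J)) (compat-star c v tv))) refl
    where
    tightU : weight (wt p) (lookup U) ≡ tot p
    tightU = ℤₚ.i-j≡0⇒i≡j _ (tot p) z
    triv = trivial-cut even (lookup U) o (prime (lookup U) o tightU)
    v = proj₁ triv
    weights : ∀ x → weight (wt x) (lookup U) ≡ weight (wt x) ⁅ v ⁆
    weights x = ∑-cong λ e → cong (λ b → ⟦ b ⟧ * wt x e) (proj₂ (proj₂ triv) e)
    tv : tight p v ≡ true
    tv = tight-intro {p} (proj₁ (proj₂ triv)) (trans (sym (weights p)) tightU)

  forced-comb : ∀ {α β q r} → Forced q → Forced r → Forced (α ∙ q ⊖ β ∙ r)
  forced-comb {α} {β} {q} {r} fq fr i ad z = trans (val-linear i α q β r)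
    (trans (cong₂ (λ a b → α * a - β * b) (fq i ad z) (fr i ad z)) (lem α β))
    where
    lem : ∀ α β → α * 0ℤ - β * 0ℤ ≡ 0ℤ
    lem = solve-∀

  -- By `good-tight` the joins in the packing inherit all inequalities that are tight at `p`: those
  -- of edges bound the support, those of stars give uniqueness.
  good-compat : ∀ {q} → Forced q → (g : Good q) → ∀ {J} → J ∈ Good.joins g → Compat J
  good-compat {q} f g {J} J∈ = record
    { parity = λ v _ → trans (j ⁅ v ⁆) (odd-star v)
    ; support = λ e Je → nonzero-supp {p} λ z → contradiction (trans (sym Je) (⟦⟧-0 (good-tight g {edge e} tt (f (edge e) tt z) J∈))) λ ()
    ; unique = λ v _ t → uniq v t
    }
    where
    j = All.lookup (Good.areJoins g) J∈
    uniq : ∀ v → tight p v ≡ true → ∀ e d → J e ∧ star v e ≡ true → J d ∧ star v d ≡ true → e ≡ d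
    uniq v t e d pe pd = trans (sym (⁅⁆-true x e (trans (sym (proj₂ one e)) pe))) (⁅⁆-true x d (trans (sym (proj₂ one d)) pd))
      where
      Tv = tight-T {p} t
      ad = starCon-admissible Tv
      val≡0 : val (starCon v) (χ J) ≡ 0ℤ
      val≡0 = good-tight g {starCon v} ad (f (starCon v) ad (tight-val {p} t)) J∈
      one = ∑-one⇒ (λ e → J e ∧ star v e) (trans (∑-cong λ e → sym (⟦⟧-* (J e) (star v e)))
              (ℤₚ.i-j≡0⇒i≡j (weight (wt (χ J)) ⁅ v ⁆) 1ℤ (trans (sym (starCon-val v (χ J))) val≡0)))
      x = proj₁ one

  crossings : ∀ J (U : Subset n) → ∑ (λ e → ⟦ J e ∧ cut (lookup U) e ⟧) ≡ val (cutset U) (χ J) + 1ℤ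
  crossings J U = trans (∑-cong λ e → sym (⟦⟧-* (J e) (cut (lookup U) e))) (lem (weight (wt (χ J)) (lookup U)))
    where
    lem : ∀ w → w ≡ w - 1ℤ + 1ℤ
    lem = solve-∀

  -- This crude bound determines how close to the boundary `Turn` has to stop.
  slope-bound : ∀ J i → val i (χ J) ≤ + m + 1ℤ
  slope-bound J (edge e) = ℤₚ.≤-trans (⟦⟧-≤1 (J e)) (ℤₚ.i≤j+i 1ℤ (+ m))
  slope-bound J total = ℤₚ.i≤j+i 1ℤ (+ m)
  slope-bound J (cutset U) = ℤₚ.≤-trans (≤-via (+ m - w + + 2) (0≤+ (diff bound) (+≤+ z≤n)) (lem w (+ m))) ℤₚ.≤-refl
    where
    w = weight (wt (χ J)) (lookup U)
    bound : w ≤ + m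
    bound = ∑-≤-size _ λ e → subst (_≤ 1ℤ) (sym (⟦⟧-* (J e) (cut (lookup U) e))) (⟦⟧-≤1 _)
    lem : ∀ w m → m - w + + 2 ≡ m + 1ℤ - (w - 1ℤ)
    lem = solve-∀

  -- Slope 1 arises from edges and from the total, slopes 2 and 4 from cuts that the join crosses
  -- three or five times.
  Power : ℤ → Set
  Power b = b ≡ 1ℤ ⊎ b ≡ + 2 ⊎ b ≡ + 4

  power? : ∀ b → Dec (Power b)
  power? b = (b ℤ.≟ 1ℤ) ⊎-dec ((b ℤ.≟ + 2) ⊎-dec (b ℤ.≟ + 4))

  power-exponent : ∀ {b} → Power b → ∃ λ k → b ≡ 2^ k
  power-exponent (inj₁ p) = 0 , p
  power-exponent (inj₂ (inj₁ p)) = 1 , p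
  power-exponent (inj₂ (inj₂ p)) = 2 , p

  n<2^n : ∀ n → n ℕ.< 2 ℕ.^ n
  n<2^n zero = s≤s z≤n
  n<2^n (suc n) = ℕₚ.≤-trans (s≤s (n<2^n n))
    (subst (suc (2 ℕ.^ n) ℕ.≤_) (cong (2 ℕ.^ n ℕ.+_) (sym (ℕₚ.+-identityʳ _))) (ℕₚ.+-monoˡ-≤ (2 ℕ.^ n) (ℕₚ.m^n>0 2 n)))

  big-power : ∀ {a} → 0ℤ ≤ a → ∃ λ k → a < 2^ k
  big-power {+ a} _ = a , ℤ.+<+ (n<2^n a)

  floor : ∀ {A b} → 0ℤ ≤ A → 0ℤ < b → ∃ λ (c : ℕ) → ∃ λ r → A ≡ + c * b + r × 0ℤ ≤ r × r < b
  floor {+ A} {+ suc b} _ _ = A ℕD./ suc b , + (A ℕD.% suc b) ,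
      trans (cong +_ (trans (ℕD.m≡m%n+[m/n]*n A (suc b)) (ℕₚ.+-comm (A ℕD.% suc b) _)))
        (trans (ℤₚ.pos-+ (A ℕD./ suc b ℕ.* suc b) _) (cong (_+ + (A ℕD.% suc b)) (ℤₚ.pos-* (A ℕD./ suc b) (suc b)))) ,
      +≤+ z≤n , ℤ.+<+ (ℕD.m%n<n A (suc b))
    where import Data.Nat.DivMod as ℕD
  floor {b = + zero} _ (ℤ.+<+ ())

  module _ {q J} (vq : Valid q) (fq : Forced q) (c : Compat J) where

    ray-good : ∀ {i} → i ∈ cons → Min q (χ J) i → Good (ray i q (χ J))
    ray-good {i} i∈ mi = boundary-good (ray-valid {q} {χ J} {i} mi) (forced-comb {val i (χ J)} {val i q} {q} {χ J} fq (compat-forced c)) i (cons-admissible i∈) (ray-zero q (χ J) i)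
      λ z → 0<⇒≢0 (proj₁ mi) (compat-forced c i (cons-admissible i∈) z)

    -- The boundary point is a power of two times `q` minus a multiple of `J`, so copies of `J`
    -- complete its packing to one of `q`.
    finish : ∀ {i} → i ∈ cons → Min q (χ J) i → Power (val i (χ J)) → Good q
    finish {i} i∈ mi pw = good-step {q} {J} (proj₁ e) ℤ.∣ val i q ∣ (compat-join c)
        (subst₂ (λ b a → Good (b ∙ q ⊖ a ∙ χ J)) (proj₂ e) (sym (ℤₚ.0≤i⇒+∣i∣≡i (vq i (cons-admissible i∈)))) (ray-good i∈ mi))
      where e = power-exponent pw

    module Widen {U : Subset n} (i∈ : cutset U ∈ cons) (mi : Min q (χ J) (cutset U))
                 (powerless : ∀ {j} → j ∈ cons → Min q (χ J) j → ¬ Power (val j (χ J))) where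
      private
        i = cutset U
        a = val i q
        b = val i (χ J)
        y = ray i q (χ J)
        gy = ray-good i∈ mi
        fy : Forced y
        fy = forced-comb {b} {a} {q} {χ J} fq (compat-forced c)

      -- If the weight of `e` vanished at `y`, the inequality of `e` would be met together with `i`,
      -- and its slope along `J` is 1.
      slack-on : ∀ e → J e ≡ true → wt y e ≢ 0ℤ
      slack-on e Je z = powerless (∈-cons (edge e) tt) (subst (λ t → 0ℤ < ⟦ t ⟧) (sym Je) (ℤ.+<+ (s≤s z≤n)) , best) (inj₁ (cong ⟦_⟧ Je))
        where
        best : ∀ {j} → j ∈ cons → wt q e * val j (χ J) ≤ val j q * ⟦ J e ⟧
        best {j} j∈ = ℤₚ.0≤i-j⇒j≤i (*-cancel-0≤ (proj₁ mi) (subst (0ℤ ≤_) (trans (lem b (wt q e) (val j (χ J)) (val j q) a z′) (cong (λ t → b * (val j q * ⟦ t ⟧ - wt q e * val j (χ J))) (sym Je))) (diff (proj₂ mi j∈))))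
          where
          z′ : b * wt q e ≡ a
          z′ = ℤₚ.i-j≡0⇒i≡j (b * wt q e) a (trans (cong (λ t → b * wt q e - t) (trans (sym (ℤₚ.*-identityʳ a)) (cong (λ t → a * ⟦ t ⟧) (sym Je)))) z)
          lem : ∀ b w g f a → b * w ≡ a → f * b - a * g ≡ b * (f * 1ℤ - w * g)
          lem b w g f a refl = lem′ b w g f
            where
            lem′ : ∀ b w g f → f * b - b * w * g ≡ b * (f * 1ℤ - w * g)
            lem′ = solve-∀

      -- The cut `U` is tight at `y`. So the packing of `y` saturates `e`, whose weight is positive
      -- there, and each of its joins crosses `U` only once.
      single : ∀ e → J e ∧ cut (lookup U) e ≡ true → ∃ λ K → Compat K × (∀ d → K d ∧ cut (lookup U) d ≡ ⁅ e ⁆ d)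
      single e p∧ = K , good-compat fy gy K∈ , λ d → trans (proj₂ one d) (cong (λ x → ⁅ x ⁆ d) (⁅⁆-true (proj₁ one) e (trans (sym (proj₂ one e)) (∧-join Ke ce))))
        where
        Je = proj₁ (∧-split (J e) p∧)
        ce = proj₂ (∧-split (J e) p∧)
        oU = cons-admissible i∈
        tightU : weight (wt y) (lookup U) ≡ tot y
        tightU = ℤₚ.i-j≡0⇒i≡j _ (tot y) (ray-zero q (χ J) i)
        full = good-saturated gy (lookup U) oU tightU e ce
        used = load-positive⇒ (Good.joins gy) e (subst (0ℤ <_) (sym full)
                 (0<-* (2^-pos (Good.exponent gy)) (≢0⇒0< (ray-valid {q} {χ J} {i} mi (edge e) tt) (slack-on e Je))))
        K = proj₁ used
        K∈ = proj₁ (proj₂ used)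
        Ke = proj₂ (proj₂ used)
        one = ∑-one⇒ (λ d → K d ∧ cut (lookup U) d) (trans (crossings K U)
                (cong (_+ 1ℤ) (good-tight gy {i} oU (ray-zero q (χ J) i) K∈)))

      wide : ∃ λ K → Compat K × (val i (χ K) ≡ + 2 ⊎ val i (χ K) ≡ + 4)
      wide = K , cK , slope cr
        where
        members = three-members (λ e → J e ∧ cut (lookup U) e) (subst (+ 3 ≤_) (sym (crossings J U)) three)
          where
          -- The slope is positive and not 1, and it is one less than the number of crossings.
          three : + 3 ≤ b + 1ℤ
          three = ℤₚ.+-monoˡ-≤ 1ℤ (ℤₚ.i<j⇒suc[i]≤j (ℤₚ.≤∧≢⇒< (0<⇒1≤ (proj₁ mi)) λ eq → powerless i∈ mi (inj₁ (sym eq))))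
        result = let (x , y , z , (xy , xz , yz) , (px , py , pz)) = members
                 in three-or-five (lookup U) c xy xz yz px py pz single
        K = proj₁ result
        cK = proj₁ (proj₂ result)
        cr = proj₂ (proj₂ result)
        slope : weight (wt (χ K)) (lookup U) ≡ + 3 ⊎ weight (wt (χ K)) (lookup U) ≡ + 5 → val i (χ K) ≡ + 2 ⊎ val i (χ K) ≡ + 4
        slope (inj₁ eq) = inj₁ (cong (_- 1ℤ) eq)
        slope (inj₂ eq) = inj₂ (cong (_- 1ℤ) eq)

  -- Together with `Forced` this says that `q` and `p` have the same tight inequalities, so `p` can
  -- keep its role of defining compatibility while `q` moves.
  Like : Point m → Set
  Like q = ∀ i → Admissible i → val i q ≡ 0ℤ → val i p ≡ 0ℤ

  measure : Point m → Subsetᵇ m → ℕ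
  measure q J = length (filter (min? q (χ J)) cons)

  -- Follow J almost to the boundary, stopping at a dyadic point x₁, and continue from there along K:
  -- every minimiser of (x₁, K) is then a minimiser of (q, J).
  module Turn {q J} (vq : Valid q) (fq : Forced q) (lq : Like q) (c : Compat J)
              {i} (i∈ : i ∈ cons) (mi : Min q (χ J) i) {K} (cK : Compat K) (pwK : val i (χ K) ≡ + 2 ⊎ val i (χ K) ≡ + 4) where
    a = val i q
    b = val i (χ J)
    f g h : Con → ℤ
    f j = val j q
    g j = val j (χ J)
    h j = val j (χ K)

    0≤a : 0ℤ ≤ a
    0≤a = vq i (cons-admissible i∈)

    M = + m + 1ℤ

    0≤M : 0ℤ ≤ M
    0≤M = +≤+ z≤n

    0<b = proj₁ mi
    0≤b = ℤₚ.<⇒≤ 0<b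

    -- An inequality that `J` does not meet together with `i` has slack at least `2^ N` at `x₁`,
    -- after scaling by `b`, whereas the scaled slack of a minimiser along `K` is at most
    -- `b * b * M`.
    power = big-power (0≤* (0≤* 0≤b 0≤b) 0≤M)
    N = proj₁ power
    large : b * b * M < 2^ N
    large = proj₂ power

    division = floor (0≤* (2^-nonneg N) 0≤a) 0<b
    t = proj₁ division
    r = proj₁ (proj₂ division)
    2^Na≡ : 2^ N * a ≡ + t * b + r
    2^Na≡ = proj₁ (proj₂ (proj₂ division))
    0≤r = proj₁ (proj₂ (proj₂ (proj₂ division)))
    r<b = proj₂ (proj₂ (proj₂ (proj₂ division)))

    x₁ : Point m
    x₁ = 2^ N ∙ q ⊖ + t ∙ χ J

    f₁ : Con → ℤ
    f₁ j = val j x₁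

    -- The first summand is a multiple of `2^ N` and vanishes exactly when `j` ties with `i` along
    -- `J`; the second is due to rounding `t` down.
    f₁≡ : ∀ j → b * f₁ j ≡ 2^ N * (f j * b - a * g j) + r * g j
    f₁≡ j = trans (cong (b *_) (val-linear j (2^ N) q (+ t) (χ J))) (trans (lem (2^ N) a b (+ t) r (f j) (g j))
              (trans (cong (λ s → 2^ N * (f j * b - a * g j) + r * g j + (s - (+ t * b + r)) * g j) 2^Na≡)
                (lem₂ (2^ N * (f j * b - a * g j) + r * g j) (+ t * b + r) (g j))))
      where
      lem : ∀ P a b t r f g → b * (P * f - t * g) ≡ P * (f * b - a * g) + r * g + (P * a - (t * b + r)) * g
      lem = solve-∀
      lem₂ : ∀ z s g → z + (s - s) * g ≡ z
      lem₂ = solve-∀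

    0≤g : ∀ {j} → j ∈ cons → 0ℤ ≤ g j
    0≤g {j} j∈ = join-valid (compat-join c) j (cons-admissible j∈)

    x₁-valid : Valid x₁
    x₁-valid j ad = *-cancel-0≤ 0<b (subst (0ℤ ≤_) (sym (f₁≡ j))
      (0≤+ (0≤* (2^-nonneg N) (diff (proj₂ mi (∈-cons j ad)))) (0≤* 0≤r (0≤g (∈-cons j ad)))))

    x₁-forced : Forced x₁
    x₁-forced = forced-comb {2^ N} {+ t} {q} {χ J} fq (compat-forced c)

    f₁i≡r : f₁ i ≡ r
    f₁i≡r = ℤₚ.*-cancelˡ-≡ b (f₁ i) r {{ℤ.≢-nonZero (0<⇒≢0 0<b)}} (trans (f₁≡ i) (lem (2^ N) a b r))
      where
      lem : ∀ P a b r → P * (a * b - a * b) + r * b ≡ b * r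
      lem = solve-∀

    x₁⇒q : Good x₁ → Good q
    x₁⇒q = good-step {q} {J} N t (compat-join c)

    exact : r ≡ 0ℤ → Good x₁
    exact z = boundary-good x₁-valid x₁-forced i (cons-admissible i∈) (trans f₁i≡r z)
      λ w → 0<⇒≢0 0<b (compat-forced c i (cons-admissible i∈) w)

    -- With a positive remainder the boundary is not yet reached. Where `g j` is positive, slack
    -- remains; where `g j` is zero, the slack of `q` has only been scaled.
    x₁-like : r ≢ 0ℤ → Like x₁
    x₁-like r≢0 j ad z = lq j ad (settle (0ℤ ℤ.<? g j))
      where
      j∈ = ∈-cons j ad
      0<r = ≢0⇒0< 0≤r r≢0
      sum≡0 : 2^ N * (f j * b - a * g j) + r * g j ≡ 0ℤ
      sum≡0 = trans (sym (f₁≡ j)) (trans (cong (b *_) z) (ℤₚ.*-zeroʳ b))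
      settle : Dec (0ℤ < g j) → f j ≡ 0ℤ
      settle (yes 0<g) = contradiction sum≡0 (0<⇒≢0 (ℤₚ.+-mono-≤-< (0≤* (2^-nonneg N) (diff (proj₂ mi j∈))) (0<-* 0<r 0<g)))
      settle (no g≤0) = zero-product (vanish (ℤₚ.≤-antisym (ℤₚ.≮⇒≥ g≤0) (0≤g j∈)))
        where
        vanish : g j ≡ 0ℤ → 2^ N * (f j * b) ≡ 0ℤ
        vanish gz = trans (lem (2^ N) (f j * b) a r) (trans (cong (λ g → 2^ N * (f j * b - a * g) + r * g) (sym gz)) sum≡0)
          where
          lem : ∀ P x a r → P * x ≡ P * (x - a * 0ℤ) + r * 0ℤ
          lem = solve-∀
        zero-product : 2^ N * (f j * b) ≡ 0ℤ → f j ≡ 0ℤ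
        zero-product e = settle′ (0ℤ ℤ.<? f j)
          where
          settle′ : Dec (0ℤ < f j) → f j ≡ 0ℤ
          settle′ (yes 0<f) = contradiction e (0<⇒≢0 (0<-* (2^-pos N) (0<-* 0<f 0<b)))
          settle′ (no f≤0) = ℤₚ.≤-antisym (ℤₚ.≮⇒≥ f≤0) (vq j ad)

    1≤hi : 1ℤ ≤ h i
    1≤hi = go pwK
      where
      go : h i ≡ + 2 ⊎ h i ≡ + 4 → 1ℤ ≤ h i
      go (inj₁ eq) = subst (1ℤ ≤_) (sym eq) (+≤+ (s≤s z≤n))
      go (inj₂ eq) = subst (1ℤ ≤_) (sym eq) (+≤+ (s≤s z≤n))

    hi-power : Power (h i)
    hi-power = inj₂ pwK

    -- Comparing `j` with `i` along `K` bounds `b * f₁ j` below `2^ N`. So the first summand of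
    -- `f₁≡` is zero, `j` ties with `i` along `J`, and the minimality of `i` carries over.
    minimisers-shrink : ∀ {j} → j ∈ cons → Min x₁ (χ K) j → Min q (χ J) j
    minimisers-shrink {j} j∈ (0<h , best) = settle-g (0ℤ ℤ.<? g j) , λ {l} l∈ → ℤₚ.0≤i-j⇒j≤i (*-cancel-0≤ 0<b
        (subst (0ℤ ≤_) (lem a b (f j) (f l) (g j) (g l)) (0≤+ (0≤* (0≤g j∈) (diff (proj₂ mi l∈))) (0≤* (0≤g l∈) (diff tie)))))
      where
      lem : ∀ a b fj fl gj gl → gj * (fl * b - a * gl) + gl * (a * gj - b * fj) ≡ b * (fl * gj - fj * gl)
      lem = solve-∀
      0≤f₁j = x₁-valid j (cons-admissible j∈)
      short : b * f₁ j < 2^ N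
      short = ℤₚ.≤-<-trans (ℤₚ.≤-trans step₁ step₂) large
        where
        bound : f₁ j * h i ≤ f₁ i * h j
        bound = best i∈
        step₁ : b * f₁ j ≤ b * (f₁ i * h j)
        step₁ = ≤-via (b * (f₁ j * (h i - 1ℤ)) + b * (f₁ i * h j - f₁ j * h i))
          (0≤+ (0≤* 0≤b (0≤* 0≤f₁j (diff 1≤hi))) (0≤* 0≤b (diff bound))) (lem₁ b (f₁ j) (h i) (f₁ i) (h j))
          where
          lem₁ : ∀ b fj hi fi hj → b * (fj * (hi - 1ℤ)) + b * (fi * hj - fj * hi) ≡ b * (fi * hj) - b * fj
          lem₁ = solve-∀
        step₂ : b * (f₁ i * h j) ≤ b * b * M
        step₂ = ≤-via (b * (r * (M - h j) + (b - r) * M))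
          (0≤* 0≤b (0≤+ (0≤* 0≤r (diff (slope-bound K j))) (0≤* (diff (ℤₚ.<⇒≤ r<b)) 0≤M)))
          (trans (lem₂ b r M (h j)) (cong (λ z → b * b * M - b * (z * h j)) (sym f₁i≡r)))
          where
          lem₂ : ∀ b r M h → b * (r * (M - h) + (b - r) * M) ≡ b * b * M - b * (r * h)
          lem₂ = solve-∀
      tie : b * f j ≤ a * g j
      tie = go (b * f j ℤ.≤? a * g j)
        where
        go : Dec (b * f j ≤ a * g j) → b * f j ≤ a * g j
        go (yes p) = p
        go (no gt) = contradiction short (ℤₚ.≤⇒≯ (≤-via (2^ N * (f j * b - a * g j - 1ℤ) + r * g j)
            (0≤+ (0≤* (2^-nonneg N) (diff 1≤)) (0≤* 0≤r (0≤g j∈)))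
            (trans (lem₃ (2^ N) (f j * b - a * g j) (r * g j)) (cong (_- 2^ N) (sym (f₁≡ j))))))
          where
          1≤ : 1ℤ ≤ f j * b - a * g j
          1≤ = 0<⇒1≤ (subst (λ z → 0ℤ < z - a * g j) (ℤₚ.*-comm b (f j)) (ℤₚ.≤∧≢⇒< (diff (ℤₚ.<⇒≤ (ℤₚ.≰⇒> gt)))
                 λ e → ℤₚ.<⇒≢ (ℤₚ.≰⇒> gt) (sym (ℤₚ.i-j≡0⇒i≡j (b * f j) (a * g j) (sym e)))))
          lem₃ : ∀ P d s → P * (d - 1ℤ) + s ≡ P * d + s - P
          lem₃ = solve-∀
      settle-g : Dec (0ℤ < g j) → 0ℤ < g j
      settle-g (yes p) = p
      -- If `j` had slope zero along `J`, the tie would make it tight at `q` and hence at `p`, and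
      -- its slope along `K` would be zero as well.
      settle-g (no n) = contradiction (compat-forced cK j ad (lq j ad fz)) (0<⇒≢0 0<h)
        where
        ad = cons-admissible j∈
        gz : g j ≡ 0ℤ
        gz = ℤₚ.≤-antisym (ℤₚ.≮⇒≥ n) (0≤g j∈)
        fz : f j ≡ 0ℤ
        fz = settle′ (0ℤ ℤ.<? f j)
          where
          settle′ : Dec (0ℤ < f j) → f j ≡ 0ℤ
          settle′ (yes 0<f) = contradiction (ℤₚ.≤-trans tie (ℤₚ.≤-reflexive (trans (cong (a *_) gz) (ℤₚ.*-zeroʳ a)))) (ℤₚ.<⇒≱ (0<-* 0<b 0<f))
          settle′ (no f≤0) = ℤₚ.≤-antisym (ℤₚ.≮⇒≥ f≤0) (vq j ad)

    measure-drops : ¬ Min x₁ (χ K) i → measure x₁ K ℕ.< measure q J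
    measure-drops ¬m = count-< (min? x₁ (χ K)) (min? q (χ J)) cons minimisers-shrink i∈ mi ¬m

  -- The new join `K` has slope 2 or 4 at the cut `U`. Either `U` is still met first, and this slope
  -- finishes the argument, or `U` drops out of the set of minimisers, which therefore shrinks. An
  -- exact division ends on the boundary at once.
  loop : ∀ {q J} → Valid q → Forced q → Like q → Compat J → Acc ℕ._<_ (measure q J) → Good q
  loop {q} {J} vq fq lq c (acc rs) = search (Any.any? (λ i → min? q (χ J) i ×-dec power? (val i (χ J))) cons)
    where
    search : Dec (Any (λ i → Min q (χ J) i × Power (val i (χ J))) cons) → Good q
    search (yes found) = let (i , i∈ , mi , pw) = find found in finish vq fq c i∈ mi pw
    search (no none) = at (proj₁ best) (proj₁ (proj₂ best)) (proj₂ (proj₂ best))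
      where
      best = minimizer vq total tt (ℤ.+<+ (s≤s z≤n))
      powerless : ∀ {j} → j ∈ cons → Min q (χ J) j → ¬ Power (val j (χ J))
      powerless j∈ mj pw = none (lose j∈ (mj , pw))
      at : ∀ i → i ∈ cons → Min q (χ J) i → Good q
      at total i∈ mi = contradiction (inj₁ refl) (powerless i∈ mi)
      at (edge e) i∈ mi = contradiction (inj₁ (ℤₚ.≤-antisym (⟦⟧-≤1 (J e)) (0<⇒1≤ (proj₁ mi)))) (powerless i∈ mi)
      at (cutset U) i∈ mi = x₁⇒q (go (r ℤ.≟ 0ℤ))
        where
        found = Widen.wide vq fq c i∈ mi powerless
        K = proj₁ found
        cK = proj₁ (proj₂ found)
        open Turn vq fq lq c i∈ mi cK (proj₂ (proj₂ found))
        go : Dec (r ≡ 0ℤ) → Good x₁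
        go (yes z) = exact z
        go (no nz) = again (min? x₁ (χ K) (cutset U))
          where
          again : Dec (Min x₁ (χ K) (cutset U)) → Good x₁
          again (yes m₁) = finish x₁-valid x₁-forced cK i∈ m₁ hi-power
          again (no ¬m) = loop x₁-valid x₁-forced (x₁-like nz) cK (rs (measure-drops ¬m))

  good-from-compat : ∀ {J} → Compat J → Good p
  good-from-compat c = loop vp (λ _ _ z → z) (λ _ _ z → z) c (<-wellFounded _)

  -- Finding a compatible join

  Outcome : Set
  Outcome = (∃ λ J → Compat J) ⊎ Good p

  forced-direction : (d : Fin m → ℤ) → (∀ e → wt p e ≡ 0ℤ → d e ≡ 0ℤ) → (∀ v → tight p v ≡ true → weight d ⁅ v ⁆ ≡ 0ℤ) →
                     Forced (point d 0ℤ)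
  forced-direction d off stars (edge e) _ z = off e z
  forced-direction d off stars total _ z = refl
  forced-direction d off stars (cutset U) o z = trans (cong (_- 0ℤ) (trans (weights d) (stars v tv))) refl
    where
    tightU : weight (wt p) (lookup U) ≡ tot p
    tightU = ℤₚ.i-j≡0⇒i≡j _ (tot p) z
    triv = trivial-cut even (lookup U) o (prime (lookup U) o tightU)
    v = proj₁ triv
    weights : ∀ x → weight x (lookup U) ≡ weight x ⁅ v ⁆
    weights x = ∑-cong λ e → cong (λ b → ⟦ b ⟧ * x e) (proj₂ (proj₂ triv) e)
    tv : tight p v ≡ true
    tv = tight-intro {p} (proj₁ (proj₂ triv)) (trans (sym (weights (wt p))) tightU)

  -- Moving along d keeps every tight star tight; the packing at the boundary point consists of compatible joins.
  follow : (d : Fin m → ℤ) → (∀ e → wt p e ≡ 0ℤ → d e ≡ 0ℤ) → (∀ v → tight p v ≡ true → weight d ⁅ v ⁆ ≡ 0ℤ) →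
           ∀ e → 0ℤ < d e → Outcome
  follow d off stars e de = inj₁ (first (Good.joins gy) refl)
    where
    v = point d 0ℤ
    fv = forced-direction d off stars
    hit = minimizer {p} {v} vp (edge e) tt de
    i = proj₁ hit
    i∈ = proj₁ (proj₂ hit)
    mi : Min p v i
    mi = proj₂ (proj₂ hit)
    y = ray i p v
    fy : Forced y
    fy = forced-comb {val i v} {val i p} {p} {v} (λ _ _ z → z) fv
    gy : Good y
    gy = boundary-good (ray-valid {p} {v} {i} mi) fy i (cons-admissible i∈) (ray-zero p v i)
           λ z → 0<⇒≢0 (proj₁ mi) (fv i (cons-admissible i∈) z)
    -- The direction has total 0, so the boundary point keeps a positive total and its packing is
    -- not empty.
    many : 0ℤ < + length (Good.joins gy)
    many = subst (0ℤ <_) (sym (Good.count gy)) (0<-* (2^-pos (Good.exponent gy))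
             (subst (0ℤ <_) (lem (val i v) (val i p) (tot p)) (0<-* (proj₁ mi) pos)))
      where
      lem : ∀ b a t → b * t ≡ b * t - a * 0ℤ
      lem = solve-∀
    first : ∀ Js → Good.joins gy ≡ Js → ∃ λ J → Compat J
    first [] eq = contradiction (subst (λ Js → 0ℤ < + length Js) eq many) (ℤₚ.<-irrefl refl)
    first (J ∷ Js) eq = J , good-compat fy gy (subst (J ∈_) (sym eq) (here refl))

  follow± : (d : Fin m → ℤ) → (∀ e → wt p e ≡ 0ℤ → d e ≡ 0ℤ) → (∀ v → tight p v ≡ true → weight d ⁅ v ⁆ ≡ 0ℤ) →
            ∀ e → d e ≢ 0ℤ → Outcome
  follow± d off stars e de = go (0ℤ ℤ.<? d e)
    where
    neg-weight : ∀ U → weight (λ e → 0ℤ * 0ℤ - 1ℤ * d e) U ≡ 0ℤ * weight (λ _ → 0ℤ) U - 1ℤ * weight d U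
    neg-weight U = weight-linear 0ℤ 1ℤ (λ _ → 0ℤ) d U
    lem : ∀ w → 0ℤ * w - 1ℤ * 0ℤ ≡ 0ℤ
    lem = solve-∀
    lem₂ : ∀ x → - x ≡ 0ℤ * 0ℤ - 1ℤ * x
    lem₂ = solve-∀
    go : Dec (0ℤ < d e) → Outcome
    go (yes q) = follow d off stars e q
    -- The negative of `d` is written as a linear combination to suit `weight-linear`.
    go (no q) = follow (λ e → 0ℤ * 0ℤ - 1ℤ * d e) (λ f z → trans (cong (λ x → 0ℤ * 0ℤ - 1ℤ * x) (off f z)) refl)
      (λ v t → trans (neg-weight ⁅ v ⁆) (trans (cong (λ x → 0ℤ * weight (λ _ → 0ℤ) ⁅ v ⁆ - 1ℤ * x) (stars v t)) (lem (weight (λ _ → 0ℤ) ⁅ v ⁆))))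
      e (subst (0ℤ <_) (lem₂ (d e)) (ℤₚ.neg-mono-< (ℤₚ.≤∧≢⇒< (ℤₚ.≮⇒≥ q) de)))

  oth : Fin m → Fin n → Fin n
  oth e v = Bool.if ⁅ v ⁆ (src e) then tgt e else src e

  record Ends (e : Fin m) (v : Fin n) : Set where
    field
      distinct : oth e v ≢ v
      star≡ : ∀ x → star x e ≡ ⁅ v ⁆ x xor ⁅ oth e v ⁆ x
      living : alive (oth e v) ≡ true

  ends-of : ∀ e v → star v e ≡ true → Ends e v
  ends-of e v se = go (ends v e se)
    where
    go : (src e ≡ v × tgt e ≢ v) ⊎ (tgt e ≡ v × src e ≢ v) → Ends e v
    go (inj₁ (refl , ne)) = record
      { distinct = λ q → ne (trans (sym o) q)
      ; star≡ = λ x → trans (star-ends e x) (cong (λ y → ⁅ src e ⁆ x xor ⁅ y ⁆ x) (sym o))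
      ; living = subst (λ y → alive y ≡ true) (sym o) (tgt-alive e)
      }
      where
      o : oth e (src e) ≡ tgt e
      o = cong (λ b → Bool.if b then tgt e else src e) (⁅⁆-self (src e))
    go (inj₂ (refl , ne)) = record
      { distinct = λ q → ne (trans (sym o) q)
      ; star≡ = λ x → trans (star-ends e x) (trans (Boolₚ.xor-comm (⁅ src e ⁆ x) _) (cong (λ y → ⁅ tgt e ⁆ x xor ⁅ y ⁆ x) (sym o)))
      ; living = subst (λ y → alive y ≡ true) (sym o) (src-alive e)
      }
      where
      o : oth e (tgt e) ≡ src e
      o = cong (λ b → Bool.if b then tgt e else src e) (⁅⁆-other (ne ∘ sym))

  star-other : ∀ {e v} → star v e ≡ true → star (oth e v) e ≡ true
  star-other {e} {v} se = trans (Ends.star≡ E (oth e v)) (cong₂ _xor_ (⁅⁆-other (Ends.distinct E ∘ sym)) (⁅⁆-self _))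
    where E = ends-of e v se

  star-third : ∀ {e v x} → star v e ≡ true → x ≢ v → x ≢ oth e v → star x e ≡ false
  star-third {e} {v} {x} se p q = trans (Ends.star≡ (ends-of e v se) x) (cong₂ _xor_ (⁅⁆-other (p ∘ sym)) (⁅⁆-other (q ∘ sym)))

  -- An edge of the support counts once for each tight end, and twice if only one end is tight.
  share : Fin n → Fin m → ℤ
  share v e = ⟦ star v e ∧ supp p e ⟧ * (1ℤ + ⟦ not (tight p (oth e v)) ⟧)

  module AtVertex (v : Fin n) (tv : tight p v ≡ true) where
    Tv = tight-T {p} tv

    At : Fin m → Set
    At e = star v e ∧ supp p e ≡ true

    at? : ∀ e → Dec (At e)
    at? e = (star v e ∧ supp p e) Bool.≟ true

    at-star : ∀ {e} → At e → star v e ≡ true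
    at-star {e} a = proj₁ (∧-split (star v e) a)

    at-supp : ∀ {e} → At e → supp p e ≡ true
    at-supp {e} a = proj₂ (∧-split (star v e) a)

    at-pos : ∀ {e} → At e → 0ℤ < wt p e
    at-pos {e} a = ≢0⇒0< (vp (edge e) tt) (in-supp {p} (at-supp a))

    not-at : ∀ {e} → star v e ≡ true → ¬ At e → wt p e ≡ 0ℤ
    not-at {e} se na = not-supp {p} (go (supp p e) refl)
      where
      go : ∀ b → supp p e ≡ b → supp p e ≡ false
      go false eq = eq
      go true eq = contradiction (∧-join se eq) na

    some : ∃ At
    some = let (e , pos′) = ∑-positive⇒ (λ e → ⟦ star v e ⟧ * wt p e) (subst (0ℤ <_) (sym (tight-weight {p} tv)) pos)
           in e , go e (star v e) refl (supp p e) refl pos′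
      where
      go : ∀ e s → star v e ≡ s → ∀ t → supp p e ≡ t → 0ℤ < ⟦ star v e ⟧ * wt p e → At e
      go e true es true et _ = ∧-join es et
      go e false es _ _ q = contradiction q (λ r → ℤₚ.<-irrefl (sym (cong (λ b → ⟦ b ⟧ * wt p e) es)) r)
      go e true es false et q = contradiction q (λ r → ℤₚ.<-irrefl (sym (trans (cong (⟦ star v e ⟧ *_) (not-supp {p} et)) (ℤₚ.*-zeroʳ ⟦ star v e ⟧))) r)

    w : Fin m → ℤ
    w = share v

    0≤w : ∀ e → 0ℤ ≤ w e
    0≤w e = 0≤* (⟦⟧-nonneg (star v e ∧ supp p e)) (0≤+ (+≤+ z≤n) (⟦⟧-nonneg (not (tight p (oth e v)))))

    w≥1 : ∀ {e} → At e → 1ℤ ≤ w e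
    w≥1 {e} a = subst (1ℤ ≤_) (sym (trans (cong (λ b → ⟦ b ⟧ * (1ℤ + ⟦ not (tight p (oth e v)) ⟧)) a) (ℤₚ.*-identityˡ _)))
      (ℤₚ.+-monoʳ-≤ 1ℤ (⟦⟧-nonneg (not (tight p (oth e v)))))

    w≥2 : ∀ {e} → At e → tight p (oth e v) ≡ false → + 2 ≤ w e
    w≥2 {e} a l = ℤₚ.≤-reflexive (sym (cong₂ (λ s t → ⟦ s ⟧ * (1ℤ + ⟦ not t ⟧)) a l))

    -- Every join contains the only edge e at v, so e can be contracted.
    module Pendant (e : Fin m) (ae : At e) (only : ∀ f → At f → f ≡ e) where
      private
        u = oth e v
        E = ends-of e v (at-star ae)
        u≢v = Ends.distinct E

      merge-to : Retraction G
      merge-to = record { ρ = ρ ; idem = idem ; preserves = preserves }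
        where
        ρ : Fin n → Fin n
        ρ x = Bool.if ⁅ v ⁆ x then u else x
        idem : ∀ x → ρ (ρ x) ≡ ρ x
        idem x = go (⁅ v ⁆ x) refl
          where
          go : ∀ b → ⁅ v ⁆ x ≡ b → ρ (Bool.if b then u else x) ≡ (Bool.if ⁅ v ⁆ x then u else x)
          go true eq = trans (cong (λ b → Bool.if b then u else u) (⁅⁆-other {a = v} {u} (u≢v ∘ sym))) (cong (λ b → Bool.if b then u else x) (sym eq))
          go false eq = refl
        preserves : ∀ x → alive x ≡ true → alive (ρ x) ≡ true
        preserves x ax = go (⁅ v ⁆ x)
          where
          go : ∀ b → alive (Bool.if b then u else x) ≡ true
          go true = Ends.living E
          go false = ax

      private
        H = contract G merge-to
        ρ = Retraction.ρ merge-to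

        ρ-v : ρ v ≡ u
        ρ-v = cong (λ b → Bool.if b then u else v) (⁅⁆-self v)

        ρ-other : ∀ {x} → v ≢ x → ρ x ≡ x
        ρ-other {x} ne = cong (λ b → Bool.if b then u else x) (⁅⁆-other ne)

        g : Weights.Good H p
        g = IHG H (contract-fewer G merge-to (T-alive v Tv) (λ q → u≢v (trans (sym ρ-v) q))) (valid-contract G merge-to vp)

        -- In the contraction `e` is a loop, which a join may or may not contain; it is put into
        -- every join.
        lift : Subsetᵇ m → Subsetᵇ m
        lift J f = J f ∨ ⁅ e ⁆ f

        -- The whole weight of the tight star lies on `e`, which leaves room for one copy of `e` per
        -- join.
        full : wt p e ≡ tot p
        full = trans (sym (∑-select e (wt p))) (trans (∑-cong λ f → sym (pointwise f)) (tight-weight {p} tv))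
          where
          pointwise : ∀ f → ⟦ star v f ⟧ * wt p f ≡ ⟦ ⁅ e ⁆ f ⟧ * wt p f
          pointwise f = go (toSum (e Fin.≟ f)) (star v f) refl
            where
            go : e ≡ f ⊎ e ≢ f → ∀ b → star v f ≡ b → ⟦ star v f ⟧ * wt p f ≡ ⟦ ⁅ e ⁆ f ⟧ * wt p f
            go (inj₁ refl) b _ = cong (λ s → ⟦ s ⟧ * wt p e) (trans (at-star ae) (sym (⁅⁆-self e)))
            go (inj₂ ne) false eq = cong (λ s → ⟦ s ⟧ * wt p f) (trans eq (sym (⁅⁆-other ne)))
            go (inj₂ ne) true eq = trans (cong (⟦ star v f ⟧ *_) z) (trans (ℤₚ.*-zeroʳ ⟦ star v f ⟧) (sym (trans (cong (⟦ ⁅ e ⁆ f ⟧ *_) z) (ℤₚ.*-zeroʳ ⟦ ⁅ e ⁆ f ⟧))))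
              where z = not-at eq (λ a → ne (sym (only f a)))

        module _ {J : Subsetᵇ m} (j : Graft.Join H J) (sup : ∀ f → J f ≡ true → supp p f ≡ true) where

          at-e : lift J e ≡ true
          at-e = trans (cong (J e ∨_) (⁅⁆-self e)) (Boolₚ.∨-zeroʳ _)

          off-e : ∀ {V : Subsetᵇ m} → V e ≡ false → ∀ f → lift J f ∧ V f ≡ J f ∧ V f
          off-e {V} ve f = go (toSum (e Fin.≟ f))
            where
            go : e ≡ f ⊎ e ≢ f → lift J f ∧ V f ≡ J f ∧ V f
            go (inj₁ refl) = trans (cong (lift J e ∧_) ve) (trans (Boolₚ.∧-zeroʳ _) (sym (trans (cong (J e ∧_) ve) (Boolₚ.∧-zeroʳ _))))
            go (inj₂ ne) = cong (_∧ V f) (trans (cong (J f ∨_) (⁅⁆-other ne)) (Boolₚ.∨-identityʳ _))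

          parity-v : ⨁ (λ f → lift J f ∧ star v f) ≡ T v
          parity-v = trans (⨁-cong pointwise) (trans (⨁-single e (star v)) (trans (at-star ae) (sym Tv)))
            where
            pointwise : ∀ f → lift J f ∧ star v f ≡ ⁅ e ⁆ f ∧ star v f
            pointwise f = go (toSum (e Fin.≟ f)) (J f) refl (star v f) refl
              where
              go : e ≡ f ⊎ e ≢ f → ∀ b → J f ≡ b → ∀ s → star v f ≡ s → lift J f ∧ star v f ≡ ⁅ e ⁆ f ∧ star v f
              go (inj₁ refl) _ _ _ _ = cong (_∧ star v e) (trans at-e (sym (⁅⁆-self e)))
              go (inj₂ ne) false jf _ _ = cong (λ b → (b ∨ ⁅ e ⁆ f) ∧ star v f) jf
              go (inj₂ ne) true jf true sf = contradiction (sym (only f (∧-join sf (sup f jf)))) ne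
              go (inj₂ ne) true jf false sf = trans (cong (lift J f ∧_) sf) (trans (Boolₚ.∧-zeroʳ _) (sym (trans (cong (⁅ e ⁆ f ∧_) sf) (Boolₚ.∧-zeroʳ _))))

          lift-join : Join (lift J)
          lift-join = join-from-stars λ x → go x (toSum (v Fin.≟ x)) (toSum (u Fin.≟ x))
            where
            go : ∀ x → v ≡ x ⊎ v ≢ x → u ≡ x ⊎ u ≢ x → ⨁ (λ f → lift J f ∧ star x f) ≡ T x
            go x (inj₁ refl) _ = parity-v
            go x (inj₂ v≢x) (inj₂ u≢x) = trans (⨁-cong (off-e {star x} (star-third (at-star ae) (v≢x ∘ sym) (u≢x ∘ sym))))
                (trans (⨁-cong λ f → cong (J f ∧_) (sym (cut-cong same f))) (trans (join-contract G merge-to j ⁅ x ⁆) (trans (odd-cong same) (odd-star x))))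
              where
              same : ∀ y → ⁅ x ⁆ (ρ y) ≡ ⁅ x ⁆ y
              same y = at (toSum (v Fin.≟ y))
                where
                at : v ≡ y ⊎ v ≢ y → ⁅ x ⁆ (ρ y) ≡ ⁅ x ⁆ y
                at (inj₁ refl) = trans (cong ⁅ x ⁆ ρ-v) (trans (⁅⁆-other (u≢x ∘ sym)) (sym (⁅⁆-other (v≢x ∘ sym))))
                at (inj₂ ne) = cong ⁅ x ⁆ (ρ-other ne)
            -- The fibre of `u` consists of `u` and `v`, and its cut avoids the loop `e`. Modulo
            -- two, the star of `u` is this cut plus the star of `v`.
            go x (inj₂ v≢x) (inj₁ refl) = trans (⨁-cong λ f → cong (lift J f ∧_) (recombine f))
                (trans (⨁-cong λ f → Boolₚ.∧-distribˡ-xor (lift J f) (cut V f) (star v f))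
                (trans (⨁-xor (λ f → lift J f ∧ cut V f) (λ f → lift J f ∧ star v f))
                (trans (cong₂ _xor_ (trans (⨁-cong (off-e {cut V} cutVe)) (trans (join-contract G merge-to j ⁅ u ⁆) oddV)) parity-v)
                  (trans (Boolₚ.xor-assoc (T u) (T v) (T v)) (trans (cong (T u xor_) (Boolₚ.xor-same (T v))) (Boolₚ.xor-identityʳ (T u)))))))
              where
              V : Subsetᵇ n
              V y = ⁅ u ⁆ (ρ y)
              V≡ : ∀ y → V y ≡ ⁅ u ⁆ y xor ⁅ v ⁆ y
              V≡ y = at (toSum (v Fin.≟ y))
                where
                at : v ≡ y ⊎ v ≢ y → ⁅ u ⁆ (ρ y) ≡ ⁅ u ⁆ y xor ⁅ v ⁆ y
                at (inj₁ refl) = trans (cong ⁅ u ⁆ ρ-v) (trans (⁅⁆-self u) (sym (cong₂ _xor_ (⁅⁆-other u≢v) (⁅⁆-self v))))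
                at (inj₂ ne) = trans (cong ⁅ u ⁆ (ρ-other ne)) (sym (trans (cong (⁅ u ⁆ y xor_) (⁅⁆-other ne)) (Boolₚ.xor-identityʳ _)))
              recombine : ∀ f → star u f ≡ cut V f xor star v f
              recombine f = sym (trans (cong (_xor star v f) (cong₂ _xor_ (V≡ (src f)) (V≡ (tgt f)))) (lem (⁅ u ⁆ (src f)) (⁅ v ⁆ (src f)) (⁅ u ⁆ (tgt f)) (⁅ v ⁆ (tgt f))))
                where
                lem : ∀ a b c d → ((a xor b) xor (c xor d)) xor (b xor d) ≡ a xor c
                lem a b c d = solve 4 (λ a b c d → ((a :+ b) :+ (c :+ d)) :+ (b :+ d) := a :+ c) refl a b c d
                  where open xor-∧-Solver
              cutVe : cut V e ≡ false
              cutVe = trans (sym (xor-cancel (cut V e) (star v e))) (trans (cong (_xor star v e) (sym (recombine e)))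
                        (cong₂ _xor_ (star-other (at-star ae)) (at-star ae)))
                where
                xor-cancel : ∀ a b → (a xor b) xor b ≡ a
                xor-cancel a b = trans (Boolₚ.xor-assoc a b b) (trans (cong (a xor_) (Boolₚ.xor-same b)) (Boolₚ.xor-identityʳ a))
              oddV : odd V ≡ T u xor T v
              oddV = trans (odd-cong V≡) (trans (⨁-△ ⁅ u ⁆ ⁅ v ⁆ T) (cong₂ _xor_ (odd-star u) (odd-star v)))

        load-lift : ∀ Js f → e ≢ f → load (map lift Js) f ≡ load Js f
        load-lift [] f ne = refl
        load-lift (J ∷ Js) f ne = cong₂ _+_ (cong ⟦_⟧ (trans (cong (J f ∨_) (⁅⁆-other ne)) (Boolₚ.∨-identityʳ _))) (load-lift Js f ne)

        load-≤ : ∀ (Js : List (Subsetᵇ m)) f → load Js f ≤ + length Js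
        load-≤ [] f = ℤₚ.≤-refl
        load-≤ (J ∷ Js) f = ℤₚ.+-mono-≤ (⟦⟧-≤1 (J f)) (load-≤ Js f)

      pendant-good : Good p
      pendant-good = record
        { exponent = k
        ; joins = map lift Js
        ; areJoins = Allₚ.map⁺ (All.tabulate λ {J} J∈ → lift-join (All.lookup (Weights.Good.areJoins g) J∈) (sup J∈))
        ; count = trans (cong +_ (Listₚ.length-map lift Js)) (Weights.Good.count g)
        ; packed = λ f → pck f (toSum (e Fin.≟ f))
        }
        where
        k = Weights.Good.exponent g
        Js = Weights.Good.joins g
        sup : ∀ {J} → J ∈ Js → ∀ f → J f ≡ true → supp p f ≡ true
        sup {J} J∈ f Jf = nonzero-supp {p} λ z → contradiction
          (subst₂ _≤_ (cong ⟦_⟧ Jf) (trans (cong (2^ k *_) z) (ℤₚ.*-zeroʳ (2^ k))) (ℤₚ.≤-trans (load-member J∈ f) (Weights.Good.packed g f))) λ { (+≤+ ()) }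
        pck : ∀ f → e ≡ f ⊎ e ≢ f → load (map lift Js) f ≤ 2^ k * wt p f
        pck f (inj₂ ne) = subst (_≤ 2^ k * wt p f) (sym (load-lift Js f ne)) (Weights.Good.packed g f)
        pck f (inj₁ refl) = ℤₚ.≤-trans (load-≤ (map lift Js) e) (ℤₚ.≤-reflexive (trans (cong +_ (Listₚ.length-map lift Js))
          (trans (Weights.Good.count g) (cong (2^ k *_) (sym full)))))

    -- Shifting weight from one of two parallel edges to the other changes the weight of no star.
    parallel : ∀ {e₁ e₂} → At e₁ → At e₂ → e₁ ≢ e₂ → oth e₁ v ≡ oth e₂ v → Outcome
    parallel {e₁} {e₂} a₁ a₂ ne same = follow d off stars e₁ (subst (0ℤ <_) (sym (cong₂ (λ s t → ⟦ s ⟧ - ⟦ t ⟧) (⁅⁆-self e₁) (⁅⁆-other (ne ∘ sym)))) (ℤ.+<+ (s≤s z≤n)))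
      where
      d : Fin m → ℤ
      d f = ⟦ ⁅ e₁ ⁆ f ⟧ - ⟦ ⁅ e₂ ⁆ f ⟧
      off : ∀ f → wt p f ≡ 0ℤ → d f ≡ 0ℤ
      off f z = cong₂ (λ s t → ⟦ s ⟧ - ⟦ t ⟧) (⁅⁆-other {a = e₁} {f} λ { refl → in-supp {p} (at-supp a₁) z }) (⁅⁆-other {a = e₂} {f} λ { refl → in-supp {p} (at-supp a₂) z })
      stars : ∀ x → tight p x ≡ true → weight d ⁅ x ⁆ ≡ 0ℤ
      stars x _ = trans (∑-cong λ f → lem ⟦ star x f ⟧ ⟦ ⁅ e₁ ⁆ f ⟧ ⟦ ⁅ e₂ ⁆ f ⟧) (trans (∑-linear 1ℤ 1ℤ (λ f → ⟦ ⁅ e₁ ⁆ f ⟧ * ⟦ star x f ⟧) (λ f → ⟦ ⁅ e₂ ⁆ f ⟧ * ⟦ star x f ⟧))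
          (trans (cong₂ (λ a b → 1ℤ * a - 1ℤ * b) (∑-select e₁ (λ f → ⟦ star x f ⟧)) (trans (∑-select e₂ (λ f → ⟦ star x f ⟧)) (cong ⟦_⟧ (sym equal)))) (lem₂ ⟦ star x e₁ ⟧)))
        where
        lem : ∀ s a b → s * (a - b) ≡ 1ℤ * (a * s) - 1ℤ * (b * s)
        lem = solve-∀
        lem₂ : ∀ s → 1ℤ * s - 1ℤ * s ≡ 0ℤ
        lem₂ = solve-∀
        equal : star x e₁ ≡ star x e₂
        equal = trans (Ends.star≡ (ends-of e₁ v (at-star a₁)) x) (trans (cong (λ y → ⁅ v ⁆ x xor ⁅ y ⁆ x) same) (sym (Ends.star≡ (ends-of e₂ v (at-star a₂)) x)))

  module TwoEdges (v : Fin n) (tv : tight p v ≡ true) {e₁ e₂ : Fin m}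
    (a₁ : AtVertex.At v tv e₁) (a₂ : AtVertex.At v tv e₂) (e₁≢e₂ : e₁ ≢ e₂)
    (only : ∀ f → AtVertex.At v tv f → f ≡ e₁ ⊎ f ≡ e₂) (ta : tight p (oth e₁ v) ≡ true) (tb : tight p (oth e₂ v) ≡ true) (a≢b : oth e₁ v ≢ oth e₂ v) where
    open AtVertex v tv
    private
      W = wt p
      a = oth e₁ v
      b = oth e₂ v
      E₁ = ends-of e₁ v (at-star a₁)
      E₂ = ends-of e₂ v (at-star a₂)
      v≢a : v ≢ a
      v≢a = Ends.distinct E₁ ∘ sym
      v≢b : v ≢ b
      v≢b = Ends.distinct E₂ ∘ sym
      A : Subsetᵇ n
      A = (⁅ v ⁆ △ ⁅ a ⁆) △ ⁅ b ⁆

      cutA : ∀ f → cut A f ≡ (star v f xor star a f) xor star b f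
      cutA f = lem (⁅ v ⁆ (src f)) (⁅ a ⁆ (src f)) (⁅ b ⁆ (src f)) (⁅ v ⁆ (tgt f)) (⁅ a ⁆ (tgt f)) (⁅ b ⁆ (tgt f))
        where
        lem : ∀ a b c d e f → ((a xor b) xor c) xor ((d xor e) xor f) ≡ ((a xor d) xor (b xor e)) xor (c xor f)
        lem a b c d e f = solve 6 (λ a b c d e f → ((a :+ b) :+ c) :+ ((d :+ e) :+ f) := ((a :+ d) :+ (b :+ e)) :+ (c :+ f)) refl a b c d e f
          where open xor-∧-Solver

      oddA : odd A ≡ true
      oddA = trans (⨁-△ (⁅ v ⁆ △ ⁅ a ⁆) ⁅ b ⁆ T) (cong₂ _xor_ (trans (⨁-△ ⁅ v ⁆ ⁅ a ⁆ T)
        (cong₂ _xor_ (trans (odd-star v) (tight-T {p} tv)) (trans (odd-star a) (tight-T {p} ta)))) (trans (odd-star b) (tight-T {p} tb)))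

      star-v₁ = at-star a₁
      star-v₂ = at-star a₂
      star-a₁ : star a e₁ ≡ true
      star-a₁ = star-other star-v₁
      star-b₂ : star b e₂ ≡ true
      star-b₂ = star-other star-v₂
      star-b₁ : star b e₁ ≡ false
      star-b₁ = star-third star-v₁ (v≢b ∘ sym) (a≢b ∘ sym)
      star-a₂ : star a e₂ ≡ false
      star-a₂ = star-third star-v₂ (v≢a ∘ sym) a≢b
      cutA₁ : cut A e₁ ≡ false
      cutA₁ = trans (cutA e₁) (cong₂ _xor_ (cong₂ _xor_ star-v₁ star-a₁) star-b₁)
      cutA₂ : cut A e₂ ≡ false
      cutA₂ = trans (cutA e₂) (cong₂ _xor_ (cong₂ _xor_ star-v₂ star-a₂) star-b₂)

      by-edge : ∀ {ℓ} (P : Fin m → Set ℓ) → P e₁ → P e₂ → (∀ f → e₁ ≢ f → e₂ ≢ f → P f) → ∀ f → P f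
      by-edge P p₁ p₂ p₃ f = go (toSum (e₁ Fin.≟ f)) (toSum (e₂ Fin.≟ f))
        where
        go : e₁ ≡ f ⊎ e₁ ≢ f → e₂ ≡ f ⊎ e₂ ≢ f → P f
        go (inj₁ refl) _ = p₁
        go (inj₂ _) (inj₁ refl) = p₂
        go (inj₂ q) (inj₂ r) = p₃ f q r

      off-star : ∀ f → e₁ ≢ f → e₂ ≢ f → star v f ≡ true → W f ≡ 0ℤ
      off-star f n₁ n₂ s = not-at s λ af → settle (only f af)
        where
        settle : f ≡ e₁ ⊎ f ≡ e₂ → ⊥
        settle (inj₁ q) = n₁ (sym q)
        settle (inj₂ q) = n₂ (sym q)

      W≥0 : ∀ f → 0ℤ ≤ W f
      W≥0 f = vp (edge f) tt

      two-edges : W e₁ + W e₂ ≡ tot p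
      two-edges = trans (sym (trans (∑-+ (λ f → ⟦ ⁅ e₁ ⁆ f ⟧ * W f) (λ f → ⟦ ⁅ e₂ ⁆ f ⟧ * W f)) (cong₂ _+_ (∑-select e₁ W) (∑-select e₂ W))))
        (trans (∑-cong pointwise) (tight-weight {p} tv))
        where
        pointwise : ∀ f → ⟦ ⁅ e₁ ⁆ f ⟧ * W f + ⟦ ⁅ e₂ ⁆ f ⟧ * W f ≡ ⟦ star v f ⟧ * W f
        pointwise = by-edge _
          (trans (cong₂ (λ s t → ⟦ s ⟧ * W e₁ + ⟦ t ⟧ * W e₁) (⁅⁆-self e₁) (⁅⁆-other (e₁≢e₂ ∘ sym))) (trans (lem (W e₁)) (cong (λ s → ⟦ s ⟧ * W e₁) (sym star-v₁))))
          (trans (cong₂ (λ s t → ⟦ s ⟧ * W e₂ + ⟦ t ⟧ * W e₂) (⁅⁆-other e₁≢e₂) (⁅⁆-self e₂)) (trans (lem₂ (W e₂)) (cong (λ s → ⟦ s ⟧ * W e₂) (sym star-v₂))))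
          λ f n₁ n₂ → trans (cong₂ (λ s t → ⟦ s ⟧ * W f + ⟦ t ⟧ * W f) (⁅⁆-other n₁) (⁅⁆-other n₂)) (sym (go f (star v f) refl n₁ n₂))
          where
          lem : ∀ x → 1ℤ * x + 0ℤ * x ≡ 1ℤ * x
          lem = solve-∀
          lem₂ : ∀ x → 0ℤ * x + 1ℤ * x ≡ 1ℤ * x
          lem₂ = solve-∀
          go : ∀ f s → star v f ≡ s → e₁ ≢ f → e₂ ≢ f → ⟦ star v f ⟧ * W f ≡ 0ℤ
          go f false eq _ _ = cong (λ s → ⟦ s ⟧ * W f) eq
          go f true eq n₁ n₂ = trans (cong (⟦ star v f ⟧ *_) (off-star f n₁ n₂ eq)) (ℤₚ.*-zeroʳ ⟦ star v f ⟧)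

      -- The sum of the three tight stars counts `e₁` and `e₂` twice, although they lie inside `A`.
      -- Their weights add up to the total, so at most 3 - 2 times the total is left for the cut.
      tightA : weight W A ≡ tot p
      tightA = ℤₚ.≤-antisym (≤-via _ (diff summed) (trans (cong₂ _-_ rhs lhs) (trans (cong (λ t → tot p + tot p + tot p - (weight W A + + 2 * t)) two-edges) (lem (tot p) (weight W A)))))
                 (valid-cut {p} vp A oddA)
        where
        L R : Fin m → ℤ
        L f = ⟦ cut A f ⟧ * W f + + 2 * (⟦ ⁅ e₁ ⁆ f ⟧ * W f + ⟦ ⁅ e₂ ⁆ f ⟧ * W f)
        R f = ⟦ star v f ⟧ * W f + ⟦ star a f ⟧ * W f + ⟦ star b f ⟧ * W f
        lem : ∀ t w → t + t + t - (w + + 2 * t) ≡ t - w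
        lem = solve-∀
        xor-≤ : ∀ x y z → ⟦ (x xor y) xor z ⟧ ≤ ⟦ x ⟧ + ⟦ y ⟧ + ⟦ z ⟧
        xor-≤ true true true = +≤+ (s≤s z≤n)
        xor-≤ true true false = +≤+ z≤n
        xor-≤ true false true = +≤+ z≤n
        xor-≤ true false false = ℤₚ.≤-refl
        xor-≤ false true true = +≤+ z≤n
        xor-≤ false true false = ℤₚ.≤-refl
        xor-≤ false false true = ℤₚ.≤-refl
        xor-≤ false false false = ℤₚ.≤-refl
        pointwise : ∀ f → L f ≤ R f
        pointwise = by-edge _
          (ℤₚ.≤-reflexive (trans (cong₂ (λ s t → ⟦ s ⟧ * W e₁ + + 2 * t) cutA₁ (cong₂ (λ s t → ⟦ s ⟧ * W e₁ + ⟦ t ⟧ * W e₁) (⁅⁆-self e₁) (⁅⁆-other (e₁≢e₂ ∘ sym))))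
            (trans (lem₁ (W e₁)) (sym (cong₂ (λ s t → s + ⟦ t ⟧ * W e₁) (cong₂ (λ s t → ⟦ s ⟧ * W e₁ + ⟦ t ⟧ * W e₁) star-v₁ star-a₁) star-b₁)))))
          (ℤₚ.≤-reflexive (trans (cong₂ (λ s t → ⟦ s ⟧ * W e₂ + + 2 * t) cutA₂ (cong₂ (λ s t → ⟦ s ⟧ * W e₂ + ⟦ t ⟧ * W e₂) (⁅⁆-other e₁≢e₂) (⁅⁆-self e₂)))
            (trans (lem₂ (W e₂)) (sym (cong₂ (λ s t → s + ⟦ t ⟧ * W e₂) (cong₂ (λ s t → ⟦ s ⟧ * W e₂ + ⟦ t ⟧ * W e₂) star-v₂ star-a₂) star-b₂)))))
          λ f n₁ n₂ → ≤-via ((⟦ star v f ⟧ + ⟦ star a f ⟧ + ⟦ star b f ⟧ - ⟦ cut A f ⟧) * W f)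
            (0≤* (diff (subst (λ s → ⟦ s ⟧ ≤ ⟦ star v f ⟧ + ⟦ star a f ⟧ + ⟦ star b f ⟧) (sym (cutA f)) (xor-≤ (star v f) (star a f) (star b f)))) (W≥0 f))
            (trans (lem₃ ⟦ star v f ⟧ ⟦ star a f ⟧ ⟦ star b f ⟧ ⟦ cut A f ⟧ (W f))
              (cong₂ (λ s t → R f - (⟦ cut A f ⟧ * W f + + 2 * (⟦ s ⟧ * W f + ⟦ t ⟧ * W f))) (sym (⁅⁆-other n₁)) (sym (⁅⁆-other n₂))))
          where
          lem₁ : ∀ w → 0ℤ * w + + 2 * (1ℤ * w + 0ℤ * w) ≡ 1ℤ * w + 1ℤ * w + 0ℤ * w
          lem₁ = solve-∀
          lem₂ : ∀ w → 0ℤ * w + + 2 * (0ℤ * w + 1ℤ * w) ≡ 1ℤ * w + 0ℤ * w + 1ℤ * w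
          lem₂ = solve-∀
          lem₃ : ∀ x y z c w → (x + y + z - c) * w ≡ x * w + y * w + z * w - (c * w + + 2 * (0ℤ * w + 0ℤ * w))
          lem₃ = solve-∀
        summed : ∑ L ≤ ∑ R
        summed = ∑-mono pointwise
        lhs : ∑ L ≡ weight W A + + 2 * (W e₁ + W e₂)
        lhs = trans (∑-+ (λ f → ⟦ cut A f ⟧ * W f) (λ f → + 2 * (⟦ ⁅ e₁ ⁆ f ⟧ * W f + ⟦ ⁅ e₂ ⁆ f ⟧ * W f))) (cong (ℤ._+_ (weight W A))
          (trans (sym (∑-* (+ 2) (λ f → ⟦ ⁅ e₁ ⁆ f ⟧ * W f + ⟦ ⁅ e₂ ⁆ f ⟧ * W f))) (cong (ℤ._*_ (+ 2))
            (trans (∑-+ (λ f → ⟦ ⁅ e₁ ⁆ f ⟧ * W f) (λ f → ⟦ ⁅ e₂ ⁆ f ⟧ * W f)) (cong₂ _+_ (∑-select e₁ W) (∑-select e₂ W))))))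
        rhs : ∑ R ≡ tot p + tot p + tot p
        rhs = trans (∑-+ (λ f → ⟦ star v f ⟧ * W f + ⟦ star a f ⟧ * W f) (λ f → ⟦ star b f ⟧ * W f)) (cong₂ _+_
          (trans (∑-+ (λ f → ⟦ star v f ⟧ * W f) (λ f → ⟦ star a f ⟧ * W f)) (cong₂ _+_ (tight-weight {p} tv) (tight-weight {p} ta))) (tight-weight {p} tb))

      primeA : ¬ Nontrivial A
      primeA = prime A oddA tightA
      -- The cut of `A` is the star of a vertex `w′` outside `A`; it turns out that `T` consists of
      -- `v`, `a`, `b` and `w′`.
      fourth = trivial-cut even A oddA primeA
      w′ = proj₁ fourth
      Tw = proj₁ (proj₂ fourth)
      starw : ∀ e → cut A e ≡ star w′ e
      starw = proj₂ (proj₂ fourth)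

      conflict : ∀ {x y e} → star x e ≡ true → star y e ≡ false → x ≢ y
      conflict s t refl = contradiction (trans (sym s) t) λ ()
      v≢w : v ≢ w′
      v≢w = conflict {e = e₁} star-v₁ (trans (sym (starw e₁)) cutA₁)
      a≢w : a ≢ w′
      a≢w = conflict {e = e₁} star-a₁ (trans (sym (starw e₁)) cutA₁)
      b≢w : b ≢ w′
      b≢w = conflict {e = e₂} star-b₂ (trans (sym (starw e₂)) cutA₂)

      Link : Fin m → Set
      Link f = (star b f ∧ star w′ f) ∧ supp p f ≡ true

      -- If no edge of the support joined `b` to `w′`, all weight at `w′` would come from `a`, and
      -- together with `e₁` it would exceed the weight of the star of `a`.
      link : ∃ Link
      link = go (Finₚ.any? λ f → ((star b f ∧ star w′ f) ∧ supp p f) Bool.≟ true)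
        where
        go : Dec (∃ Link) → ∃ Link
        go (yes q) = q
        go (no none) = contradiction (subst₂ _≤_ (trans (∑-+ (λ f → ⟦ star w′ f ⟧ * W f) (λ f → ⟦ ⁅ e₁ ⁆ f ⟧ * W f))
            (cong₂ _+_ (trans (∑-cong λ f → cong (λ s → ⟦ s ⟧ * W f) (sym (starw f))) tightA) (∑-select e₁ W))) (tight-weight {p} ta) (∑-mono pointwise))
            (ℤₚ.<⇒≱ (subst (_< tot p + W e₁) (ℤₚ.+-identityʳ _) (ℤₚ.+-monoʳ-< (tot p) (at-pos a₁))))
          where
          pointwise : ∀ f → ⟦ star w′ f ⟧ * W f + ⟦ ⁅ e₁ ⁆ f ⟧ * W f ≤ ⟦ star a f ⟧ * W f
          pointwise = by-edge _
            (ℤₚ.≤-reflexive (trans (cong₂ (λ s t → ⟦ s ⟧ * W e₁ + ⟦ t ⟧ * W e₁) (trans (sym (starw e₁)) cutA₁) (⁅⁆-self e₁)) (trans (lem (W e₁)) (cong (λ s → ⟦ s ⟧ * W e₁) (sym star-a₁)))))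
            (subst (_≤ ⟦ star a e₂ ⟧ * W e₂) (sym (cong₂ (λ s t → ⟦ s ⟧ * W e₂ + ⟦ t ⟧ * W e₂) (trans (sym (starw e₂)) cutA₂) (⁅⁆-other e₁≢e₂))) (0≤* (⟦⟧-nonneg (star a e₂)) (W≥0 e₂)))
            λ f n₁ n₂ → subst (_≤ ⟦ star a f ⟧ * W f) (sym (trans (cong (λ t → ⟦ star w′ f ⟧ * W f + ⟦ t ⟧ * W f) (⁅⁆-other n₁)) (ℤₚ.+-identityʳ _)))
              (rest f n₁ n₂ (supp p f) refl (star v f) refl (star a f) refl (star b f) refl)
            where
            lem : ∀ x → 0ℤ * x + 1ℤ * x ≡ 1ℤ * x
            lem = solve-∀
            zero-case : ∀ f s t → W f ≡ 0ℤ → ⟦ s ⟧ * W f ≤ ⟦ t ⟧ * W f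
            zero-case f s t z = ℤₚ.≤-reflexive (trans (trans (cong (⟦ s ⟧ *_) z) (ℤₚ.*-zeroʳ ⟦ s ⟧)) (sym (trans (cong (⟦ t ⟧ *_) z) (ℤₚ.*-zeroʳ ⟦ t ⟧))))
            w-val : ∀ f {x y z} → star v f ≡ x → star a f ≡ y → star b f ≡ z → star w′ f ≡ (x xor y) xor z
            w-val f refl refl refl = trans (sym (starw f)) (cutA f)
            rest : ∀ f → e₁ ≢ f → e₂ ≢ f → ∀ s → supp p f ≡ s → ∀ x → star v f ≡ x → ∀ y → star a f ≡ y → ∀ z → star b f ≡ z → ⟦ star w′ f ⟧ * W f ≤ ⟦ star a f ⟧ * W f
            rest f n₁ n₂ false es _ _ _ _ _ _ = zero-case f (star w′ f) (star a f) (not-supp {p} es)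
            rest f n₁ n₂ true es true ex _ _ _ _ = zero-case f (star w′ f) (star a f) (off-star f n₁ n₂ ex)
            rest f n₁ n₂ true es false ex y ey false ez = ℤₚ.≤-reflexive (cong (λ s → ⟦ s ⟧ * W f) (trans (w-val f ex ey ez) (trans (Boolₚ.xor-identityʳ y) (sym ey))))
            rest f n₁ n₂ true es false ex true ey true ez = subst (_≤ ⟦ star a f ⟧ * W f) (sym (cong (λ s → ⟦ s ⟧ * W f) (w-val f ex ey ez))) (0≤* (⟦⟧-nonneg (star a f)) (W≥0 f))
            rest f n₁ n₂ true es false ex false ey true ez = contradiction (f , ∧-join (∧-join ez (w-val f ex ey ez)) es) none

      e₃ = proj₁ link
      split₃ = ∧-split (star b e₃ ∧ star w′ e₃) (proj₂ link)
      star-b₃ = proj₁ (∧-split (star b e₃) (proj₁ split₃))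
      star-w₃ = proj₂ (∧-split (star b e₃) (proj₁ split₃))
      E₃ = ends-of e₃ b star-b₃
      oth₃ : oth e₃ b ≡ w′
      oth₃ = go (toSum (oth e₃ b Fin.≟ w′))
        where
        go : oth e₃ b ≡ w′ ⊎ oth e₃ b ≢ w′ → oth e₃ b ≡ w′
        go (inj₁ q) = q
        go (inj₂ q) = contradiction (trans (sym star-w₃) (star-third star-b₃ (b≢w ∘ sym) (q ∘ sym))) λ ()

      S₁ S₃ : Fin n → Bool
      S₁ x = ⁅ v ⁆ x xor ⁅ a ⁆ x
      S₃ x = ⁅ b ⁆ x xor ⁅ w′ ⁆ x
      star₁ : ∀ x → star x e₁ ≡ S₁ x
      star₁ = Ends.star≡ E₁
      star₃ : ∀ x → star x e₃ ≡ S₃ x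
      star₃ x = trans (Ends.star≡ E₃ x) (cong (λ y → ⁅ b ⁆ x xor ⁅ y ⁆ x) oth₃)

      by-vertex : ∀ {ℓ} (P : Fin n → Set ℓ) → P v → P a → P b → P w′ → (∀ x → v ≢ x → a ≢ x → b ≢ x → w′ ≢ x → P x) → ∀ x → P x
      by-vertex P pv pa pb pw rest x = go (toSum (v Fin.≟ x)) (toSum (a Fin.≟ x)) (toSum (b Fin.≟ x)) (toSum (w′ Fin.≟ x))
        where
        go : v ≡ x ⊎ v ≢ x → a ≡ x ⊎ a ≢ x → b ≡ x ⊎ b ≢ x → w′ ≡ x ⊎ w′ ≢ x → P x
        go (inj₁ refl) _ _ _ = pv
        go (inj₂ _) (inj₁ refl) _ _ = pa
        go (inj₂ _) (inj₂ _) (inj₁ refl) _ = pb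
        go (inj₂ _) (inj₂ _) (inj₂ _) (inj₁ refl) = pw
        go (inj₂ q) (inj₂ r) (inj₂ s) (inj₂ t) = rest x q r s t

      off₁ : ∀ {x} → v ≢ x → a ≢ x → S₁ x ≡ false
      off₁ q r = cong₂ _xor_ (⁅⁆-other q) (⁅⁆-other r)
      off₃ : ∀ {x} → b ≢ x → w′ ≢ x → S₃ x ≡ false
      off₃ q r = cong₂ _xor_ (⁅⁆-other q) (⁅⁆-other r)
      S₁v : S₁ v ≡ true
      S₁v = cong₂ _xor_ (⁅⁆-self v) (⁅⁆-other (v≢a ∘ sym))
      S₁a : S₁ a ≡ true
      S₁a = cong₂ _xor_ (⁅⁆-other v≢a) (⁅⁆-self a)
      S₃b : S₃ b ≡ true
      S₃b = cong₂ _xor_ (⁅⁆-self b) (⁅⁆-other (b≢w ∘ sym))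
      S₃w : S₃ w′ ≡ true
      S₃w = cong₂ _xor_ (⁅⁆-other b≢w) (⁅⁆-self w′)

      J : Subsetᵇ m
      J = ⁅ e₁ ⁆ △ ⁅ e₃ ⁆

      -- A vertex of T outside v, a, b, w would make the tight cut A nontrivial.
      parity : ∀ x → ⨁ (λ e → J e ∧ star x e) ≡ T x
      parity x = trans (⨁-△ ⁅ e₁ ⁆ ⁅ e₃ ⁆ (star x)) (trans (cong₂ _xor_ (trans (⨁-single e₁ (star x)) (star₁ x)) (trans (⨁-single e₃ (star x)) (star₃ x)))
        (by-vertex (λ x → S₁ x xor S₃ x ≡ T x)
          (trans (cong₂ _xor_ S₁v (off₃ (v≢b ∘ sym) (v≢w ∘ sym))) (sym (tight-T {p} tv)))
          (trans (cong₂ _xor_ S₁a (off₃ (a≢b ∘ sym) (a≢w ∘ sym))) (sym (tight-T {p} ta)))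
          (trans (cong₂ _xor_ (off₁ v≢b a≢b) S₃b) (sym (tight-T {p} tb)))
          (trans (cong₂ _xor_ (off₁ v≢w a≢w) S₃w) (sym Tw))
          (λ x nv na nb nw → trans (cong₂ _xor_ (off₁ nv na) (off₃ nb nw)) (sym (outside x nv na nb nw (T x) refl))) x))
        where
        outside : ∀ x → v ≢ x → a ≢ x → b ≢ x → w′ ≢ x → ∀ t → T x ≡ t → T x ≡ false
        outside x nv na nb nw false eq = eq
        outside x nv na nb nw true eq = contradiction
          (nontrivial (T-alive v (tight-T {p} tv)) (T-alive a (tight-T {p} ta)) (T-alive x eq) (T-alive w′ Tw) v≢a (nw ∘ sym)
            (cong₂ _xor_ S₁v (⁅⁆-other (v≢b ∘ sym))) (cong₂ _xor_ S₁a (⁅⁆-other (a≢b ∘ sym)))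
            (cong₂ _xor_ (off₁ nv na) (⁅⁆-other nb)) (cong₂ _xor_ (off₁ v≢w a≢w) (⁅⁆-other b≢w))) primeA

      member : ∀ e → J e ≡ true → e ≡ e₁ ⊎ e ≡ e₃
      member e je = go (toSum (e₁ Fin.≟ e)) (toSum (e₃ Fin.≟ e))
        where
        go : e₁ ≡ e ⊎ e₁ ≢ e → e₃ ≡ e ⊎ e₃ ≢ e → e ≡ e₁ ⊎ e ≡ e₃
        go (inj₁ q) _ = inj₁ (sym q)
        go (inj₂ _) (inj₁ q) = inj₂ (sym q)
        go (inj₂ q) (inj₂ r) = contradiction (trans (sym je) (cong₂ _xor_ (⁅⁆-other q) (⁅⁆-other r))) λ ()

      apart : ∀ x → star x e₁ ≡ true → star x e₃ ≡ true → ⊥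
      apart x s t = by-vertex (λ x → S₁ x ≡ true → S₃ x ≡ true → ⊥)
        (λ _ q → clash (off₃ (v≢b ∘ sym) (v≢w ∘ sym)) q) (λ _ q → clash (off₃ (a≢b ∘ sym) (a≢w ∘ sym)) q)
        (λ q _ → clash (off₁ v≢b a≢b) q) (λ q _ → clash (off₁ v≢w a≢w) q) (λ x q r _ _ s _ → clash (off₁ q r) s)
        x (trans (sym (star₁ x)) s) (trans (sym (star₃ x)) t)
        where
        clash : ∀ {b} → b ≡ false → b ≡ true → ⊥
        clash refl ()

    -- The edges from `v` to `a` and from `b` to `w′` match the four vertices of `T` perfectly.
    matching : Compat J
    matching = record
      { parity = λ x _ → parity x
      ; support = λ e je → sup e (member e je)
      ; unique = λ x _ _ e f p q → uniq x (proj₂ (∧-split (J e) p)) (proj₂ (∧-split (J f) q)) (member e (proj₁ (∧-split (J e) p))) (member f (proj₁ (∧-split (J f) q)))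
      }
      where
      sup : ∀ e → e ≡ e₁ ⊎ e ≡ e₃ → supp p e ≡ true
      sup _ (inj₁ refl) = at-supp a₁
      sup _ (inj₂ refl) = proj₂ split₃
      uniq : ∀ x {e f} → star x e ≡ true → star x f ≡ true → e ≡ e₁ ⊎ e ≡ e₃ → f ≡ e₁ ⊎ f ≡ e₃ → e ≡ f
      uniq x s t (inj₁ refl) (inj₁ refl) = refl
      uniq x s t (inj₂ refl) (inj₂ refl) = refl
      uniq x s t (inj₁ refl) (inj₂ refl) = ⊥-elim (apart x s t)
      uniq x s t (inj₂ refl) (inj₁ refl) = ⊥-elim (apart x t s)

  -- Three edges at `v` give a share of 3, and so do two edges if one of them leads to a vertex that
  -- is not tight. Each remaining case settles the search on its own.
  classify : ∀ v → tight p v ≡ true → Outcome ⊎ (+ 3 ≤ ∑ (share v))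
  classify v tv = second (proj₁ some) (proj₂ some) (Finₚ.any? λ f → at? f ×-dec ¬? (f Fin.≟ proj₁ some))
    where
    open AtVertex v tv
    third : ∀ {e₁ e₂} → At e₁ → At e₂ → e₂ ≢ e₁ → Dec (∃ λ f → At f × (f ≢ e₁ × f ≢ e₂)) → Outcome ⊎ (+ 3 ≤ ∑ (share v))
    third {e₁} {e₂} a₁ a₂ ne (yes (e₃ , a₃ , n₁ , n₂)) = inj₂ (ℤₚ.≤-trans (ℤₚ.+-mono-≤ (ℤₚ.+-mono-≤ (w≥1 a₁) (w≥1 a₂)) (w≥1 a₃))
      (∑-three (share v) 0≤w (ne ∘ sym) (n₁ ∘ sym) (n₂ ∘ sym)))
    third {e₁} {e₂} a₁ a₂ ne (no none) = neighbours (tight p (oth e₁ v)) refl (tight p (oth e₂ v)) refl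
      where
      only : ∀ f → At f → f ≡ e₁ ⊎ f ≡ e₂
      only f af = go (toSum (f Fin.≟ e₁)) (toSum (f Fin.≟ e₂))
        where
        go : f ≡ e₁ ⊎ f ≢ e₁ → f ≡ e₂ ⊎ f ≢ e₂ → f ≡ e₁ ⊎ f ≡ e₂
        go (inj₁ q) _ = inj₁ q
        go (inj₂ _) (inj₁ q) = inj₂ q
        go (inj₂ q) (inj₂ r) = contradiction (f , af , q , r) none
      neighbours : ∀ s → tight p (oth e₁ v) ≡ s → ∀ t → tight p (oth e₂ v) ≡ t → Outcome ⊎ (+ 3 ≤ ∑ (share v))
      neighbours false s _ _ = inj₂ (ℤₚ.≤-trans (ℤₚ.+-mono-≤ (w≥2 a₁ s) (w≥1 a₂)) (∑-two (share v) 0≤w (ne ∘ sym)))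
      neighbours true s false t = inj₂ (ℤₚ.≤-trans (ℤₚ.+-mono-≤ (w≥1 a₁) (w≥2 a₂ t)) (∑-two (share v) 0≤w (ne ∘ sym)))
      neighbours true s true t = inj₁ (settle (toSum (oth e₁ v Fin.≟ oth e₂ v)))
        where
        settle : oth e₁ v ≡ oth e₂ v ⊎ oth e₁ v ≢ oth e₂ v → Outcome
        settle (inj₁ q) = parallel a₁ a₂ (ne ∘ sym) q
        settle (inj₂ q) = inj₁ (_ , TwoEdges.matching v tv a₁ a₂ (ne ∘ sym) only s t q)
    second : ∀ e₁ → At e₁ → Dec (∃ λ f → At f × f ≢ e₁) → Outcome ⊎ (+ 3 ≤ ∑ (share v))
    second e₁ a₁ (yes (e₂ , a₂ , ne)) = third a₁ a₂ ne (Finₚ.any? λ f → at? f ×-dec (¬? (f Fin.≟ e₁) ×-dec ¬? (f Fin.≟ e₂)))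
    second e₁ a₁ (no none) = inj₁ (inj₂ (Pendant.pendant-good e₁ a₁ λ f af → settle f af (toSum (f Fin.≟ e₁))))
      where
      settle : ∀ f → At f → f ≡ e₁ ⊎ f ≢ e₁ → f ≡ e₁
      settle f af (inj₁ q) = q
      settle f af (inj₂ q) = contradiction (f , af , q) none

  share-total : ∀ e → ∑ (λ x → ⟦ tight p x ⟧ * share x e) ≤ + 2 * ⟦ supp p e ⟧
  share-total e = ℤₚ.≤-trans (∑-mono pointwise) (subst (_≤ + 2 * ⟦ supp p e ⟧)
      (sym (trans (∑-+ (λ x → ⟦ ⁅ src e ⁆ x ⟧ * α) (λ x → ⟦ ⁅ tgt e ⁆ x ⟧ * β)) (cong₂ _+_ (∑-select (src e) (λ _ → α)) (∑-select (tgt e) (λ _ → β)))))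
      (bound (tight p (src e)) (tight p (tgt e)) (supp p e)))
    where
    half : Bool → Bool → Bool → ℤ
    half s t q = ⟦ s ⟧ * (⟦ q ⟧ * (1ℤ + ⟦ not t ⟧))
    half≥0 : ∀ s t q → 0ℤ ≤ half s t q
    half≥0 s t q = 0≤* (⟦⟧-nonneg s) (0≤* (⟦⟧-nonneg q) (0≤+ (+≤+ z≤n) (⟦⟧-nonneg (not t))))
    α = half (tight p (src e)) (tight p (tgt e)) (supp p e)
    β = half (tight p (tgt e)) (tight p (src e)) (supp p e)
    bound : ∀ s t q → half s t q + half t s q ≤ + 2 * ⟦ q ⟧
    bound true true true = ℤₚ.≤-refl
    bound true false true = ℤₚ.≤-refl
    bound false true true = ℤₚ.≤-refl
    bound false false true = +≤+ z≤n
    bound true true false = ℤₚ.≤-refl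
    bound true false false = ℤₚ.≤-refl
    bound false true false = ℤₚ.≤-refl
    bound false false false = ℤₚ.≤-refl
    right≥0 : ∀ x → 0ℤ ≤ ⟦ ⁅ src e ⁆ x ⟧ * α + ⟦ ⁅ tgt e ⁆ x ⟧ * β
    right≥0 x = 0≤+ (0≤* (⟦⟧-nonneg (⁅ src e ⁆ x)) (half≥0 (tight p (src e)) (tight p (tgt e)) (supp p e)))
                    (0≤* (⟦⟧-nonneg (⁅ tgt e ⁆ x)) (half≥0 (tight p (tgt e)) (tight p (src e)) (supp p e)))
    pointwise : ∀ x → ⟦ tight p x ⟧ * share x e ≤ ⟦ ⁅ src e ⁆ x ⟧ * α + ⟦ ⁅ tgt e ⁆ x ⟧ * β
    pointwise x = go (star x e) refl
      where
      go : ∀ b → star x e ≡ b → ⟦ tight p x ⟧ * share x e ≤ ⟦ ⁅ src e ⁆ x ⟧ * α + ⟦ ⁅ tgt e ⁆ x ⟧ * β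
      go false eq = subst (_≤ ⟦ ⁅ src e ⁆ x ⟧ * α + ⟦ ⁅ tgt e ⁆ x ⟧ * β) (sym (trans (cong (λ b → ⟦ tight p x ⟧ * (⟦ b ∧ supp p e ⟧ * (1ℤ + ⟦ not (tight p (oth e x)) ⟧))) eq) (ℤₚ.*-zeroʳ ⟦ tight p x ⟧))) (right≥0 x)
      go true eq = at (ends x e eq)
        where
        one : ∀ y → ⟦ ⁅ y ⁆ y ⟧ ≡ 1ℤ
        one y = cong ⟦_⟧ (⁅⁆-self y)
        none : ∀ {y z} → y ≢ z → ⟦ ⁅ y ⁆ z ⟧ ≡ 0ℤ
        none ne = cong ⟦_⟧ (⁅⁆-other ne)
        left : ∀ y → oth e x ≡ y → ⟦ tight p x ⟧ * share x e ≡ half (tight p x) (tight p y) (supp p e)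
        left y o = cong₂ (λ b y → ⟦ tight p x ⟧ * (⟦ b ∧ supp p e ⟧ * (1ℤ + ⟦ not (tight p y) ⟧))) eq o
        lem₁ : ∀ a b → a ≡ 1ℤ * a + 0ℤ * b
        lem₁ = solve-∀
        lem₂ : ∀ a b → b ≡ 0ℤ * a + 1ℤ * b
        lem₂ = solve-∀
        at : (src e ≡ x × tgt e ≢ x) ⊎ (tgt e ≡ x × src e ≢ x) → ⟦ tight p x ⟧ * share x e ≤ ⟦ ⁅ src e ⁆ x ⟧ * α + ⟦ ⁅ tgt e ⁆ x ⟧ * β
        at (inj₁ (refl , ne)) = ℤₚ.≤-reflexive (trans (left (tgt e) (cong (λ b → Bool.if b then tgt e else src e) (⁅⁆-self (src e))))
          (trans (lem₁ α β) (sym (cong₂ (λ s t → s * α + t * β) (one (src e)) (none ne)))))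
        at (inj₂ (refl , ne)) = ℤₚ.≤-reflexive (trans (left (src e) (cong (λ b → Bool.if b then tgt e else src e) (⁅⁆-other (ne ∘ sym))))
          (trans (lem₂ α β) (sym (cong₂ (λ s t → s * α + t * β) (none ne) (one (tgt e))))))

  #tight #supp : ℤ
  #tight = ∑ (λ x → ⟦ tight p x ⟧)
  #supp = ∑ (λ e → ⟦ supp p e ⟧)

  -- Double counting: a tight vertex receives shares of at least 3, and an edge of the support hands
  -- out at most 2.
  sparse : (∀ x → tight p x ≡ true → + 3 ≤ ∑ (share x)) → + 3 * #tight ≤ + 2 * #supp
  sparse many = subst₂ _≤_ (trans (sym (∑-* (+ 3) (λ x → ⟦ tight p x ⟧))) refl) (sym (∑-* (+ 2) (λ e → ⟦ supp p e ⟧)))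
      (ℤₚ.≤-trans (∑-mono rows) (ℤₚ.≤-trans (ℤₚ.≤-reflexive (trans (∑-cong λ x → ∑-* ⟦ tight p x ⟧ (share x)) (∑-swap (λ x e → ⟦ tight p x ⟧ * share x e))))
        (∑-mono share-total)))
    where
    rows : ∀ x → + 3 * ⟦ tight p x ⟧ ≤ ⟦ tight p x ⟧ * ∑ (share x)
    rows x = go (tight p x) refl
      where
      go : ∀ b → tight p x ≡ b → + 3 * ⟦ tight p x ⟧ ≤ ⟦ tight p x ⟧ * ∑ (share x)
      go true eq = subst (λ b → + 3 * ⟦ b ⟧ ≤ ⟦ b ⟧ * ∑ (share x)) (sym eq) (subst (+ 3 ≤_) (sym (ℤₚ.*-identityˡ _)) (many x eq))
      go false eq = subst (λ b → + 3 * ⟦ b ⟧ ≤ ⟦ b ⟧ * ∑ (share x)) (sym eq) ℤₚ.≤-refl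

  tightRows unitRows rows : List (Fin m → ℤ)
  tightRows = map (λ x e → ⟦ star x e ⟧) (filter (λ x → tight p x Bool.≟ true) (allFin n))
  unitRows = map (λ f e → ⟦ ⁅ f ⁆ e ⟧) (filter (λ f → not (supp p f) Bool.≟ true) (allFin m))
  rows = tightRows ++ unitRows

  rows-count : + length rows + #supp ≡ #tight + + m
  rows-count = trans (cong (_+ #supp) (trans (cong +_ (Listₚ.length-++ tightRows)) (cong₂ (λ a b → + a + + b) (Listₚ.length-map _ (filter (λ x → tight p x Bool.≟ true) (allFin n))) (Listₚ.length-map _ (filter (λ f → not (supp p f) Bool.≟ true) (allFin m))))))
    (trans (cong₂ (λ a b → a + b + #supp) (length-filter (tight p)) (length-filter (not ∘ supp p)))
    (trans (ℤₚ.+-assoc #tight _ #supp) (cong (ℤ._+_ #tight) (trans (sym (∑-+ (λ f → ⟦ not (supp p f) ⟧) (λ f → ⟦ supp p f ⟧))) (trans (∑-cong λ f → one (supp p f)) (∑-1 m))))))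
    where
    one : ∀ b → ⟦ not b ⟧ + ⟦ b ⟧ ≡ 1ℤ
    one true = refl
    one false = refl

  -- The equations are one for each tight star and one for each edge outside the support. By
  -- `sparse` they are fewer than the edges, so a nonzero direction satisfies them all.
  by-elimination : (∀ x → tight p x ≡ true → + 3 ≤ ∑ (share x)) → 0ℤ < #supp → Outcome
  by-elimination many some = follow± d off stars (proj₁ (proj₁ (proj₂ K))) (proj₂ (proj₁ (proj₂ K)))
    where
    fewer : #tight < #supp
    fewer = ℤₚ.≰⇒> λ le → ℤₚ.<⇒≱ some (≤-via _ (0≤+ (diff (sparse many)) (0≤* {+ 3} (+≤+ z≤n) (diff le))) (lem #tight #supp))
      where
      lem : ∀ t s → (+ 2 * s - + 3 * t) + + 3 * (t - s) ≡ 0ℤ - s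
      lem = solve-∀
    short : length rows ℕ.< m
    short = ℤₚ.drop‿+<+ (ℤₚ.≰⇒> λ le → ℤₚ.<⇒≱ (subst₂ _<_ (sym rows-count) (ℤₚ.+-comm #supp (+ m)) (ℤₚ.+-monoˡ-< (+ m) fewer)) (ℤₚ.+-monoˡ-≤ #supp le))
    K = kernel-vector rows short
    d = proj₁ K
    annihilated = proj₂ (proj₂ K)
    off : ∀ e → wt p e ≡ 0ℤ → d e ≡ 0ℤ
    off e z = trans (sym (∑-select e d)) (All.lookup annihilated (∈-++⁺ʳ tightRows (∈-map⁺ (λ f e → ⟦ ⁅ f ⁆ e ⟧)
      (∈-filter⁺ (λ f → not (supp p f) Bool.≟ true) (∈-allFin e) (cong not (zero-not-supp {p} z))))))
    stars : ∀ v → tight p v ≡ true → weight d ⁅ v ⁆ ≡ 0ℤ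
    stars v tv = All.lookup annihilated (∈-++⁺ˡ (∈-map⁺ (λ x e → ⟦ star x e ⟧) (∈-filter⁺ (λ x → tight p x Bool.≟ true) (∈-allFin v) tv)))

  -- Without support every star has weight 0, so none of them is an odd cut and `T` is empty.
  empty-join : ¬ (0ℤ < #supp) → Compat (λ _ → false)
  empty-join none = record
    { parity = λ x _ → trans (⨁-0 m) (sym (untouched x (T x) refl))
    ; support = λ _ ()
    ; unique = λ _ _ _ _ _ ()
    }
    where
    zero-everywhere : ∀ e → wt p e ≡ 0ℤ
    zero-everywhere e = not-supp {p} (go (supp p e) refl)
      where
      go : ∀ b → supp p e ≡ b → supp p e ≡ false
      go false eq = eq
      go true eq = contradiction (ℤₚ.<-≤-trans (ℤ.+<+ (s≤s z≤n)) (subst (λ b → ⟦ b ⟧ ≤ #supp) eq (∑-term _ (λ e → ⟦⟧-nonneg (supp p e)) e))) none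
    untouched : ∀ x b → T x ≡ b → T x ≡ false
    untouched x false eq = eq
    untouched x true eq = contradiction (subst (tot p ≤_) (trans (∑-cong λ e → trans (cong (⟦ star x e ⟧ *_) (zero-everywhere e)) (ℤₚ.*-zeroʳ ⟦ star x e ⟧)) (∑-0 m))
      (valid-cut {p} vp ⁅ x ⁆ (trans (odd-star x) eq))) (ℤₚ.<⇒≱ pos)

  outcome : Outcome
  outcome = go (gather λ x → at x (tight p x) refl)
    where
    at : ∀ x b → tight p x ≡ b → Outcome ⊎ (tight p x ≡ true → + 3 ≤ ∑ (share x))
    at x false eq = inj₂ λ t → contradiction (trans (sym t) eq) λ ()
    at x true eq = cases (classify x eq)
      where
      cases : Outcome ⊎ (+ 3 ≤ ∑ (share x)) → Outcome ⊎ (tight p x ≡ true → + 3 ≤ ∑ (share x))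
      cases (inj₁ o) = inj₁ o
      cases (inj₂ q) = inj₂ λ _ → q
    go : Outcome ⊎ (∀ x → tight p x ≡ true → + 3 ≤ ∑ (share x)) → Outcome
    go (inj₁ o) = o
    go (inj₂ many) = settle (0ℤ ℤ.<? #supp)
      where
      settle : Dec (0ℤ < #supp) → Outcome
      settle (yes q) = by-elimination many q
      settle (no q) = inj₁ (_ , empty-join q)

  prime-good : Good p
  prime-good = go outcome
    where
    go : Outcome → Good p
    go (inj₁ (J , c)) = good-from-compat c
    go (inj₂ g) = g

-- The two nested inductions

module _ {m n} (G : Graft m n)
  (IHG : ∀ (H : Graft m n) → card (Graft.alive H) ℕ.< card (Graft.alive G) → ∀ {x} → Weights.Valid H x → Weights.Good H x) where
  open Graft G
  open Weights G
  open Constraints G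
  open Measure G

  valid⇒good-step : ∀ p → Valid p → Acc ℕ._<_ (μ p) → Good p
  valid⇒good-step p vp (acc smaller) = cases (tot p ℤ.≟ 0ℤ) (anySubset? crossing?)
    where
    Crossing : Subsetᵇ n → Set
    Crossing U = (odd U ≡ true × weight (wt p) U ≡ tot p) × Nontrivial U
    crossing? : ∀ (U : Subset n) → Dec (Crossing (lookup U))
    crossing? U = ((odd (lookup U) Bool.≟ true) ×-dec (weight (wt p) (lookup U) ℤ.≟ tot p)) ×-dec nontrivial? (lookup U)
    crossing-cong : ∀ {U V} → U ≗ V → Crossing U → Crossing V
    crossing-cong e ((o , w) , nontrivial ax ay az aw ne ne′ ux uy uz uw) =
      (trans (sym (odd-cong e)) o , trans (sym (weight-cong (wt p) e)) w) ,
      nontrivial ax ay az aw ne ne′ (trans (sym (e _)) ux) (trans (sym (e _)) uy) (trans (sym (e _)) uz) (trans (sym (e _)) uw)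
    cases : Dec (tot p ≡ 0ℤ) → Dec (∃ λ (U : Subset n) → Crossing (lookup U)) → Good p
    cases (yes z) _ = good-trivial {p} vp z
    cases (no nz) (yes (U , (o , w) , nt)) = nontrivial-good IHG {p} vp (lookup U) o w nt
    cases (no nz) (no none) = Step.prime-good G IHG p vp (≢0⇒0< (vp total tt) nz) (λ {q} vq lt → valid⇒good-step q vq (smaller lt))
      λ U o w nt → none (tabulate U , crossing-cong (sym ∘ lookup∘tabulate U) ((o , w) , nt))

valid⇒good : ∀ {m n} (G : Graft m n) {p} → Weights.Valid G p → Weights.Good G p
valid⇒good G = go G (<-wellFounded _)
  where
  go : ∀ {m n} (G : Graft m n) → Acc ℕ._<_ (card (Graft.alive G)) → ∀ {p} → Weights.Valid G p → Weights.Good G p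
  go G (acc fewer) {p} vp = valid⇒good-step G (λ H lt {x} → go H (fewer lt) {x}) p vp (<-wellFounded _)

open import Defs

-- Dyadic rationals

frac : ℕ → ℤ → ℚ
frac k a = (a ℚ./ (2 ℕ.^ k)) {{ℕₚ.m^n≢0 2 k}}

∣2^⇒2^ : ∀ k {d} → d Div.∣ 2 ℕ.^ k → ∃ λ j → d ≡ 2 ℕ.^ j
∣2^⇒2^ zero d∣1 = 0 , Div.∣1⇒≡1 d∣1
∣2^⇒2^ (suc k) {d} (divides q eq) = go (euclidsLemma q d prime[2] (divides (2 ℕ.^ k) (trans (sym eq) (ℕₚ.*-comm 2 (2 ℕ.^ k)))))
  where
  go : 2 Div.∣ q ⊎ 2 Div.∣ d → ∃ λ j → d ≡ 2 ℕ.^ j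
  go (inj₁ (divides q′ refl)) = ∣2^⇒2^ k (divides q′ (ℕₚ.*-cancelˡ-≡ _ _ 2 (trans eq (trans (cong (ℕ._* d) (ℕₚ.*-comm q′ 2)) (ℕₚ.*-assoc 2 q′ d)))))
  go (inj₂ (divides d′ refl)) = let (j , e) = ∣2^⇒2^ k {d′} (divides q (ℕₚ.*-cancelˡ-≡ _ _ 2 (trans eq (trans (sym (ℕₚ.*-assoc q d′ 2)) (ℕₚ.*-comm (q ℕ.* d′) 2)))))
                                in suc j , trans (ℕₚ.*-comm d′ 2) (cong (2 ℕ.*_) e)

-- The reduced denominator divides `2 ^ k`, and divisors of powers of two are powers of two.
frac-dyadic : ∀ k a → Dyadic (frac k a)
frac-dyadic k a = ∣2^⇒2^ k (divides g (trans (ℤₚ.+-injective (trans (sym (ℚₚ.↧-/ a (2 ℕ.^ k) {{ℕₚ.m^n≢0 2 k}})) (sym (ℤₚ.pos-* (ℚ.denominatorℕ (frac k a)) g))))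
                            (ℕₚ.*-comm (ℚ.denominatorℕ (frac k a)) g)))
  where
  g = ℤ.∣ ℤ-GCD.gcd a (+ (2 ℕ.^ k)) ∣

module _ (N : ℕ) where

  private
    q : ℤ → ℚ
    q a = a ℚ./ suc N
    s : ℤ
    s = + suc N

  /-unfold : ∀ a → ℚ.toℚᵘ (q a) ℚᵘ.≃ mkℚᵘ a N
  /-unfold a = ℚₚ.toℚᵘ-fromℚᵘ (mkℚᵘ a N)

  /-+ : ∀ a b → q (a + b) ≡ q a ℚ.+ q b
  /-+ a b = ℚₚ.toℚᵘ-injective (ℚᵘₚ.≃-trans (/-unfold (a + b)) (ℚᵘₚ.≃-trans (*≡* (trans (cong ((a + b) *_) (ℤₚ.pos-* (suc N) (suc N))) (lem a b s)))
    (ℚᵘₚ.≃-sym (ℚᵘₚ.≃-trans (ℚₚ.toℚᵘ-homo-+ (q a) (q b)) (ℚᵘₚ.+-cong (/-unfold a) (/-unfold b))))))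
    where
    lem : ∀ a b s → (a + b) * (s * s) ≡ (a * s + b * s) * s
    lem = solve-∀

  /-neg : ∀ a → q (- a) ≡ ℚ.- q a
  /-neg a = ℚₚ.toℚᵘ-injective (ℚᵘₚ.≃-trans (/-unfold (- a)) (ℚᵘₚ.≃-sym (ℚᵘₚ.≃-trans (ℚₚ.toℚᵘ-homo‿- (q a)) (ℚᵘₚ.-‿cong (/-unfold a)))))

  /-cancel : ∀ a → q (s * a) ≡ ℤ→ℚ a
  /-cancel a = ℚₚ.toℚᵘ-injective (ℚᵘₚ.≃-trans (/-unfold (s * a)) (ℚᵘₚ.≃-trans (*≡* (lem a s)) (ℚᵘₚ.≃-sym (ℚₚ.toℚᵘ-fromℚᵘ (mkℚᵘ a 0)))))
    where
    lem : ∀ a s → s * a * 1ℤ ≡ a * s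
    lem = solve-∀

  /-mono : ∀ {a b} → a ≤ b → q a ℚ.≤ q b
  /-mono {a} {b} le = ℚₚ.toℚᵘ-cancel-≤ (ℚᵘₚ.≤-trans (ℚᵘₚ.≤-reflexive (/-unfold a)) (ℚᵘₚ.≤-trans (*≤* (ℤₚ.*-monoʳ-≤-nonNeg s le)) (ℚᵘₚ.≤-reflexive (ℚᵘₚ.≃-sym (/-unfold b)))))

  /-reflects : ∀ {a b} → q a ℚ.≤ q b → a ≤ b
  /-reflects {a} {b} le = go (ℚᵘₚ.≤-trans (ℚᵘₚ.≤-reflexive (ℚᵘₚ.≃-sym (/-unfold a))) (ℚᵘₚ.≤-trans (ℚₚ.toℚᵘ-mono-≤ le) (ℚᵘₚ.≤-reflexive (/-unfold b))))
    where
    go : mkℚᵘ a N ℚᵘ.≤ mkℚᵘ b N → a ≤ b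
    go (*≤* p) = ℤₚ.*-cancelʳ-≤-pos a b s p

  /-0 : q 0ℤ ≡ 0ℚ
  /-0 = ℚₚ.toℚᵘ-injective (ℚᵘₚ.≃-trans (/-unfold 0ℤ) (*≡* refl))

-- Sums over lists of subsets

sumL : ∀ {A : Set} → List A → (A → ℤ) → ℤ
sumL [] f = 0ℤ
sumL (x ∷ xs) f = f x + sumL xs f

sumL-cong : ∀ {A : Set} (xs : List A) {f g : A → ℤ} → f ≗ g → sumL xs f ≡ sumL xs g
sumL-cong [] e = refl
sumL-cong (x ∷ xs) e = cong₂ _+_ (e x) (sumL-cong xs e)

sumL-++ : ∀ {A : Set} (xs ys : List A) f → sumL (xs ++ ys) f ≡ sumL xs f + sumL ys f
sumL-++ [] ys f = sym (ℤₚ.+-identityˡ _)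
sumL-++ (x ∷ xs) ys f = trans (cong (ℤ._+_ (f x)) (sumL-++ xs ys f)) (sym (ℤₚ.+-assoc (f x) _ _))

sumL-map : ∀ {A B : Set} (h : A → B) xs f → sumL (map h xs) f ≡ sumL xs (f ∘ h)
sumL-map h [] f = refl
sumL-map h (x ∷ xs) f = cong (ℤ._+_ (f (h x))) (sumL-map h xs f)

sumL-+ : ∀ {A : Set} (xs : List A) f g → sumL xs (λ x → f x + g x) ≡ sumL xs f + sumL xs g
sumL-+ [] f g = refl
sumL-+ (x ∷ xs) f g = trans (cong (ℤ._+_ (f x + g x)) (sumL-+ xs f g)) (lem (f x) (g x) (sumL xs f) (sumL xs g))
  where
  lem : ∀ a b c d → a + b + (c + d) ≡ a + c + (b + d)
  lem = solve-∀

sumL-0 : ∀ {A : Set} (xs : List A) → sumL xs (λ _ → 0ℤ) ≡ 0ℤ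
sumL-0 [] = refl
sumL-0 (x ∷ xs) = trans (ℤₚ.+-identityˡ _) (sumL-0 xs)

same : ∀ {k} → Subset k → Subset k → Bool
same [] [] = true
same (a ∷ A) (b ∷ B) = not (a xor b) ∧ same A B

same⇒≡ : ∀ {k} (A B : Subset k) → same A B ≡ true → A ≡ B
same⇒≡ [] [] p = refl
same⇒≡ (true ∷ A) (true ∷ B) p = cong (true ∷_) (same⇒≡ A B p)
same⇒≡ (false ∷ A) (false ∷ B) p = cong (false ∷_) (same⇒≡ A B p)

-- The enumeration `allSubsets` contains every subset exactly once, so only the term at `K`
-- survives.
sum-same : ∀ {k} (K : Subset k) (f : Subset k → ℤ) → sumL (allSubsets k) (λ J → f J * ⟦ same K J ⟧) ≡ f K
sum-same [] f = lem (f [])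
  where
  lem : ∀ a → a * 1ℤ + 0ℤ ≡ a
  lem = solve-∀
sum-same {suc k} (b ∷ K) f = trans (sumL-++ (map (true ∷_) (allSubsets k)) (map (false ∷_) (allSubsets k)) F)
    (trans (cong₂ _+_ (sumL-map (true ∷_) (allSubsets k) F) (sumL-map (false ∷_) (allSubsets k) F)) (go b refl))
  where
  F : Subset (suc k) → ℤ
  F J = f J * ⟦ same (b ∷ K) J ⟧
  vanish : ∀ c → (∀ J → same (b ∷ K) (c ∷ J) ≡ false) → sumL (allSubsets k) (F ∘ (c ∷_)) ≡ 0ℤ
  vanish c e = trans (sumL-cong (allSubsets k) λ J → trans (cong (λ b → f (c ∷ J) * ⟦ b ⟧) (e J)) (ℤₚ.*-zeroʳ (f (c ∷ J)))) (sumL-0 (allSubsets k))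
  go : ∀ b′ → b ≡ b′ → sumL (allSubsets k) (F ∘ (true ∷_)) + sumL (allSubsets k) (F ∘ (false ∷_)) ≡ f (b ∷ K)
  go true refl = trans (cong₂ _+_ (sum-same K (f ∘ (true ∷_))) (vanish false λ _ → refl)) (ℤₚ.+-identityʳ _)
  go false refl = trans (cong₂ _+_ (vanish true λ _ → refl) (sum-same K (f ∘ (false ∷_)))) (ℤₚ.+-identityˡ _)

-- Joins in a packing are functions; they are tabulated because the dual variables are indexed by
-- vectors, whose equality can be tested.
multiplicity : ∀ {m} → List (Subsetᵇ m) → Subset m → ℤ
multiplicity [] J = 0ℤ
multiplicity (K ∷ Ks) J = ⟦ same (tabulate K) J ⟧ + multiplicity Ks J

multiplicity-nonneg : ∀ {m} (Ks : List (Subsetᵇ m)) J → 0ℤ ≤ multiplicity Ks J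
multiplicity-nonneg [] J = +≤+ z≤n
multiplicity-nonneg (K ∷ Ks) J = 0≤+ (⟦⟧-nonneg (same (tabulate K) J)) (multiplicity-nonneg Ks J)

sum-multiplicity : ∀ {m} (f : Subset m → ℤ) K Ks →
  sumL (allSubsets m) (λ J → f J * multiplicity (K ∷ Ks) J) ≡ f (tabulate K) + sumL (allSubsets m) (λ J → f J * multiplicity Ks J)
sum-multiplicity {m} f K Ks = trans (sumL-cong (allSubsets m) λ J → ℤₚ.*-distribˡ-+ (f J) ⟦ same (tabulate K) J ⟧ (multiplicity Ks J))
  (trans (sumL-+ (allSubsets m) (λ J → f J * ⟦ same (tabulate K) J ⟧) (λ J → f J * multiplicity Ks J)) (cong (_+ sumL (allSubsets m) (λ J → f J * multiplicity Ks J)) (sum-same (tabulate K) f)))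

sum-load : ∀ {m} (Ks : List (Subsetᵇ m)) e → sumL (allSubsets m) (λ J → ⟦ lookup J e ⟧ * multiplicity Ks J) ≡ load Ks e
sum-load {m} [] e = trans (sumL-cong (allSubsets m) λ J → ℤₚ.*-zeroʳ ⟦ lookup J e ⟧) (sumL-0 (allSubsets m))
sum-load (K ∷ Ks) e = trans (sum-multiplicity (λ J → ⟦ lookup J e ⟧) K Ks) (cong₂ _+_ (cong ⟦_⟧ (lookup∘tabulate K e)) (sum-load Ks e))

sum-length : ∀ {m} (Ks : List (Subsetᵇ m)) → sumL (allSubsets m) (multiplicity Ks) ≡ + length Ks
sum-length {m} Ks = trans (sumL-cong (allSubsets m) λ J → sym (ℤₚ.*-identityˡ _)) (go Ks)
  where
  go : ∀ Ks → sumL (allSubsets m) (λ J → 1ℤ * multiplicity Ks J) ≡ + length Ks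
  go [] = sumL-0 (allSubsets m)
  go (K ∷ Ks) = trans (sum-multiplicity (λ _ → 1ℤ) K Ks) (cong (ℤ._+_ 1ℤ) (go Ks))

sumListℚ-cong : ∀ {A : Set} (xs : List A) {f g : A → ℚ} → f ≗ g → sumListℚ xs f ≡ sumListℚ xs g
sumListℚ-cong [] e = refl
sumListℚ-cong (x ∷ xs) e = cong₂ ℚ._+_ (e x) (sumListℚ-cong xs e)

sumListℚ-mono : ∀ {A : Set} (xs : List A) {f g : A → ℚ} → (∀ x → f x ℚ.≤ g x) → sumListℚ xs f ℚ.≤ sumListℚ xs g
sumListℚ-mono [] e = ℚₚ.≤-refl
sumListℚ-mono (x ∷ xs) e = ℚₚ.+-mono-≤ (e x) (sumListℚ-mono xs e)

sumListℚ-/ : ∀ {A : Set} N (xs : List A) f → sumListℚ xs (λ x → f x ℚ./ suc N) ≡ sumL xs f ℚ./ suc N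
sumListℚ-/ N [] f = sym (/-0 N)
sumListℚ-/ N (x ∷ xs) f = trans (cong ((f x ℚ./ suc N) ℚ.+_) (sumListℚ-/ N xs f)) (sym (/-+ N (f x) (sumL xs f)))

sumListℚ-* : ∀ {A : Set} a (xs : List A) f → sumListℚ xs (λ x → a ℚ.* f x) ≡ a ℚ.* sumListℚ xs f
sumListℚ-* a [] f = sym (ℚₚ.*-zeroʳ a)
sumListℚ-* a (x ∷ xs) f = trans (cong (a ℚ.* f x ℚ.+_) (sumListℚ-* a xs f)) (sym (ℚₚ.*-distribˡ-+ a (f x) _))

sumFinℚ-mono : ∀ k {f g : Fin k → ℚ} → (∀ i → f i ℚ.≤ g i) → sumFinℚ k f ℚ.≤ sumFinℚ k g
sumFinℚ-mono zero e = ℚₚ.≤-refl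
sumFinℚ-mono (suc k) e = ℚₚ.+-mono-≤ (e zero) (sumFinℚ-mono k (e ∘ suc))

sumFinℚ-cong : ∀ k {f g : Fin k → ℚ} → f ≗ g → sumFinℚ k f ≡ sumFinℚ k g
sumFinℚ-cong zero e = refl
sumFinℚ-cong (suc k) e = cong₂ ℚ._+_ (e zero) (sumFinℚ-cong k (e ∘ suc))

sumFinℚ-0 : ∀ k → sumFinℚ k (λ _ → 0ℚ) ≡ 0ℚ
sumFinℚ-0 zero = refl
sumFinℚ-0 (suc k) = trans (ℚₚ.+-identityˡ _) (sumFinℚ-0 k)

sumFinℚ-nonneg : ∀ k {f : Fin k → ℚ} → (∀ i → 0ℚ ℚ.≤ f i) → 0ℚ ℚ.≤ sumFinℚ k f
sumFinℚ-nonneg k {f} p = subst (ℚ._≤ sumFinℚ k f) (sumFinℚ-0 k) (sumFinℚ-mono k p)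

sumFinℚ-term : ∀ k {f : Fin k → ℚ} → (∀ i → 0ℚ ℚ.≤ f i) → ∀ i → f i ℚ.≤ sumFinℚ k f
sumFinℚ-term (suc k) {f} p zero = ℚₚ.≤-trans (ℚₚ.≤-reflexive (sym (ℚₚ.+-identityʳ _))) (ℚₚ.+-monoʳ-≤ (f zero) (sumFinℚ-nonneg k (p ∘ suc)))
sumFinℚ-term (suc k) {f} p (suc i) = ℚₚ.≤-trans (sumFinℚ-term k (p ∘ suc) i) (ℚₚ.≤-trans (ℚₚ.≤-reflexive (sym (ℚₚ.+-identityˡ _))) (ℚₚ.+-monoˡ-≤ _ (p zero)))

sumFinℚ-+ : ∀ k (f g : Fin k → ℚ) → sumFinℚ k (λ i → f i ℚ.+ g i) ≡ sumFinℚ k f ℚ.+ sumFinℚ k g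
sumFinℚ-+ zero f g = refl
sumFinℚ-+ (suc k) f g = trans (cong (f zero ℚ.+ g zero ℚ.+_) (sumFinℚ-+ k (f ∘ suc) (g ∘ suc))) (interchange (f zero) (g zero) _ _)
  where
  interchange : ∀ a b c d → a ℚ.+ b ℚ.+ (c ℚ.+ d) ≡ a ℚ.+ c ℚ.+ (b ℚ.+ d)
  interchange a b c d = trans (ℚₚ.+-assoc a b _) (trans (cong (a ℚ.+_) (trans (sym (ℚₚ.+-assoc b c d)) (trans (cong (ℚ._+ d) (ℚₚ.+-comm b c)) (ℚₚ.+-assoc c b d)))) (sym (ℚₚ.+-assoc a c _)))

sum-swap : ∀ {A : Set} (xs : List A) k (f : A → Fin k → ℚ) → sumListℚ xs (λ x → sumFinℚ k (f x)) ≡ sumFinℚ k (λ i → sumListℚ xs (λ x → f x i))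
sum-swap [] k f = sym (sumFinℚ-0 k)
sum-swap (x ∷ xs) k f = trans (cong (sumFinℚ k (f x) ℚ.+_) (sum-swap xs k f)) (sym (sumFinℚ-+ k (f x) (λ i → sumListℚ xs (λ x → f x i))))

sumFinℚ-∑ : ∀ k (f : Fin k → ℤ) → sumFinℚ k (λ i → ℤ→ℚ (f i)) ≡ ℤ→ℚ (∑ f)
sumFinℚ-∑ zero f = sym (cong ℤ→ℚ (trans (∑-cong {g = λ _ → 0ℤ} λ ()) (∑-0 0)))
sumFinℚ-∑ (suc k) f = trans (cong (ℤ→ℚ (f zero) ℚ.+_) (sumFinℚ-∑ k (f ∘ suc))) (trans (sym (/-+ 0 (f zero) (∑ (f ∘ suc)))) (cong ℤ→ℚ (sym (∑-suc f))))

-- Parity of degrees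

parity : ℕ → Bool
parity zero = false
parity (suc d) = not (parity d)

parity-+ : ∀ a b → parity (a ℕ.+ b) ≡ parity a xor parity b
parity-+ zero b = refl
parity-+ (suc a) b = trans (cong not (parity-+ a b)) (Boolₚ.not-distribˡ-xor (parity a) (parity b))

odd⇒parity : ∀ d → OddNat d → parity d ≡ true
odd⇒parity 1 _ = refl
odd⇒parity (suc (suc d)) o = trans (Boolₚ.not-involutive _) (odd⇒parity d o)

parity⇒odd : ∀ d → parity d ≡ true → OddNat d
parity⇒odd 1 _ = refl
parity⇒odd (suc (suc d)) o = parity⇒odd d (trans (sym (Boolₚ.not-involutive _)) o)

opaque
  unfolding ⨁

  parity-sum : ∀ k (f : Fin k → ℕ) → parity (sumFinℕ k f) ≡ ⨁ (parity ∘ f)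
  parity-sum zero f = refl
  parity-sum (suc k) f = trans (parity-+ (f zero) _) (cong (parity (f zero) xor_) (parity-sum k (f ∘ suc)))

minimum : ∀ {A : Set} (f : A → ℤ) (L : List A) → (∀ x → 0ℤ ≤ f x) → ∀ {x} → x ∈ L → ∃ λ y → y ∈ L × (∀ {z} → z ∈ L → f y ≤ f z)
minimum f L nn x∈ = go (minimal-or-none f (λ _ → 1ℤ) L (λ {x} _ → nn x))
  where
  go : (∀ {i} → i ∈ L → 1ℤ ≤ 0ℤ) ⊎ (∃ λ i → i ∈ L × Minimal f (λ _ → 1ℤ) L i) → ∃ λ y → y ∈ L × (∀ {z} → z ∈ L → f y ≤ f z)
  go (inj₁ none) = contradiction (none x∈) λ { (+≤+ ()) }
  go (inj₂ (y , y∈ , _ , min)) = y , y∈ , λ z∈ → subst₂ _≤_ (ℤₚ.*-identityʳ _) (ℤₚ.*-identityʳ _) (min z∈)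

-- Weak duality and the dyadic optimal solution

module Packing (𝒢 : Graph) (𝒯 : Subset (n 𝒢)) where

  graft : Graft (m 𝒢) (n 𝒢)
  graft = record
    { src = proj₁ ∘ ends 𝒢
    ; tgt = proj₂ ∘ ends 𝒢
    ; T = lookup 𝒯
    ; alive = λ _ → true
    ; src-alive = λ _ → refl
    ; tgt-alive = λ _ → refl
    ; T-alive = λ _ _ → refl
    }

  open Graft graft
  open Weights graft
  open Stars graft hiding (ends)
  open Constraints graft using (odd?)

  degree-parity : ∀ J v → parity (degree 𝒢 J v) ≡ ⨁ (λ e → lookup J e ∧ star v e)
  degree-parity J v = trans (parity-sum (m 𝒢) (λ e → bool→ℕ (lookup J e) ℕ.* incidence 𝒢 e v)) (⨁-cong λ e → term (lookup J e) e)
    where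
    at : ∀ {x} (d : Dec (x ≡ v)) → parity [ d ]ᵈ ≡ ⁅ v ⁆ x
    at (yes refl) = sym (⁅⁆-self v)
    at (no ne) = sym (⁅⁆-other (ne ∘ sym))
    term : ∀ b e → parity (bool→ℕ b ℕ.* incidence 𝒢 e v) ≡ b ∧ star v e
    term false e = refl
    term true e = trans (cong parity (ℕₚ.+-identityʳ (incidence 𝒢 e v))) (trans (parity-+ [ src e Fin.≟ v ]ᵈ [ tgt e Fin.≟ v ]ᵈ) (cong₂ _xor_ (at (src e Fin.≟ v)) (at (tgt e Fin.≟ v))))

  isTJoin⇒join : ∀ {J} → IsTJoin 𝒢 𝒯 J → Join (lookup J)
  isTJoin⇒join {J} j = join-from-stars λ v → trans (sym (degree-parity J v)) (agree (parity (degree 𝒢 J v)) refl (T v) refl)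
    where
    agree : ∀ {v} b → parity (degree 𝒢 J v) ≡ b → ∀ t → T v ≡ t → parity (degree 𝒢 J v) ≡ T v
    agree {v} true p _ _ = trans p (sym ([]=⇒lookup (Equivalence.to (j v) (parity⇒odd (degree 𝒢 J v) p))))
    agree {v} false p false q = trans p (sym q)
    agree {v} false p true q = trans (odd⇒parity (degree 𝒢 J v) (Equivalence.from (j v) (lookup⇒[]= v 𝒯 q))) (sym q)

  join⇒isTJoin : ∀ {J} → Join (lookup J) → IsTJoin 𝒢 𝒯 J
  join⇒isTJoin {J} j v = mk⇔ (λ o → lookup⇒[]= v 𝒯 (trans (sym parity≡) (odd⇒parity (degree 𝒢 J v) o)))
      (λ v∈ → parity⇒odd (degree 𝒢 J v) (trans parity≡ ([]=⇒lookup v∈)))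
    where
    parity≡ : parity (degree 𝒢 J v) ≡ T v
    parity≡ = trans (degree-parity J v) (trans (j ⁅ v ⁆) (odd-star v))

  multiplicity-off : ∀ {Ks} → All Join Ks → ∀ J → ¬ IsTJoin 𝒢 𝒯 J → multiplicity Ks J ≡ 0ℤ
  multiplicity-off [] J nj = refl
  multiplicity-off {K ∷ Ks} (k ∷ ks) J nj = cong₂ (λ b l → ⟦ b ⟧ + l) (go (same (tabulate K) J) refl) (multiplicity-off ks J nj)
    where
    go : ∀ b → same (tabulate K) J ≡ b → same (tabulate K) J ≡ false
    go false eq = eq
    go true eq = contradiction (join⇒isTJoin {J} λ U → trans (⨁-cong λ e → cong (_∧ cut U e)
      (trans (cong (λ J → lookup J e) (sym (same⇒≡ (tabulate K) J eq))) (lookup∘tabulate K e))) (k U)) nj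

  coverage : DualVec 𝒢 → Fin (m 𝒢) → ℚ
  coverage d e = sumListℚ (allSubsets (m 𝒢)) (λ J → bool→ℚ (lookup J e) ℚ.* y d J)

  *-nonneg : ∀ b {x} → 0ℚ ℚ.≤ x → 0ℚ ℚ.≤ bool→ℚ b ℚ.* x
  *-nonneg true {x} p = subst (0ℚ ℚ.≤_) (sym (ℚₚ.*-identityˡ x)) p
  *-nonneg false {x} p = ℚₚ.≤-reflexive (sym (ℚₚ.*-zeroˡ x))

  coverage-≤ : ∀ {w d} → DualFeasible 𝒢 𝒯 w d → ∀ e → coverage d e ℚ.≤ ℤ→ℚ (- w e)
  coverage-≤ {w} {d} (_ , _ , z≥0 , eq) e = subst₂ ℚ._≤_ (ℚₚ.+-identityʳ s) (trans sum≡ (trans (cong ℚ.-_ (eq e)) (sym (/-neg 0 (w e))))) (ℚₚ.+-monoʳ-≤ s (z≥0 e))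
    where
    s = coverage d e
    t = z d e
    sum≡ : s ℚ.+ t ≡ ℚ.- (ℚ.- s ℚ.- t)
    sum≡ = sym (trans (ℚₚ.neg-distrib-+ (ℚ.- s) (ℚ.- t)) (cong₂ ℚ._+_ (⁻¹-involutive s) (⁻¹-involutive t)))

  coverage-nonneg : ∀ {w d} → DualFeasible 𝒢 𝒯 w d → ∀ e → 0ℚ ℚ.≤ coverage d e
  coverage-nonneg {w} {d} (y≥0 , _) e = sumList-nonneg (allSubsets (m 𝒢))
    where
    sumList-nonneg : ∀ Js → 0ℚ ℚ.≤ sumListℚ Js (λ J → bool→ℚ (lookup J e) ℚ.* y d J)
    sumList-nonneg [] = ℚₚ.≤-refl
    sumList-nonneg (J ∷ Js) = ℚₚ.+-mono-≤ (*-nonneg (lookup J e) (y≥0 J)) (sumList-nonneg Js)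

  -- A feasible dual vector writes `- w e` as a sum of nonnegative terms.
  cost-nonneg : ∀ {w d} → DualFeasible 𝒢 𝒯 w d → ∀ e → 0ℤ ≤ - w e
  cost-nonneg {w} {d} f e = /-reflects 0 (ℚₚ.≤-trans (coverage-nonneg {w} {d} f e) (coverage-≤ {w} {d} f e))

  -- Weak duality against the incidence vector of an odd cut.
  packing-≤-cut : ∀ {w d} → DualFeasible 𝒢 𝒯 w d → ∀ U → odd U ≡ true →
                  sumListℚ (allSubsets (m 𝒢)) (y d) ℚ.≤ ℤ→ℚ (weight (λ e → - w e) U)
  packing-≤-cut {w} {d} f@(y≥0 , y-off , _) U o = ℚₚ.≤-trans (sumListℚ-mono (allSubsets (m 𝒢)) crosses)
      (ℚₚ.≤-trans (ℚₚ.≤-reflexive (trans (sum-swap (allSubsets (m 𝒢)) (m 𝒢) term) (sumFinℚ-cong (m 𝒢) λ e → sumListℚ-* (bool→ℚ (cut U e)) (allSubsets (m 𝒢)) (λ J → bool→ℚ (lookup J e) ℚ.* y d J))))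
      (ℚₚ.≤-trans (sumFinℚ-mono (m 𝒢) (λ e → bounded e (cut U e))) (ℚₚ.≤-reflexive (sumFinℚ-∑ (m 𝒢) (λ e → ⟦ cut U e ⟧ * - w e)))))
    where
    term : Subset (m 𝒢) → Fin (m 𝒢) → ℚ
    term J e = bool→ℚ (cut U e) ℚ.* (bool→ℚ (lookup J e) ℚ.* y d J)
    term-nonneg : ∀ J e → 0ℚ ℚ.≤ term J e
    term-nonneg J e = *-nonneg (cut U e) (*-nonneg (lookup J e) (y≥0 J))
    crosses : ∀ J → y d J ℚ.≤ sumFinℚ (m 𝒢) (term J)
    crosses J = go (Finₚ.any? λ e → (lookup J e ∧ cut U e) Bool.≟ true)
      where
      go : Dec (∃ λ e → lookup J e ∧ cut U e ≡ true) → y d J ℚ.≤ sumFinℚ (m 𝒢) (term J)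
      go (yes (e , p)) = ℚₚ.≤-trans (ℚₚ.≤-reflexive (sym (one (lookup J e) (cut U e) p))) (sumFinℚ-term (m 𝒢) (term-nonneg J) e)
        where
        one : ∀ a b → a ∧ b ≡ true → bool→ℚ b ℚ.* (bool→ℚ a ℚ.* y d J) ≡ y d J
        one true true _ = trans (ℚₚ.*-identityˡ _) (ℚₚ.*-identityˡ (y d J))
      go (no none) = subst (ℚ._≤ sumFinℚ (m 𝒢) (term J)) (sym (y-off J λ j → none (⨁-true⇒ _ (trans (isTJoin⇒join {J} j U) o)))) (sumFinℚ-nonneg (m 𝒢) (term-nonneg J))
    bounded : ∀ e b → bool→ℚ b ℚ.* coverage d e ℚ.≤ ℤ→ℚ (⟦ b ⟧ * - w e)
    bounded e true = subst₂ ℚ._≤_ (sym (ℚₚ.*-identityˡ (coverage d e))) (cong ℤ→ℚ (sym (ℤₚ.*-identityˡ (- w e)))) (coverage-≤ {w} {d} f e)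
    bounded e false = ℚₚ.≤-reflexive (trans (ℚₚ.*-zeroˡ (coverage d e)) (sym (/-0 0)))

  module _ (w : Fin (m 𝒢) → ℤ) (c≥0 : ∀ e → 0ℤ ≤ - w e) {v : Fin (n 𝒢)} (v∈T : lookup 𝒯 v ≡ true) where

    private
      c : Fin (m 𝒢) → ℤ
      c e = - w e

    -- The star of `v` is an odd cut, so the minimum is taken over a list that is not empty.
    smallest : ∃ λ U → U ∈ filter odd? (allSubsets (n 𝒢)) × (∀ {V} → V ∈ filter odd? (allSubsets (n 𝒢)) → weight c (lookup U) ≤ weight c (lookup V))
    smallest = minimum (λ U → weight c (lookup U)) (filter odd? (allSubsets (n 𝒢))) (λ U → weight-nonneg (lookup U) c≥0)
      (∈-filter⁺ odd? (∈-allSubsets (tabulate ⁅ v ⁆)) (trans (odd-cong (lookup∘tabulate ⁅ v ⁆)) (trans (odd-star v) v∈T)))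

    U₀ : Subset (n 𝒢)
    U₀ = proj₁ smallest

    odd-U₀ : odd (lookup U₀) ≡ true
    odd-U₀ = proj₂ (∈-filter⁻ odd? {xs = allSubsets (n 𝒢)} (proj₁ (proj₂ smallest)))

    τ : ℤ
    τ = weight c (lookup U₀)

    cut-condition : Valid (point c τ)
    cut-condition (edge e) _ = c≥0 e
    cut-condition total _ = weight-nonneg (lookup U₀) c≥0
    cut-condition (cutset U) o = diff (proj₂ (proj₂ smallest) (∈-filter⁺ odd? (∈-allSubsets U) o))

    optimal : ∃ λ d → DualOptimal 𝒢 𝒯 w d × DyadicVec 𝒢 d
    optimal = finish (valid⇒good graft cut-condition)
      where
      finish : Good (point c τ) → ∃ λ d → DualOptimal 𝒢 𝒯 w d × DyadicVec 𝒢 d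
      finish (good k Js joins cnt packed) = split (2 ℕ.^ k) refl
        where
        d : DualVec 𝒢
        d = dualVec (λ J → frac k (multiplicity Js J)) (λ e → frac k (2^ k * c e - load Js e))
        dyadic : DyadicVec 𝒢 d
        dyadic = (λ J → frac-dyadic k (multiplicity Js J)) , (λ e → frac-dyadic k (2^ k * c e - load Js e))
        -- The lemmas on fractions have a denominator of the form `suc N`, so `2 ^ k` has to be
        -- exposed as a successor.
        split : ∀ N → 2 ℕ.^ k ≡ N → ∃ λ d → DualOptimal 𝒢 𝒯 w d × DyadicVec 𝒢 d
        split zero eq = contradiction (ℕₚ.m^n≡0⇒m≡0 2 k eq) λ ()
        split (suc N) eq = d , ((y≥0 , y-off , z≥0 , balance) , best) , dyadic
          where
          frac≡ : ∀ a → frac k a ≡ a ℚ./ suc N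
          frac≡ a = ℚₚ./-cong {p₁ = a} {{ℕₚ.m^n≢0 2 k}} refl eq
          y≥0 : ∀ J → 0ℚ ℚ.≤ y d J
          y≥0 J = subst₂ ℚ._≤_ (/-0 N) (sym (frac≡ (multiplicity Js J))) (/-mono N (multiplicity-nonneg Js J))
          y-off : ∀ J → ¬ IsTJoin 𝒢 𝒯 J → y d J ≡ 0ℚ
          y-off J nj = trans (frac≡ (multiplicity Js J)) (trans (cong (ℚ._/ suc N) (multiplicity-off joins J nj)) (/-0 N))
          z≥0 : ∀ e → 0ℚ ℚ.≤ z d e
          z≥0 e = subst₂ ℚ._≤_ (/-0 N) (sym (frac≡ (2^ k * c e - load Js e))) (/-mono N (diff (packed e)))
          covered : ∀ e → coverage d e ≡ load Js e ℚ./ suc N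
          covered e = trans (sumListℚ-cong (allSubsets (m 𝒢)) λ J → trans (cong (bool→ℚ (lookup J e) ℚ.*_) (frac≡ (multiplicity Js J))) (times (lookup J e) (multiplicity Js J)))
              (trans (sumListℚ-/ N (allSubsets (m 𝒢)) (λ J → ⟦ lookup J e ⟧ * multiplicity Js J)) (cong (ℚ._/ suc N) (sum-load Js e)))
            where
            times : ∀ b a → bool→ℚ b ℚ.* (a ℚ./ suc N) ≡ (⟦ b ⟧ * a) ℚ./ suc N
            times true a = trans (ℚₚ.*-identityˡ (a ℚ./ suc N)) (cong (ℚ._/ suc N) (sym (ℤₚ.*-identityˡ a)))
            times false a = trans (ℚₚ.*-zeroˡ (a ℚ./ suc N)) (sym (/-0 N))
          balance : ∀ e → ℚ.- coverage d e ℚ.- z d e ≡ ℤ→ℚ (w e)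
          balance e = begin
            ℚ.- coverage d e ℚ.- z d e                                   ≡⟨ cong₂ (λ s t → ℚ.- s ℚ.- t) (covered e) (frac≡ r) ⟩
            ℚ.- (l ℚ./ suc N) ℚ.- (r ℚ./ suc N)                          ≡⟨ cong₂ ℚ._+_ (/-neg N l) (/-neg N r) ⟨
            ((- l) ℚ./ suc N) ℚ.+ ((- r) ℚ./ suc N)                      ≡⟨ /-+ N (- l) (- r) ⟨
            (- l + - r) ℚ./ suc N                                        ≡⟨ cong (ℚ._/ suc N) (trans (lem l (2^ k) (w e)) (cong (λ N → + N * w e) eq)) ⟩
            (+ suc N * w e) ℚ./ suc N                                    ≡⟨ /-cancel N (w e) ⟩
            ℤ→ℚ (w e)                                                    ∎
            where
            open ≡-Reasoning
            l = load Js e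
            r = 2^ k * c e - load Js e
            lem : ∀ l k w → - l + - (k * - w - l) ≡ k * w
            lem = solve-∀
          objective : sumListℚ (allSubsets (m 𝒢)) (y d) ≡ ℤ→ℚ τ
          objective = trans (sumListℚ-cong (allSubsets (m 𝒢)) λ J → frac≡ (multiplicity Js J)) (trans (sumListℚ-/ N (allSubsets (m 𝒢)) (multiplicity Js))
            (trans (cong (ℚ._/ suc N) (trans (sum-length Js) (trans cnt (cong (λ N → + N * τ) eq)))) (/-cancel N τ)))
          best : ∀ d′ → DualFeasible 𝒢 𝒯 w d′ → dualObjective 𝒢 d ℚ.≤ dualObjective 𝒢 d′
          best d′ f = ℚₚ.neg-antimono-≤ (subst (sumListℚ (allSubsets (m 𝒢)) (y d′) ℚ.≤_) (sym objective) (packing-≤-cut {w} {d′} f (lookup U₀) odd-U₀))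

theorem1p8 : (G : Graph) (T : Subset (n G)) →
  Nonempty T → EvenNat ∣ T ∣ → TJoinSystemTDD G T
theorem1p8 G T (v , v∈) _ w (d , feasible , _) = Packing.optimal G T w (Packing.cost-nonneg G T {w} {d} feasible) ([]=⇒lookup v∈)
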